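{- Let $\mu,\nu$ be partitions and let $l=u_1(\nu)$ (the length of $\nu$). Then $$s_\mu s_\nu=\sum_\lambda c^\lambda_{\mu,\nu}s_\lambda=\sum_{(\mu=\mu^0,\mu^1,\ldots,\mu^l)} s_{\mu^l},$$ where the last sum is over all sequences of partitions $(\mu^0=\mu,\mu^1,\ldots,\mu^l)$ such that for each $1\le i\le l$ the code of $\mu^i$ is obtained from the code of $\mu^{i-1}$ as follows: working from the U immediately left of the leftmost R in the code of $\mu^{i-1}$ to the right, the U's are moved to the right a total of $r_i(\nu)$ places by switching a UR to RU in the code $r_i(\nu)$ times, with no U moving past the starting position of the next U to its right in the code; and, writing $k(i,j)$ for the number of UR$\to$RU switches in step $i$ made using the last (rightmost) $j$ U's (so $k(i,0)=0$), one has $k(i,j)\le k(i-1,j-1)$ for all $i,j$. In particular $c^\lambda_{\mu,\nu}$ equals the number of such sequences with $\mu^l=\lambda$.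
   Context: A partition $\lambda=(\lambda_1\ge\cdots\ge\lambda_l>0)$; $s_\lambda$ is the Schur function and $c^\lambda_{\mu,\nu}$ the Littlewood–Richardson coefficients defined by $s_\mu s_\nu=\sum_\lambda c^\lambda_{\mu,\nu}s_\lambda$. The code of a partition $\lambda$: place the Young diagram (row $i$ has $\lambda_i$ boxes, rows top to bottom, left-justified) top-left aligned in the fourth quadrant; trace up the negative $y$-axis to the bottom of the diagram, then along the lower-right boundary of the diagram, then right along the positive $x$-axis; the code is the doubly infinite sequence of letters R (unit right step) and U (unit up step) along this path. Switching UR to RU in the code moves a U one place right and adds one box to the corresponding row. For a partition $\nu$, $u_1(\nu)$ is the number of U's in the code to the right of the first R from the left (equal to the number of parts of $\nu$), and $r_i(\nu)$ is the number of R's to the left of the $i$-th U from the right (equal to $\nu_i$). -}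

module Defs where

open import Data.Bool using (Bool; true; false; _∧_; not; if_then_else_; T)
open import Data.Nat using (ℕ; zero; suc; _+_; _*_; _∸_; _≤ᵇ_; _≡ᵇ_; _<ᵇ_)
open import Data.List using (List; []; _∷_; _++_; length; map; reverse; replicate; concatMap; zipWith; concat; filterᵇ)
open import Data.Nat.ListAction using (sum)

allᵇ : {A : Set} → (A → Bool) → List A → Bool
allᵇ p [] = true
allᵇ p (x ∷ xs) = p x ∧ allᵇ p xs

_⇒ᵇ_ : Bool → Bool → Bool
a ⇒ᵇ b = not a Data.Bool.∨ b

rangeFrom : ℕ → ℕ → List ℕ
rangeFrom a zero = []
rangeFrom a (suc k) = a ∷ rangeFrom (suc a) k

upto1 : ℕ → List ℕ
upto1 n = rangeFrom 1 n

upto0 : ℕ → List ℕ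
upto0 n = rangeFrom 0 (suc n)

listsOf : {A : Set} → ℕ → List A → List (List A)
listsOf zero xs = [] ∷ []
listsOf (suc k) xs = concatMap (λ x → map (x ∷_) (listsOf k xs)) xs

eqList : List ℕ → List ℕ → Bool
eqList [] [] = true
eqList (x ∷ xs) (y ∷ ys) = (x ≡ᵇ y) ∧ eqList xs ys
eqList _ _ = false

count : ℕ → List ℕ → ℕ
count c [] = 0
count c (x ∷ xs) = if c ≡ᵇ x then suc (count c xs) else count c xs

isPartition : List ℕ → Bool
isPartition [] = true
isPartition (x ∷ []) = 1 ≤ᵇ x
isPartition (x ∷ y ∷ xs) = (y ≤ᵇ x) ∧ isPartition (y ∷ xs)

size : List ℕ → ℕ
size = sum

-- all partitions of n (each exactly once): a partition of n has at most n
-- parts, each between 1 and n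
partitionsOf : ℕ → List (List ℕ)
partitionsOf n =
  filterᵇ (λ p → isPartition p ∧ (sum p ≡ᵇ n))
          (concatMap (λ k → listsOf k (upto1 n)) (upto0 n))

-- Codes of partitions.
-- The (doubly infinite) code of λ is  U^∞ · codeMid λ · R^∞  where
--   codeMid λ = R^{λ_l} U R^{λ_{l-1}-λ_l} U ... R^{λ_1-λ_2} U
-- (the lower-right boundary of the diagram traced from (0,-l) to (λ₁,0)).

data Letter : Set where
  U R : Letter

codeMid : List ℕ → List Letter
codeMid la = go 0 (reverse la)
  where
  go : ℕ → List ℕ → List Letter
  go prev [] = []
  go prev (p ∷ ps) = replicate (p ∸ prev) R ++ (U ∷ go p ps)

countR : List Letter → ℕ
countR [] = 0
countR (R ∷ w) = suc (countR w)
countR (U ∷ w) = countR w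

countU : List Letter → ℕ
countU [] = 0
countU (U ∷ w) = suc (countU w)
countU (R ∷ w) = countU w

-- r i λ  (i ≥ 1): number of R's in the code to the left of the i-th U from the right.
-- (U's of the infinite U-tail have no R to their left.)
rIdx : ℕ → List ℕ → ℕ
rIdx i la = go i (reverse (codeMid la))
  where
  go : ℕ → List Letter → ℕ
  go n [] = 0
  go n (R ∷ w) = go n w
  go zero (U ∷ w) = 0
  go (suc zero) (U ∷ w) = countR w
  go (suc (suc n)) (U ∷ w) = go (suc n) w

u₁ : List ℕ → ℕ
u₁ la = countU (afterFirstR (codeMid la))
  where
  afterFirstR : List Letter → List Letter
  afterFirstR [] = []          -- first R lies in the R^∞ tail: nothing to its right but R's
  afterFirstR (R ∷ w) = w
  afterFirstR (U ∷ w) = afterFirstR w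

-- One step  μ → μ'  moving U's a total of a places.
-- The U's that may move are the U immediately left of the leftmost R and all U's
-- to its right, i.e. the U's with index 1 .. u₁ μ + 1 counted from the right.
-- The U with index j has moved (rIdx j μ' ∸ rIdx j μ) places (= number of UR→RU
-- switches using it).  The bound B covers all U's that can possibly be affected.

movable : List ℕ → ℕ
movable μ = suc (u₁ μ)

bound : List ℕ → List ℕ → ℕ
bound μ μ' = length μ + length μ' + 2

moved : List ℕ → List ℕ → ℕ → ℕ
moved μ μ' j = rIdx j μ' ∸ rIdx j μ

validStep : List ℕ → List ℕ → ℕ → Bool
validStep μ μ' a =
  allᵇ (λ j →
          (rIdx j μ ≤ᵇ rIdx j μ')
        ∧ ((movable μ <ᵇ j) ⇒ᵇ (rIdx j μ' ≡ᵇ rIdx j μ))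
        ∧ ((2 ≤ᵇ j) ⇒ᵇ (rIdx j μ' ≤ᵇ rIdx (j ∸ 1) μ)))
       (upto1 (bound μ μ'))
  ∧ (sum (map (moved μ μ') (upto1 (movable μ))) ≡ᵇ a)

kSw : List ℕ → List ℕ → ℕ → ℕ
kSw μ μ' j = sum (map (moved μ μ') (upto1 j))

-- condition k(i,j) ≤ k(i-1,j-1) for consecutive steps μ0 → μ1 → μ2, all j ≥ 1
-- (beyond the bound both sides are constant)
kCond : List ℕ → List ℕ → List ℕ → Bool
kCond μ0 μ1 μ2 =
  allᵇ (λ j → kSw μ1 μ2 j ≤ᵇ kSw μ0 μ1 (j ∸ 1))
       (upto1 (length μ0 + length μ1 + length μ2 + 2))

validSeq : List ℕ → List ℕ → List (List ℕ) → Bool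
validSeq μ ν s = headOk s ∧ (length s ≡ᵇ suc (u₁ ν)) ∧ steps 1 s ∧ kconds s
  where
  headOk : List (List ℕ) → Bool
  headOk [] = false
  headOk (p ∷ _) = eqList p μ
  steps : ℕ → List (List ℕ) → Bool
  steps i (p ∷ q ∷ rest) = isPartition q ∧ validStep p q (rIdx i ν) ∧ steps (suc i) (q ∷ rest)
  steps i _ = true
  kconds : List (List ℕ) → Bool
  kconds (p ∷ q ∷ t ∷ rest) = kCond p q t ∧ kconds (q ∷ t ∷ rest)
  kconds _ = true

-- Candidate sequences: μ⁰ = μ and μ^i ranging over all partitions of
-- |μ| + r₁(ν) + ... + r_i(ν)  (each switch adds exactly one box).
candidates : List ℕ → List ℕ → List (List (List ℕ))
candidates μ ν = map (μ ∷_) (go (size μ) (map (λ i → rIdx i ν) (upto1 (u₁ ν))))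
  where
  go : ℕ → List ℕ → List (List (List ℕ))
  go n [] = [] ∷ []
  go n (a ∷ as) = concatMap (λ p → map (p ∷_) (go (n + a) as)) (partitionsOf (n + a))

lastOr : List ℕ → List (List ℕ) → List ℕ
lastOr d [] = d
lastOr d (p ∷ ps) = lastOr p ps

-- Schur functions, via their monomial coefficients.
-- A monomial x₁^{α₁} ⋯ x_n^{α_n} is given by α : List ℕ.
-- [x^α] s_λ = number of semistandard Young tableaux of shape λ and content α.

rowWeak : List ℕ → Bool
rowWeak [] = true
rowWeak (x ∷ []) = true
rowWeak (x ∷ y ∷ xs) = (x ≤ᵇ y) ∧ rowWeak (y ∷ xs)

colStrict : List ℕ → List ℕ → Bool    -- upper row, lower row
colStrict _ [] = true
colStrict [] (_ ∷ _) = false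
colStrict (x ∷ xs) (y ∷ ys) = (x <ᵇ y) ∧ colStrict xs ys

isSSYT : List (List ℕ) → Bool
isSSYT t = allᵇ rowWeak t ∧ cols t
  where
  cols : List (List ℕ) → Bool
  cols (r1 ∷ r2 ∷ rs) = colStrict r1 r2 ∧ cols (r2 ∷ rs)
  cols _ = true

hasContent : List ℕ → List (List ℕ) → Bool
hasContent α t = allᵇ (λ c → count c (concat t) ≡ᵇ ci c α) (upto1 (length α))
  where
  ci : ℕ → List ℕ → ℕ
  ci _ [] = 0
  ci zero (_ ∷ _) = 0
  ci (suc zero) (x ∷ _) = x
  ci (suc (suc k)) (_ ∷ xs) = ci (suc k) xs

fillings : List ℕ → ℕ → List (List (List ℕ))
fillings [] n = [] ∷ []
fillings (r ∷ rs) n = concatMap (λ row → map (row ∷_) (fillings rs n)) (listsOf r (upto1 n))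

schurCoeff : List ℕ → List ℕ → ℕ
schurCoeff la α = length (filterᵇ (λ t → isSSYT t ∧ hasContent α t) (fillings la (length α)))

below : List ℕ → List (List ℕ)
below [] = [] ∷ []
below (a ∷ as) = concatMap (λ b → map (b ∷_) (below as)) (upto0 a)

schurProdCoeff : List ℕ → List ℕ → List ℕ → ℕ
schurProdCoeff μ ν α =
  sum (map (λ β → schurCoeff μ β * schurCoeff ν (zipWith _∸_ α β)) (below α))

module Submission where

-- Write L_ν s_μ for the sum of the s_λ over the chains from μ with step sizes ν satisfying the two
-- conditions of the theorem. Both s_μ s_ν and L_ν s_μ behave in the same way when ν is multiplied by h_x:
-- * (s_μ s_ν) h_x is the sum of the s_μ s_ν′ over the ν′ obtained from ν by adding a horizontal strip of size
--   x. This is the Pieri rule, proved on Gelfand–Tsetlin patterns with Fomin's local rule.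
-- * (L_ν s_μ) h_x is the sum of the L_ν′ s_μ over the same ν′. By the Pieri rule (L_ν s_μ) h_x is the sum over
--   the chains extended by an arbitrary horizontal strip. Read strips i and i + 1 as words in the letters i and
--   i + 1 and turn the unmatched i + 1's into i's, first for the last two strips and then downwards along the
--   chain; this restores the condition k(i,j) ≤ k(i-1,j-1), and it is inverted by recording the weight ν.
-- Among the ν′ with one more part than ν, the one whose last part is x is the only one whose last part is not
-- smaller, so induction on the length and on the last part gives s_μ s_ν = L_ν s_μ.
-- The coefficients are determined because s_p has no monomial x^q unless p dominates q, and has x^p.

-- No direct bijection between pairs of tableaux and chains is built. Only the two multiplications
-- by h_x are bijective; isolating one term of a Pieri sum needs a subtraction, so from there on
-- only cardinalities are compared. The obstacle lies in the chains. Repairing two adjacent strips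
-- enlarges their common shape and may break the condition one level lower; repairing that level
-- enlarges the next shape and might spoil the level just restored. What saves the argument is a
-- comparison of the two counters of unmatched letters in every row, carried by a linear relation
-- that each row preserves. A repair also forgets how many letters `i` were unmatched before it. The
-- difference of an old and a new weight is exactly that number, which is why adding a horizontal
-- strip to the weight is enough to undo everything. Shapes carry trailing zeros up to a common
-- length. All conditions can then be read row by row, and having at least as many rows as variables
-- leaves an empty last row for the box that an insertion may push down.

-- Linear identities over the natural numbers by reflection.

module LinearArithmetic where
  open import Data.Nat using (ℕ; zero; suc; _+_; _*_; _≤_; z≤n; s≤s)
  open import Data.Nat.Properties
  open import Data.Fin using (Fin; zero; suc)
  open import Data.Vec using (Vec; []; _∷_; lookup; zipWith; replicate)
  open import Data.Product using (_×_; _,_)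
  open import Data.Empty using (⊥)
  open import Algebra.Properties.CommutativeSemigroup +-commutativeSemigroup using (interchange)
  open import Relation.Binary.PropositionalEquality
  import Relation.Binary.Reflection as Reflection

  infixl 6 _:+_

  data Lin (n : ℕ) : Set where
    var  : Fin n → Lin n
    con  : ℕ → Lin n
    _:+_ : Lin n → Lin n → Lin n

  ⟦_⟧ : ∀ {n} → Lin n → Vec ℕ n → ℕ
  ⟦ var i ⟧ ρ = lookup ρ i
  ⟦ con k ⟧ ρ = k
  ⟦ s :+ t ⟧ ρ = ⟦ s ⟧ ρ + ⟦ t ⟧ ρ

  unit : ∀ {n} → Fin n → Vec ℕ n
  unit zero    = 1 ∷ replicate _ 0
  unit (suc i) = 0 ∷ unit i

  coeffs : ∀ {n} → Lin n → ℕ × Vec ℕ n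
  coeffs (var i)  = 0 , unit i
  coeffs (con k)  = k , replicate _ 0
  coeffs (s :+ t) with coeffs s | coeffs t
  ... | k , cs | l , ds = k + l , zipWith _+_ cs ds

  dot : ∀ {n} → Vec ℕ n → Vec ℕ n → ℕ
  dot []       []      = 0
  dot (c ∷ cs) (x ∷ ρ) = c * x + dot cs ρ

  dot-zero : ∀ {n} (ρ : Vec ℕ n) → dot (replicate n 0) ρ ≡ 0
  dot-zero []      = refl
  dot-zero (x ∷ ρ) = dot-zero ρ

  dot-unit : ∀ {n} (i : Fin n) ρ → dot (unit i) ρ ≡ lookup ρ i
  dot-unit zero    (x ∷ ρ) rewrite dot-zero ρ = trans (+-identityʳ (x + 0)) (+-identityʳ x)
  dot-unit (suc i) (x ∷ ρ) = dot-unit i ρ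

  dot-+ : ∀ {n} (cs ds : Vec ℕ n) ρ → dot (zipWith _+_ cs ds) ρ ≡ dot cs ρ + dot ds ρ
  dot-+ []       []       []      = refl
  dot-+ (c ∷ cs) (d ∷ ds) (x ∷ ρ) = trans (cong₂ _+_ (*-distribʳ-+ x c d) (dot-+ cs ds ρ)) (interchange (c *
        x) (d * x) _ _)

  ⟦_⇓⟧ : ∀ {n} → Lin n → Vec ℕ n → ℕ
  ⟦ t ⇓⟧ ρ with coeffs t
  ... | k , cs = k + dot cs ρ

  ⇓-correct : ∀ {n} (t : Lin n) ρ → ⟦ t ⇓⟧ ρ ≡ ⟦ t ⟧ ρ
  ⇓-correct (var i)  ρ = dot-unit i ρ
  ⇓-correct (con k)  ρ = trans (cong (k +_) (dot-zero ρ)) (+-identityʳ k)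
  ⇓-correct (s :+ t) ρ with coeffs s | coeffs t | ⇓-correct s ρ | ⇓-correct t ρ
  ... | k , cs | l , ds | p | q = trans (cong (k + l +_) (dot-+ cs ds ρ)) (trans (interchange k l _ _) (cong₂
        _+_ p q))

  open Reflection (setoid ℕ) var ⟦_⟧ ⟦_⇓⟧ ⇓-correct public using () renaming (solve to lin; _⊜_ to _:=_)

  infixl 5 _⊕_ _⊞_

  _⊕_ : ∀ {a b c d} → a ≤ b → c ≤ d → a + c ≤ b + d
  _⊕_ = +-mono-≤

  _⊞_ : ∀ {a b c d : ℕ} → a ≡ b → c ≡ d → a + c ≡ b + d
  _⊞_ = cong₂ _+_

  -- A certificate that l ≤ r follows from A ≤ B; the equation contains no subtraction, so lin proves it.
  ≤-slack : ∀ {l r A B} k → A ≤ B → l + B + k ≡ r + A → l ≤ r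
  ≤-slack {l} {r} {A} {B} k A≤B eq = +-cancelʳ-≤ A l r
    (≤-trans (+-monoʳ-≤ l A≤B) (≤-trans (m≤m+n (l + B) k) (≤-reflexive eq)))

  ≤-by : ∀ {l r A B} → A ≤ B → l + B ≡ r + A → l ≤ r
  ≤-by {l} {B = B} A≤B eq = ≤-slack 0 A≤B (trans (+-identityʳ (l + B)) eq)

  ≡-by : ∀ {l r A B} → A ≡ B → l + B ≡ r + A → l ≡ r
  ≡-by {l} {r} {A} refl eq = +-cancelʳ-≡ A l r eq

  1≰0 : 1 ≤ 0 → ⊥
  1≰0 ()

open import Data.Bool using (Bool; true; false; _∧_; if_then_else_) renaming (T to True)
open import Data.Nat using (ℕ; zero; suc; _+_; _*_; _∸_; _≤_; _<_; z≤n; s≤s; _≤?_; _≟_; _≤ᵇ_; _<ᵇ_; _≡ᵇ_; _⊔_; _⊓_; >-nonZero)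
open import Data.Nat.Properties hiding (_≤?_; _≟_)
open import Data.Nat.Induction using (<-rec)
open import Data.Nat.ListAction using (sum)
open import Data.Nat.ListAction.Properties using (sum-++)
open import Data.List using (List; []; _∷_; [_]; _++_; _∷ʳ_; _ʳ++_; length; map; concat; concatMap; filter; filterᵇ; replicate; reverse; zipWith)
open import Data.List.Properties hiding (sum-++)
open import Data.List.Membership.Propositional using (_∈_)
open import Data.List.Membership.Propositional.Properties
open import Data.List.Relation.Unary.All as All using (All; []; _∷_)
import Data.List.Relation.Unary.All.Properties as All
open import Data.List.Relation.Unary.AllPairs using (AllPairs; []; _∷_)
open import Data.List.Relation.Unary.Any using (here; there)
open import Data.List.Relation.Unary.Linked using (Linked; []; [-]; _∷_)
open import Data.List.Relation.Unary.Unique.Propositional using (Unique)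
import Data.List.Relation.Unary.Unique.Propositional.Properties as Unique
open import Data.List.Relation.Binary.Pointwise using (Pointwise; []; _∷_)
open import Data.Product using (∃-syntax; _×_; _,_; proj₁; proj₂; uncurry)
open import Data.Sum using (_⊎_; inj₁; inj₂)
open import Data.Empty using (⊥; ⊥-elim)
open import Data.Unit using (⊤; tt)
open import Function using (_∘_; _∋_)
open import Relation.Nullary using (Dec; yes; no)
open import Relation.Nullary.Decidable using (T?; map′; _×-dec_)
open import Relation.Unary using (Decidable)
open import Relation.Binary.PropositionalEquality hiding ([_]; J)

-- Two adjacent horizontal strips: the lattice condition, its repair and the inverse.

module Strips where
  open LinearArithmetic

  variable
    u u′ v v′ w w′ w₁ w₂ w₃ e e′ e₁ e₂ x y z zₑ vₑ : ℕ
    μ κ τ ƛ o a b c ā b̄ ws ws′ α β γ δ ε ζ : List ℕ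
    C C′ D T T′ : List (List ℕ)

  split≤ : ∀ {m n} → m ≤ n → ∃[ k ] m + k ≡ n
  split≤ {m} {n} m≤n = n ∸ m , m+[n∸m]≡n m≤n

  -- Shapes are lists of a fixed length, padded by zeros. In HS u μ ƛ the first row of ƛ is at most u, the bound
  -- that the preceding row of μ imposes on it; so HS u μ ƛ says that ƛ / μ is a horizontal strip.
  data HS : ℕ → List ℕ → List ℕ → Set where
    []   : HS u [] []
    cons : ∀ {m l} → m ≤ l → l ≤ u → HS m μ ƛ → HS u (m ∷ μ) (l ∷ ƛ)

  H : List ℕ → List ℕ → Set
  H μ ƛ = ∃[ u ] HS u μ ƛ

  HS-mono : u ≤ v → HS u μ ƛ → HS v μ ƛ
  HS-mono u≤v [] = []
  HS-mono u≤v (cons p q h) = cons p (≤-trans q u≤v) h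

  common : ∀ {a b c d} → H a b → H c d → ∃[ u ] HS u a b × HS u c d
  common (u , h) (v , h′) = u + v , HS-mono (m≤m+n u v) h , HS-mono (m≤n+m v u) h′

  -- k(i+1,j) ≤ k(i,j-1) for the strips b / a and c / b (numbered i and i + 1), read row by row from the top:
  -- w is k(i,j) - k(i+1,j) before the current row, and e the value after the last row.
  data Lat : ℕ → List ℕ → List ℕ → List ℕ → ℕ → Set where
    []   : Lat w [] [] [] w
    cons : ∀ {x y z} → z ≤ y + w → w′ + (z + x) ≡ w + (y + y) →
           Lat w′ a b c e → Lat w (x ∷ a) (y ∷ b) (z ∷ c) e

  -- In each row the letters i + 1 (of the strip c / b) are read before the letters i (of b / a), and w counts the
  -- i's not yet matched by an i + 1. The unmatched i + 1's become i's, which replaces b by b̄. Given a and c,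
  -- the pairs (w , b) and (b̄ , e) determine each other.
  data Up : ℕ → List ℕ → List ℕ → List ℕ → List ℕ → ℕ → Set where
    []    : Up w [] [] [] [] w
    keep  : ∀ {x y z} → z ≤ y + w → w′ + (z + x) ≡ w + (y + y) →
            Up w′ a b c b̄ e → Up w (x ∷ a) (y ∷ b) (z ∷ c) (y ∷ b̄) e
    raise : ∀ {x y ȳ z} → y < ȳ → ȳ + w ≡ z → w′ + x ≡ y →
            Up w′ a b c b̄ e → Up w (x ∷ a) (y ∷ b) (z ∷ c) (ȳ ∷ b̄) e

  Up-pw : Up w a b c b̄ e → Pointwise _≤_ b b̄
  Up-pw [] = []
  Up-pw (keep _ _ up) = ≤-refl ∷ Up-pw up
  Up-pw (raise y<ȳ _ _ up) = <⇒≤ y<ȳ ∷ Up-pw up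

  Pw-sum : Pointwise _≤_ a b → sum a ≤ sum b
  Pw-sum [] = z≤n
  Pw-sum (p ∷ ps) = +-mono-≤ p (Pw-sum ps)

  HS-sum : HS u μ ƛ → sum μ ≤ sum ƛ
  HS-sum [] = z≤n
  HS-sum (cons p _ h) = +-mono-≤ p (HS-sum h)

  Lat-sum : Lat w a b c e → e + (sum c + sum a) ≡ w + (sum b + sum b)
  Lat-sum {w} [] = refl
  Lat-sum {w = w} {e = e} (cons {w′ = w′} {a = a} {b = b} {c = c} {x = x} {y} {z} _ q l) = (≡-by ((Lat-sum l)
        ⊞ q) (lin 9 (λ x₁ x₂ x₃ e w w′ x y z → e :+ (z :+ x₃ :+ (x :+ x₁)) :+ (w′ :+ (x₂ :+ x₂) :+ (w :+ (y
        :+ y))) := w :+ (y :+ x₂ :+ (y :+ x₂)) :+ (e :+ (x₃ :+ x₁) :+ (w′ :+ (z :+ x)))) refl (sum a) (sum b)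
        (sum c) e w w′ x y z))

  -- The row equations telescope, so the final counter depends on the sizes of the shapes alone.
  -- Weights record sizes, and in this way they determine `e`.
  Up-sum : Up w a b c b̄ e → e + (sum a + sum c) ≡ w + (sum b + sum b̄)
  Up-sum [] = refl
  Up-sum {w = w} {e = e} (keep {w′ = w′} {a = a} {b = b} {c = c} {b̄ = b̄} {x = x} {y} {z} _ q l) = (≡-by
        ((Up-sum l) ⊞ q) (lin 10 (λ x₁ x₂ x₃ x₄ e w w′ x y z → e :+ (x :+ x₁ :+ (z :+ x₄)) :+ (w′ :+ (x₂ :+
        x₃) :+ (w :+ (y :+ y))) := w :+ (y :+ x₂ :+ (y :+ x₃)) :+ (e :+ (x₁ :+ x₄) :+ (w′ :+ (z :+ x)))) refl
        (sum a) (sum b) (sum b̄) (sum c) e w w′ x y z))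
  Up-sum {w = w} {e = e} (raise {w′ = w′} {a = a} {b = b} {c = c} {b̄ = b̄} {x = x} {y} {ȳ} {z} _ p q l) =
        (≡-by ((Up-sum l) ⊞ q ⊞ sym p) (lin 11 (λ x₁ x₂ x₃ x₄ e w w′ x y z ȳ → e :+ (x :+ x₁ :+ (z :+ x₄)) :+
        (w′ :+ (x₂ :+ x₃) :+ y :+ (ȳ :+ w)) := w :+ (y :+ x₂ :+ (ȳ :+ x₃)) :+ (e :+ (x₁ :+ x₄) :+ (w′ :+ x)
        :+ z)) refl (sum a) (sum b) (sum b̄) (sum c) e w w′ x y z ȳ))

  -- Read from the top: the incoming `w` decides the constructor, since `keep` means `z ≤ y + w` and
  -- `raise` forces `y + w < z`.
  Up-functional : Up w a b c b̄ e → Up w a b c ā e′ → b̄ ≡ ā × e ≡ e′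
  Up-functional [] [] = refl , refl
  Up-functional {w = w} (keep {w′ = w′} {x = x} {y} {z} p q l) (keep {w′ = v′} p′ q′ l′)
    with refl ← (w′ ≡ v′) ∋ (≡-by (q ⊞ sym q′) (lin 6 (λ v′ w w′ x y z → w′ :+ (w :+ (y :+ y) :+ (v′ :+ (z :+
          x))) := v′ :+ (w′ :+ (z :+ x) :+ (w :+ (y :+ y)))) refl v′ w w′ x y z))
    with refl , refl ← Up-functional l l′ = refl , refl
  Up-functional {w = w} (keep {y = y} {z} p q l) (raise {ȳ = ȳ} y< p′ q′ l′) =
    ⊥-elim (1≰0 (≤-by (p ⊕ y< ⊕ ≤-reflexive p′) (lin 4 (λ w y z ȳ → con 1 :+ (y :+ w :+ ȳ :+ z) := con 0 :+
          (z :+ (con 1 :+ y) :+ (ȳ :+ w))) refl w y z ȳ)))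
  Up-functional {w = w} (raise {y = y} {ȳ = ȳ} {z} y< p′ q′ l′) (keep p q l) =
    ⊥-elim (1≰0 (≤-by (p ⊕ y< ⊕ ≤-reflexive p′) (lin 4 (λ w y z ȳ → con 1 :+ (y :+ w :+ ȳ :+ z) := con 0 :+
          (z :+ (con 1 :+ y) :+ (ȳ :+ w))) refl w y z ȳ)))
  Up-functional {w = w} (raise {w′ = w′} {x = x} {y} {ȳ} {z} _ p q l) (raise {w′ = v′} {ȳ = ȳ′} _ p′ q′ l′)
    with refl ← (w′ ≡ v′) ∋ (≡-by (q ⊞ sym q′) (lin 4 (λ v′ w′ x y → w′ :+ (y :+ (v′ :+ x)) := v′ :+ (w′ :+ x
          :+ y)) refl v′ w′ x y))
    with refl ← (ȳ ≡ ȳ′) ∋ (≡-by (p ⊞ sym p′) (lin 4 (λ w z ȳ ȳ′ → ȳ :+ (z :+ (ȳ′ :+ w)) := ȳ′ :+ (ȳ :+ w :+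
          z)) refl w z ȳ ȳ′))
    with refl , refl ← Up-functional l l′ = refl , refl

  -- Read from the bottom: once `w′` is known, a kept entry is at most `w′ + x`, while a raised one
  -- exceeds `w′ + x`, the entry it came from.
  Up-injective : Up w a b c ā e → Up v a b̄ c ā e → b ≡ b̄ × w ≡ v
  Up-injective [] [] = refl , refl
  Up-injective {w = w} {v = v} (keep {w′ = w′} {x = x} {y} {z} p q l) (keep p′ q′ l′)
    with refl , refl ← Up-injective l l′
    with refl ← (w ≡ v) ∋ (≡-by (sym q ⊞ q′) (lin 6 (λ v w w′ x y z → w :+ (w′ :+ (z :+ x) :+ (v :+ (y :+
          y))) := v :+ (w :+ (y :+ y) :+ (w′ :+ (z :+ x)))) refl v w w′ x y z)) = refl , refl
  Up-injective {w = w} {v = v} (keep {w′ = w′} {x = x} {y} {z} p q l) (raise {y = y′} y< p′ q′ l′)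
    with refl , refl ← Up-injective l l′ =
    ⊥-elim (1≰0 (≤-by (p ⊕ y< ⊕ ≤-reflexive q′ ⊕ ≤-reflexive (sym q)) (lin 6 (λ w w′ x y y′ z → con 1 :+ (y
          :+ w :+ y :+ y′ :+ (w′ :+ (z :+ x))) := con 0 :+ (z :+ (con 1 :+ y′) :+ (w′ :+ x) :+ (w :+ (y :+
          y)))) refl w w′ x y y′ z)))
  Up-injective {w = v} {v = w} (raise {y = y′} y< p′ q′ l′) (keep {w′ = w′} {x = x} {y} {z} p q l)
    with refl , refl ← Up-injective l l′ =
    ⊥-elim (1≰0 (≤-by (p ⊕ y< ⊕ ≤-reflexive q′ ⊕ ≤-reflexive (sym q)) (lin 6 (λ w w′ x y y′ z → con 1 :+ (y
          :+ w :+ y :+ y′ :+ (w′ :+ (z :+ x))) := con 0 :+ (z :+ (con 1 :+ y′) :+ (w′ :+ x) :+ (w :+ (y :+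
          y)))) refl w w′ x y y′ z)))
  Up-injective {w = w} {v = v} (raise {x = x} {y} {ȳ} {z} _ p q l) (raise _ p′ q′ l′)
    with refl , refl ← Up-injective l l′
    with refl ← trans (sym q) q′
    with refl ← (w ≡ v) ∋ (≡-by (p ⊞ sym p′) (lin 4 (λ v w z ȳ → w :+ (z :+ (ȳ :+ v)) := v :+ (ȳ :+ w :+ z))
          refl v w z ȳ)) = refl , refl

  -- The hypothesis `u′ ≤ u + w` says that the letters `i` of the row above are all still unmatched
  -- when the current row begins; both branches pass it on. It bounds a raised entry, which is `z`
  -- minus `w`, by the row of `a` above it, as the strip from `a` to `b̄` requires.
  Up-exists : HS u a b → HS u′ b c → u′ ≤ u + w →
              ∃[ b̄ ] ∃[ e ] Up w a b c b̄ e × HS u a b̄ × HS u′ b̄ c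
  Up-exists [] [] _ = _ , _ , [] , [] , []
  Up-exists {u = u} {u′ = u′} {w = w} (cons {m = x} {l = y} x≤y y≤u h) (cons {l = z} y≤z z≤u′ h′) le
    with z ≤? y + w
  ... | yes z≤
    with w′ , eq ← split≤ (z + x ≤ w + (y + y) ∋ (≤-by (z≤ ⊕ x≤y) (lin 4 (λ w x y z → z :+ x :+ (y :+ w :+ y)
          := w :+ (y :+ y) :+ (z :+ x)) refl w x y z)))
    with _ , _ , up , g , g′ ← Up-exists {w = w′} h h′ (≤-by (≤-reflexive (sym eq) ⊕ z≤) (lin 5 (λ w w′ x y z
          → y :+ (z :+ x :+ w′ :+ (y :+ w)) := x :+ w′ :+ (w :+ (y :+ y) :+ z)) refl w w′ x y z))
    = _ , _ , keep z≤ (≡-by eq (lin 5 (λ w w′ x y z → w′ :+ (z :+ x) :+ (w :+ (y :+ y)) := w :+ (y :+ y) :+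
          (z :+ x :+ w′)) refl w w′ x y z)) up , cons x≤y y≤u g , cons y≤z z≤u′ g′
  ... | no z≰
    with y< ← ≰⇒> z≰
    with ȳ , eq ← split≤ (w ≤ z ∋ (≤-slack (y + 1) y< (lin 3 (λ w y z → w :+ z :+ (y :+ con 1) := z :+ (con 1
          :+ (y :+ w))) refl w y z)))
    with w′ , eq′ ← split≤ x≤y
    with y<ȳ ← suc y ≤ ȳ ∋ (≤-by (y< ⊕ ≤-reflexive (sym eq)) (lin 4 (λ w y z ȳ → con 1 :+ y :+ (z :+ (w :+
          ȳ)) := ȳ :+ (con 1 :+ (y :+ w) :+ z)) refl w y z ȳ))
    with _ , _ , up , g , g′ ← Up-exists {w = w′} h h′ (≤-reflexive (sym eq′))
    = _ , _ , raise y<ȳ (trans (+-comm ȳ w) eq) (trans (+-comm w′ x) eq′) up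
    , cons (≤-trans x≤y (<⇒≤ y<ȳ)) (≤-by (≤-reflexive eq ⊕ z≤u′ ⊕ le) (lin 5 (λ u u′ w z ȳ → ȳ :+ (z :+ u′ :+
          (u :+ w)) := u :+ (w :+ ȳ :+ z :+ u′)) refl u u′ w z ȳ)) g
    , cons (≤-slack w (≤-reflexive eq) (lin 3 (λ w z ȳ → ȳ :+ z :+ w := z :+ (w :+ ȳ)) refl w z ȳ)) z≤u′
          (HS-mono (<⇒≤ y<ȳ) g′)

  -- Rows are treated from the bottom, and `ȳ ≤ w′ + x` tells kept rows from raised ones. The last
  -- component leaves open the bound `t` on the first row of `c`, because the row of `b` above it is
  -- only found afterwards: either that row is kept, which gives `u′`, or it is lowered to `w + u`.
  Down-exists : Lat v a b̄ c vₑ → HS u a b̄ → HS u′ b̄ c → e ≤ vₑ →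
    ∃[ b ] ∃[ w ] w ≤ v × Up w a b c b̄ e × HS u a b × (∀ t → u′ ≤ t ⊎ w + u ≤ t → HS t b c)
  Down-exists [] [] [] e≤ = _ , _ , e≤ , [] , [] , λ _ _ → []
  Down-exists {v = v} {u = u} {u′ = u′} (cons {w′ = v′} {x = x} {ȳ} {z} z≤ eq l) (cons x≤ȳ ȳ≤u h) (cons ȳ≤z
        z≤u′ h′) e≤
    with b , w′ , w′≤v′ , up , g , g′ ← Down-exists l h h′ e≤
    with ȳ ≤? w′ + x
  ... | yes ȳ≤
    with w , eq′ ← split≤ (ȳ + ȳ ≤ w′ + (z + x) ∋ (≤-by (ȳ≤ ⊕ ȳ≤z) (lin 4 (λ w′ x z ȳ → ȳ :+ ȳ :+ (w′ :+ x :+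
          z) := w′ :+ (z :+ x) :+ (ȳ :+ ȳ)) refl w′ x z ȳ)))
    with z≤ȳ+w ← z ≤ ȳ + w ∋ (≤-by (≤-reflexive (sym eq′) ⊕ ȳ≤) (lin 5 (λ w w′ x z ȳ → z :+ (ȳ :+ ȳ :+ w :+
          (w′ :+ x)) := ȳ :+ w :+ (w′ :+ (z :+ x) :+ ȳ)) refl w w′ x z ȳ))
    = _ , w , (≤-by (≤-reflexive eq′ ⊕ ≤-reflexive eq ⊕ w′≤v′) (lin 7 (λ v v′ w w′ x z ȳ → w :+ (w′ :+ (z :+
          x) :+ (v :+ (ȳ :+ ȳ)) :+ v′) := v :+ (ȳ :+ ȳ :+ w :+ (v′ :+ (z :+ x)) :+ w′)) refl v v′ w w′ x z ȳ))
    , keep z≤ȳ+w (≡-by (sym eq′) (lin 5 (λ w w′ x z ȳ → w′ :+ (z :+ x) :+ (ȳ :+ ȳ :+ w) := w :+ (ȳ :+ ȳ) :+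
          (w′ :+ (z :+ x))) refl w w′ x z ȳ)) up
    , cons x≤ȳ ȳ≤u g
    , λ where t (inj₁ u′≤t) → cons ȳ≤z (≤-trans z≤u′ u′≤t) (g′ ȳ (inj₁ ≤-refl))
              t (inj₂ le) → cons ȳ≤z (≤-by (z≤ȳ+w ⊕ ȳ≤u ⊕ le) (lin 5 (λ t u w z ȳ → z :+ (ȳ :+ w :+ u :+ t)
                    := t :+ (z :+ ȳ :+ (w :+ u))) refl t u w z ȳ)) (g′ ȳ (inj₁ ≤-refl))
  ... | no ȳ≰
    with y< ← ≰⇒> ȳ≰
    with w , eq′ ← split≤ ȳ≤z
    = _ , w , (≤-by (≤-reflexive eq′ ⊕ z≤) (lin 4 (λ v w z ȳ → w :+ (z :+ (ȳ :+ v)) := v :+ (ȳ :+ w :+ z))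
          refl v w z ȳ))
    , raise y< eq′ refl up
    , cons (m≤n+m x w′) (≤-trans (<⇒≤ y<) ȳ≤u) g
    , λ where t (inj₁ u′≤t) → cons (≤-trans (<⇒≤ y<) ȳ≤z) (≤-trans z≤u′ u′≤t) (g′ _ (inj₂ ≤-refl))
              t (inj₂ le) → cons (≤-trans (<⇒≤ y<) ȳ≤z) (≤-by (≤-reflexive (sym eq′) ⊕ ȳ≤u ⊕ le) (lin 5 (λ t
                    u w z ȳ → z :+ (ȳ :+ w :+ u :+ t) := t :+ (z :+ ȳ :+ (w :+ u))) refl t u w z ȳ)) (g′ _
                    (inj₂ ≤-refl))

  -- The counter of `Lat` also counts the letters that were raised to `i`, and the counter of `Up`
  -- does not. The two drift apart in one direction only, hence the invariant `w ≤ v`.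
  Up-Lat : Up w a b c b̄ e → w ≤ v → ∃[ vₑ ] Lat v a b̄ c vₑ
  Up-Lat [] _ = _ , []
  Up-Lat {w = w} {v = v} (keep {w′ = w′} {x = x} {y} {z} p q l) w≤v
    with v′ , eq ← split≤ (z + x ≤ v + (y + y) ∋ (≤-slack w′ (≤-reflexive q ⊕ w≤v) (lin 6 (λ v w w′ x y z → z
          :+ x :+ (w :+ (y :+ y) :+ v) :+ w′ := v :+ (y :+ y) :+ (w′ :+ (z :+ x) :+ w)) refl v w w′ x y z)))
    with _ , l′ ← Up-Lat {v = v′} l (≤-by (≤-reflexive q ⊕ w≤v ⊕ ≤-reflexive (sym eq)) (lin 7 (λ v v′ w w′ x
          y z → w′ :+ (w :+ (y :+ y) :+ v :+ (z :+ x :+ v′)) := v′ :+ (w′ :+ (z :+ x) :+ w :+ (v :+ (y :+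
          y)))) refl v v′ w w′ x y z))
    = _ , cons (≤-by (p ⊕ w≤v) (lin 4 (λ v w y z → z :+ (y :+ w :+ v) := y :+ v :+ (z :+ w)) refl v w y z))
          (≡-by eq (lin 5 (λ v v′ x y z → v′ :+ (z :+ x) :+ (v :+ (y :+ y)) := v :+ (y :+ y) :+ (z :+ x :+
          v′)) refl v v′ x y z)) l′
  Up-Lat {w = w} {v = v} (raise {w′ = w′} {x = x} {y} {ȳ} {z} y< p q l) w≤v
    with v′ , eq ← split≤ (z + x ≤ v + (ȳ + ȳ) ∋ (≤-slack (w′ + 1) (y< ⊕ ≤-reflexive (sym p) ⊕ ≤-reflexive q
          ⊕ w≤v) (lin 7 (λ v w w′ x y z ȳ → z :+ x :+ (ȳ :+ (ȳ :+ w) :+ y :+ v) :+ (w′ :+ con 1) := v :+ (ȳ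
          :+ ȳ) :+ (con 1 :+ y :+ z :+ (w′ :+ x) :+ w)) refl v w w′ x y z ȳ)))
    with _ , l′ ← Up-Lat {v = v′} l (≤-slack 1 (y< ⊕ ≤-reflexive (sym p) ⊕ ≤-reflexive q ⊕ w≤v ⊕ ≤-reflexive
          (sym eq)) (lin 8 (λ v v′ w w′ x y z ȳ → w′ :+ (ȳ :+ (ȳ :+ w) :+ y :+ v :+ (z :+ x :+ v′)) :+ con 1
          := v′ :+ (con 1 :+ y :+ z :+ (w′ :+ x) :+ w :+ (v :+ (ȳ :+ ȳ)))) refl v v′ w w′ x y z ȳ))
    = _ , cons (≤-by (≤-reflexive (sym p) ⊕ w≤v) (lin 4 (λ v w z ȳ → z :+ (ȳ :+ w :+ v) := ȳ :+ v :+ (z :+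
          w)) refl v w z ȳ)) (≡-by eq (lin 5 (λ v v′ x z ȳ → v′ :+ (z :+ x) :+ (v :+ (ȳ :+ ȳ)) := v :+ (ȳ :+
          ȳ) :+ (z :+ x :+ v′)) refl v v′ x z ȳ)) l′

  -- The repair of the next lower pair of strips enlarges a to ā; it raises the number of i's by no more than the
  -- repair above it did, so the condition just restored survives.
  Up-Up-Lat : Lat w₁ o a b e₁ → Up w a b c b̄ e → Up w₂ o a b̄ ā e₂ → w₂ ≤ w₁ → w₃ + w₂ ≡ w + w₁ →
              (∃[ e₃ ] Lat w₃ ā b̄ c e₃) × e₂ ≤ e₁
  Up-Up-Lat [] [] [] le eq = (_ , []) , le
  Up-Up-Lat {w₁ = w₁} {w = w} {w₂ = w₂} {w₃ = w₃} (cons {w′ = w₁′} {x = o} {a} {b} l₁ l₂ l) (keep {w′ = w′}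
        {z = c} p q up) (keep {w′ = w₂′} p₂ q₂ up₂) le eq
    with w₂′≤w₁′ ← (w₂′ ≤ w₁′) ∋ (≤-by (≤-reflexive q₂ ⊕ ≤-reflexive (sym l₂) ⊕ le) (lin 7 (λ a b o w₁ w₁′ w₂
          w₂′ → w₂′ :+ (w₂ :+ (a :+ a) :+ (w₁′ :+ (b :+ o)) :+ w₁) := w₁′ :+ (w₂′ :+ (b :+ o) :+ (w₁ :+ (a :+
          a)) :+ w₂)) refl a b o w₁ w₁′ w₂ w₂′))
    with w₃′ , eq′ ← split≤ (w₂′ ≤ w′ + w₁′ ∋ (≤-slack w′ w₂′≤w₁′ (lin 3 (λ w′ w₁′ w₂′ → w₂′ :+ w₁′ :+ w′ :=
          w′ :+ w₁′ :+ w₂′) refl w′ w₁′ w₂′)))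
    with (_ , r) , le′ ← Up-Up-Lat {w₃ = w₃′} l up up₂ w₂′≤w₁′ (trans (+-comm w₃′ w₂′) eq′)
    = (_ , cons (≤-by (p ⊕ ≤-reflexive (sym eq) ⊕ le) (lin 6 (λ b c w w₁ w₂ w₃ → c :+ (b :+ w :+ (w₃ :+ w₂)
          :+ w₁) := b :+ w₃ :+ (c :+ (w :+ w₁) :+ w₂)) refl b c w w₁ w₂ w₃))
       (≡-by (eq′ ⊞ sym eq ⊞ q ⊞ sym q₂ ⊞ l₂) (lin 12 (λ a b c o w w′ w₁ w₁′ w₂ w₂′ w₃ w₃′ → w₃′ :+ (c :+ a)
             :+ (w′ :+ w₁′ :+ (w₃ :+ w₂) :+ (w :+ (b :+ b)) :+ (w₂′ :+ (b :+ o)) :+ (w₁ :+ (a :+ a))) := w₃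
             :+ (b :+ b) :+ (w₂′ :+ w₃′ :+ (w :+ w₁) :+ (w′ :+ (c :+ a)) :+ (w₂ :+ (a :+ a)) :+ (w₁′ :+ (b :+
             o)))) refl a b c o w w′ w₁ w₁′ w₂ w₂′ w₃ w₃′)) r) , le′
  Up-Up-Lat {w₁ = w₁} {w = w} {w₂ = w₂} {w₃ = w₃} (cons {w′ = w₁′} {x = o} {a} {b} l₁ l₂ l) (raise {w′ = w′}
        {ȳ = b̄} {z = c} y< p q up) (keep {w′ = w₂′} p₂ q₂ up₂) le eq
    with w₂′≤w₁′ ← (w₂′ ≤ w₁′) ∋ (≤-slack 1 (y< ⊕ ≤-reflexive q₂ ⊕ ≤-reflexive (sym l₂) ⊕ le) (lin 8 (λ a b
          b̄ o w₁ w₁′ w₂ w₂′ → w₂′ :+ (b̄ :+ (w₂ :+ (a :+ a)) :+ (w₁′ :+ (b :+ o)) :+ w₁) :+ con 1 := w₁′ :+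
          (con 1 :+ b :+ (w₂′ :+ (b̄ :+ o)) :+ (w₁ :+ (a :+ a)) :+ w₂)) refl a b b̄ o w₁ w₁′ w₂ w₂′))
    with w₃′ , eq′ ← split≤ (w₂′ ≤ w′ + w₁′ ∋ (≤-slack w′ w₂′≤w₁′ (lin 3 (λ w′ w₁′ w₂′ → w₂′ :+ w₁′ :+ w′ :=
          w′ :+ w₁′ :+ w₂′) refl w′ w₁′ w₂′)))
    with (_ , r) , le′ ← Up-Up-Lat {w₃ = w₃′} l up up₂ w₂′≤w₁′ (trans (+-comm w₃′ w₂′) eq′)
    = (_ , cons (≤-by (≤-reflexive (sym p) ⊕ ≤-reflexive (sym eq) ⊕ le) (lin 6 (λ b̄ c w w₁ w₂ w₃ → c :+ (b̄
          :+ w :+ (w₃ :+ w₂) :+ w₁) := b̄ :+ w₃ :+ (c :+ (w :+ w₁) :+ w₂)) refl b̄ c w w₁ w₂ w₃))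
       (≡-by (eq′ ⊞ sym eq ⊞ sym p ⊞ q ⊞ sym q₂ ⊞ l₂) (lin 13 (λ a b b̄ c o w w′ w₁ w₁′ w₂ w₂′ w₃ w₃′ → w₃′
             :+ (c :+ a) :+ (w′ :+ w₁′ :+ (w₃ :+ w₂) :+ (b̄ :+ w) :+ b :+ (w₂′ :+ (b̄ :+ o)) :+ (w₁ :+ (a :+
             a))) := w₃ :+ (b̄ :+ b̄) :+ (w₂′ :+ w₃′ :+ (w :+ w₁) :+ c :+ (w′ :+ a) :+ (w₂ :+ (a :+ a)) :+
             (w₁′ :+ (b :+ o)))) refl a b b̄ c o w w′ w₁ w₁′ w₂ w₂′ w₃ w₃′)) r) , le′
  Up-Up-Lat {w₁ = w₁} {w = w} {w₂ = w₂} {w₃ = w₃} (cons {w′ = w₁′} {x = o} {a} {b} l₁ l₂ l) (keep {w′ = w′}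
        {z = c} p q up) (raise {w′ = w₂′} {ȳ = ā} y<₂ p₂ q₂ up₂) le eq
    -- In a row raised by the lower repair, `w₂′` restarts at `a` minus `o`, and the old condition
    -- `l₁` already keeps `w₁′` at least that large.
    with w₂′≤w₁′ ← (w₂′ ≤ w₁′) ∋ (≤-by (l₁ ⊕ ≤-reflexive q₂ ⊕ ≤-reflexive (sym l₂)) (lin 6 (λ a b o w₁ w₁′
          w₂′ → w₂′ :+ (a :+ w₁ :+ a :+ (w₁′ :+ (b :+ o))) := w₁′ :+ (b :+ (w₂′ :+ o) :+ (w₁ :+ (a :+ a))))
          refl a b o w₁ w₁′ w₂′))
    with w₃′ , eq′ ← split≤ (w₂′ ≤ w′ + w₁′ ∋ (≤-slack w′ w₂′≤w₁′ (lin 3 (λ w′ w₁′ w₂′ → w₂′ :+ w₁′ :+ w′ :=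
          w′ :+ w₁′ :+ w₂′) refl w′ w₁′ w₂′)))
    with (_ , r) , le′ ← Up-Up-Lat {w₃ = w₃′} l up up₂ w₂′≤w₁′ (trans (+-comm w₃′ w₂′) eq′)
    = (_ , cons (≤-by (p ⊕ ≤-reflexive (sym eq) ⊕ le) (lin 6 (λ b c w w₁ w₂ w₃ → c :+ (b :+ w :+ (w₃ :+ w₂)
          :+ w₁) := b :+ w₃ :+ (c :+ (w :+ w₁) :+ w₂)) refl b c w w₁ w₂ w₃))
       (≡-by (eq′ ⊞ sym eq ⊞ q ⊞ p₂ ⊞ sym q₂ ⊞ l₂) (lin 13 (λ a b c o w w′ w₁ w₁′ w₂ w₂′ w₃ w₃′ ā → w₃′ :+ (c
             :+ ā) :+ (w′ :+ w₁′ :+ (w₃ :+ w₂) :+ (w :+ (b :+ b)) :+ b :+ (w₂′ :+ o) :+ (w₁ :+ (a :+ a))) :=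
             w₃ :+ (b :+ b) :+ (w₂′ :+ w₃′ :+ (w :+ w₁) :+ (w′ :+ (c :+ a)) :+ (ā :+ w₂) :+ a :+ (w₁′ :+ (b
             :+ o)))) refl a b c o w w′ w₁ w₁′ w₂ w₂′ w₃ w₃′ ā)) r) , le′
  Up-Up-Lat {w₁ = w₁} {w = w} {w₂ = w₂} {w₃ = w₃} (cons {w′ = w₁′} {x = o} {a} {b} l₁ l₂ l) (raise {w′ = w′}
        {ȳ = b̄} {z = c} y< p q up) (raise {w′ = w₂′} {ȳ = ā} y<₂ p₂ q₂ up₂) le eq
    with w₂′≤w₁′ ← (w₂′ ≤ w₁′) ∋ (≤-by (l₁ ⊕ ≤-reflexive q₂ ⊕ ≤-reflexive (sym l₂)) (lin 6 (λ a b o w₁ w₁′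
          w₂′ → w₂′ :+ (a :+ w₁ :+ a :+ (w₁′ :+ (b :+ o))) := w₁′ :+ (b :+ (w₂′ :+ o) :+ (w₁ :+ (a :+ a))))
          refl a b o w₁ w₁′ w₂′))
    with w₃′ , eq′ ← split≤ (w₂′ ≤ w′ + w₁′ ∋ (≤-slack w′ w₂′≤w₁′ (lin 3 (λ w′ w₁′ w₂′ → w₂′ :+ w₁′ :+ w′ :=
          w′ :+ w₁′ :+ w₂′) refl w′ w₁′ w₂′)))
    with (_ , r) , le′ ← Up-Up-Lat {w₃ = w₃′} l up up₂ w₂′≤w₁′ (trans (+-comm w₃′ w₂′) eq′)
    = (_ , cons (≤-by (≤-reflexive (sym p) ⊕ ≤-reflexive (sym eq) ⊕ le) (lin 6 (λ b̄ c w w₁ w₂ w₃ → c :+ (b̄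
          :+ w :+ (w₃ :+ w₂) :+ w₁) := b̄ :+ w₃ :+ (c :+ (w :+ w₁) :+ w₂)) refl b̄ c w w₁ w₂ w₃))
       (≡-by (eq′ ⊞ sym eq ⊞ sym p ⊞ q ⊞ p₂ ⊞ sym q₂ ⊞ l₂) (lin 14 (λ a b b̄ c o w w′ w₁ w₁′ w₂ w₂′ w₃ w₃′ ā
             → w₃′ :+ (c :+ ā) :+ (w′ :+ w₁′ :+ (w₃ :+ w₂) :+ (b̄ :+ w) :+ b :+ b̄ :+ (w₂′ :+ o) :+ (w₁ :+ (a
             :+ a))) := w₃ :+ (b̄ :+ b̄) :+ (w₂′ :+ w₃′ :+ (w :+ w₁) :+ c :+ (w′ :+ a) :+ (ā :+ w₂) :+ a :+
             (w₁′ :+ (b :+ o)))) refl a b b̄ c o w w′ w₁ w₁′ w₂ w₂′ w₃ w₃′ ā)) r) , le′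

  -- A smaller lowest shape adds letters `i`, so the counter only grows. It is needed when a chain
  -- is lowered: the shape under `b̄` has then been replaced before `b̄` itself is treated.
  Lat-lower : Lat z ā b c zₑ → Pointwise _≤_ a ā → z ≤ v → ∃[ vₑ ] Lat v a b c vₑ
  Lat-lower [] [] _ = _ , []
  Lat-lower {z = w} {v = v} (cons {w′ = w′} {x = x̄} {y} {z} p q l) (_∷_ {x = x} x≤ pw) w≤v
    with v′ , eq ← split≤ (z + x ≤ v + (y + y) ∋ (≤-slack w′ (≤-reflexive q ⊕ x≤ ⊕ w≤v) (lin 7 (λ v w w′ x x̄
          y z → z :+ x :+ (w :+ (y :+ y) :+ x̄ :+ v) :+ w′ := v :+ (y :+ y) :+ (w′ :+ (z :+ x̄) :+ x :+ w))
          refl v w w′ x x̄ y z)))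
    with _ , l′ ← Lat-lower {v = v′} l pw (≤-by (≤-reflexive q ⊕ x≤ ⊕ w≤v ⊕ ≤-reflexive (sym eq)) (lin 8 (λ v
          v′ w w′ x x̄ y z → w′ :+ (w :+ (y :+ y) :+ x̄ :+ v :+ (z :+ x :+ v′)) := v′ :+ (w′ :+ (z :+ x̄) :+
          x :+ w :+ (v :+ (y :+ y)))) refl v v′ w w′ x x̄ y z))
    = _ , cons (≤-by (p ⊕ w≤v) (lin 4 (λ v w y z → z :+ (y :+ w :+ v) := y :+ v :+ (z :+ w)) refl v w y z))
          (≡-by eq (lin 5 (λ v v′ x y z → v′ :+ (z :+ x) :+ (v :+ (y :+ y)) := v :+ (y :+ y) :+ (z :+ x :+
          v′)) refl v v′ x y z)) l′

  -- Only the counters after the last row are comparable at the outset, so the comparison runs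
  -- upwards. In a raised row it is immediate: the row of `c` equals the raised entry plus `w`, and
  -- the lattice condition bounds it by that entry plus `z`.
  Down-Down-≤ : Up w a b c b̄ e → Lat z ā b̄ c zₑ → Pointwise _≤_ a ā → e ≤ zₑ → w ≤ z
  Down-Down-≤ [] [] [] le = le
  Down-Down-≤ {w = w} {z = z} (keep {w′ = w′} {x = a} {b} {c} p q up) (cons {w′ = z′} {x = ā} p′ q′ l) (a≤ ∷
        pw) le
    = (≤-by ((Down-Down-≤ up l pw le) ⊕ ≤-reflexive (sym q) ⊕ ≤-reflexive q′ ⊕ a≤) (lin 8 (λ a b c w w′ z z′
          ā → w :+ (z′ :+ (w′ :+ (c :+ a)) :+ (z :+ (b :+ b)) :+ ā) := z :+ (w′ :+ (w :+ (b :+ b)) :+ (z′ :+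
          (c :+ ā)) :+ a)) refl a b c w w′ z z′ ā))
  Down-Down-≤ {w = w} {z = z} (raise {w′ = w′} {x = a} {b} {b̄} {c} y< p q up) (cons {w′ = z′} {x = ā} p′ q′
        l) (a≤ ∷ pw) le
    = (≤-by (≤-reflexive p ⊕ p′) (lin 4 (λ b̄ c w z → w :+ (c :+ (b̄ :+ z)) := z :+ (b̄ :+ w :+ c)) refl b̄ c
          w z))

  -- Converse of `Up-Up-Lat`. The equation between the counters survives each row because `w`
  -- changes by `b + b̄ - a - c`, `w₂` by `a + ā - o - b̄`, `z` by `2b̄ - ā - c` and `w₁` by
  -- `2a - o - b`.
  Down-Down-Lat : Up w a b c b̄ e → Up w₂ o a b̄ ā e₂ → Lat z ā b̄ c zₑ → e ≤ zₑ → w₁ + w ≡ w₂ + z →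
                  ∃[ e₁ ] Lat w₁ o a b e₁
  Down-Down-Lat [] [] [] le eq = _ , []
  Down-Down-Lat {w = w} {w₂ = w₂} {z = z} {w₁ = w₁} up₀@(keep {w′ = w′} {x = a} {b} {c} p q up) up₂₀@(keep
        {w′ = w₂′} {x = o} p₂ q₂ up₂) l₀@(cons {w′ = z′} l₁ l₂ l) le eq
    with w≤z ← Down-Down-≤ up₀ l₀ (Up-pw up₂₀) le
    with w′≤z′ ← Down-Down-≤ up l (Up-pw up₂) le
    with w₁′ , eq′ ← split≤ (w′ ≤ w₂′ + z′ ∋ ≤-trans w′≤z′ (m≤n+m z′ w₂′))
    with _ , r ← Down-Down-Lat {w₁ = w₁′} up up₂ l le (trans (+-comm w₁′ w′) eq′)
    = _ , cons (≤-by (p₂ ⊕ w≤z ⊕ ≤-reflexive (sym eq)) (lin 6 (λ a b w w₁ w₂ z → b :+ (a :+ w₂ :+ z :+ (w₁ :+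
          w)) := a :+ w₁ :+ (b :+ w :+ (w₂ :+ z))) refl a b w w₁ w₂ z))
       (≡-by (eq′ ⊞ sym eq ⊞ sym q ⊞ q₂ ⊞ l₂) (lin 12 (λ a b c o w w′ w₁ w₁′ w₂ w₂′ z z′ → w₁′ :+ (b :+ o) :+
             (w₂′ :+ z′ :+ (w₁ :+ w) :+ (w′ :+ (c :+ a)) :+ (w₂ :+ (a :+ a)) :+ (z :+ (b :+ b))) := w₁ :+ (a
             :+ a) :+ (w′ :+ w₁′ :+ (w₂ :+ z) :+ (w :+ (b :+ b)) :+ (w₂′ :+ (b :+ o)) :+ (z′ :+ (c :+ a))))
             refl a b c o w w′ w₁ w₁′ w₂ w₂′ z z′)) r
  Down-Down-Lat {w = w} {w₂ = w₂} {z = z} {w₁ = w₁} up₀@(keep {w′ = w′} {x = a} {b} {c} p q up) up₂₀@(raise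
        {w′ = w₂′} {x = o} {ȳ = ā} y<₂ p₂ q₂ up₂) l₀@(cons {w′ = z′} l₁ l₂ l) le eq
    with w≤z ← Down-Down-≤ up₀ l₀ (Up-pw up₂₀) le
    with w′≤z′ ← Down-Down-≤ up l (Up-pw up₂) le
    with w₁′ , eq′ ← split≤ (w′ ≤ w₂′ + z′ ∋ ≤-trans w′≤z′ (m≤n+m z′ w₂′))
    with _ , r ← Down-Down-Lat {w₁ = w₁′} up up₂ l le (trans (+-comm w₁′ w′) eq′)
    = _ , cons (≤-by (≤-reflexive (sym p₂) ⊕ w′≤z′ ⊕ ≤-reflexive (sym eq) ⊕ ≤-reflexive (sym q) ⊕ ≤-reflexive
          l₂) (lin 10 (λ a b c w w′ w₁ w₂ z z′ ā → b :+ (ā :+ w₂ :+ z′ :+ (w₁ :+ w) :+ (w′ :+ (c :+ a)) :+ (z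
          :+ (b :+ b))) := a :+ w₁ :+ (b :+ w′ :+ (w₂ :+ z) :+ (w :+ (b :+ b)) :+ (z′ :+ (c :+ ā)))) refl a b
          c w w′ w₁ w₂ z z′ ā))
       (≡-by (eq′ ⊞ sym eq ⊞ sym q ⊞ sym p₂ ⊞ q₂ ⊞ l₂) (lin 13 (λ a b c o w w′ w₁ w₁′ w₂ w₂′ z z′ ā → w₁′ :+
             (b :+ o) :+ (w₂′ :+ z′ :+ (w₁ :+ w) :+ (w′ :+ (c :+ a)) :+ (ā :+ w₂) :+ a :+ (z :+ (b :+ b))) :=
             w₁ :+ (a :+ a) :+ (w′ :+ w₁′ :+ (w₂ :+ z) :+ (w :+ (b :+ b)) :+ b :+ (w₂′ :+ o) :+ (z′ :+ (c :+
             ā)))) refl a b c o w w′ w₁ w₁′ w₂ w₂′ z z′ ā)) r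
  Down-Down-Lat {w = w} {w₂ = w₂} {z = z} {w₁ = w₁} up₀@(raise {w′ = w′} {x = a} {b} {b̄} {c} y< p q up)
        up₂₀@(keep {w′ = w₂′} {x = o} p₂ q₂ up₂) l₀@(cons {w′ = z′} l₁ l₂ l) le eq
    with w≤z ← Down-Down-≤ up₀ l₀ (Up-pw up₂₀) le
    with w′≤z′ ← Down-Down-≤ up l (Up-pw up₂) le
    with w₁′ , eq′ ← split≤ (w′ ≤ w₂′ + z′ ∋ ≤-trans w′≤z′ (m≤n+m z′ w₂′))
    with _ , r ← Down-Down-Lat {w₁ = w₁′} up up₂ l le (trans (+-comm w₁′ w′) eq′)
    = _ , cons (≤-slack 1 (p₂ ⊕ y< ⊕ w≤z ⊕ ≤-reflexive (sym eq)) (lin 7 (λ a b b̄ w w₁ w₂ z → b :+ (a :+ w₂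
          :+ b̄ :+ z :+ (w₁ :+ w)) :+ con 1 := a :+ w₁ :+ (b̄ :+ (con 1 :+ b) :+ w :+ (w₂ :+ z))) refl a b b̄
          w w₁ w₂ z))
       (≡-by (eq′ ⊞ sym eq ⊞ p ⊞ sym q ⊞ q₂ ⊞ l₂) (lin 13 (λ a b b̄ c o w w′ w₁ w₁′ w₂ w₂′ z z′ → w₁′ :+ (b
             :+ o) :+ (w₂′ :+ z′ :+ (w₁ :+ w) :+ c :+ (w′ :+ a) :+ (w₂ :+ (a :+ a)) :+ (z :+ (b̄ :+ b̄))) :=
             w₁ :+ (a :+ a) :+ (w′ :+ w₁′ :+ (w₂ :+ z) :+ (b̄ :+ w) :+ b :+ (w₂′ :+ (b̄ :+ o)) :+ (z′ :+ (c
             :+ a)))) refl a b b̄ c o w w′ w₁ w₁′ w₂ w₂′ z z′)) r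
  Down-Down-Lat {w = w} {w₂ = w₂} {z = z} {w₁ = w₁} up₀@(raise {w′ = w′} {x = a} {b} {b̄} {c} y< p q up)
        up₂₀@(raise {w′ = w₂′} {x = o} {ȳ = ā} y<₂ p₂ q₂ up₂) l₀@(cons {w′ = z′} l₁ l₂ l) le eq
    with w≤z ← Down-Down-≤ up₀ l₀ (Up-pw up₂₀) le
    with w′≤z′ ← Down-Down-≤ up l (Up-pw up₂) le
    with w₁′ , eq′ ← split≤ (w′ ≤ w₂′ + z′ ∋ ≤-trans w′≤z′ (m≤n+m z′ w₂′))
    with _ , r ← Down-Down-Lat {w₁ = w₁′} up up₂ l le (trans (+-comm w₁′ w′) eq′)
    = _ , cons (≤-by (≤-reflexive (sym p₂) ⊕ w′≤z′ ⊕ ≤-reflexive (sym eq) ⊕ ≤-reflexive p ⊕ ≤-reflexive (sym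
          q) ⊕ ≤-reflexive l₂) (lin 11 (λ a b b̄ c w w′ w₁ w₂ z z′ ā → b :+ (ā :+ w₂ :+ z′ :+ (w₁ :+ w) :+ c
          :+ (w′ :+ a) :+ (z :+ (b̄ :+ b̄))) := a :+ w₁ :+ (b̄ :+ w′ :+ (w₂ :+ z) :+ (b̄ :+ w) :+ b :+ (z′ :+
          (c :+ ā)))) refl a b b̄ c w w′ w₁ w₂ z z′ ā))
       (≡-by (eq′ ⊞ sym eq ⊞ p ⊞ sym q ⊞ sym p₂ ⊞ q₂ ⊞ l₂) (lin 14 (λ a b b̄ c o w w′ w₁ w₁′ w₂ w₂′ z z′ ā →
             w₁′ :+ (b :+ o) :+ (w₂′ :+ z′ :+ (w₁ :+ w) :+ c :+ (w′ :+ a) :+ (ā :+ w₂) :+ a :+ (z :+ (b̄ :+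
             b̄))) := w₁ :+ (a :+ a) :+ (w′ :+ w₁′ :+ (w₂ :+ z) :+ (b̄ :+ w) :+ b :+ b̄ :+ (w₂′ :+ o) :+ (z′
             :+ (c :+ ā)))) refl a b b̄ c o w w′ w₁ w₁′ w₂ w₂′ z z′ ā)) r

-- Repairing and lowering whole chains.

module Chains where
  open LinearArithmetic
  open Strips

  -- A chain is listed from its last shape down to μ, and so are its step sizes.
  data LR (μ : List ℕ) : List ℕ → List (List ℕ) → Set where
    none : LR μ [] (μ ∷ [])
    one  : H μ b → sum μ + w ≡ sum b → LR μ (w ∷ []) (b ∷ μ ∷ [])
    more : LR μ (w ∷ ws) (b ∷ a ∷ C) → H b c → Lat 0 a b c e → sum b + x ≡ sum c →
           LR μ (x ∷ w ∷ ws) (c ∷ b ∷ a ∷ C)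

  -- ws′ is obtained from ws by adding a horizontal strip, for partitions listed from their smallest part and
  -- with ws′ one part longer.
  data RS : List ℕ → List ℕ → Set where
    last : RS [] (x ∷ [])
    cons : x ≤ w → w ≤ y → RS ws (y ∷ ws′) → RS (w ∷ ws) (x ∷ y ∷ ws′)

  LR-sum : LR μ ws (c ∷ C) → sum μ + sum ws ≡ sum c
  LR-sum {μ} none = +-identityʳ (sum μ)
  LR-sum {μ} {c = c} (one {w = w} _ p) = (≡-by p (lin 3 (λ x₁ x₂ w → x₂ :+ (w :+ con 0) :+ x₁ := x₁ :+ (x₂ :+
        w)) refl (sum c) (sum μ) w))
  LR-sum {μ} (more {w = w} {ws} {b = b} {c = c} {x = x} l _ _ p) = (≡-by ((LR-sum l) ⊞ p) (lin 6 (λ x₁ x₂ x₃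
        x₄ w x → x₄ :+ (x :+ (w :+ x₃)) :+ (x₁ :+ x₂) := x₂ :+ (x₄ :+ (w :+ x₃) :+ (x₁ :+ x))) refl (sum b)
        (sum c) (sum ws) (sum μ) w x))

  -- Its use is in `Lower-exists`: the strip from the already lowered shape to `b̄` has at least `w`
  -- boxes, which leaves room for the `w - x` unmatched letters prescribed there.
  RS-sum : RS (w ∷ ws) (x ∷ y ∷ ws′) → w + sum ws ≤ y + sum ws′
  RS-sum (cons {w = w} {y = y} _ p last) = +-monoˡ-≤ 0 p
  RS-sum (cons {w = w} {y = y} _ p (cons {w = w₁} {y = y₁} {ws = ws} {ws′ = ws′} q q′ r)) =
    +-mono-≤ p (RS-sum (cons q q′ r))

  -- b is the top of a chain b ∷ C; the strip from b to c need not fit the lattice condition.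
  -- The output chain c ∷ C′ is c ∷ b̄ ∷ ā ∷ ⋯, each entry repaired in turn.
  data Raise : List ℕ → List ℕ → List (List ℕ) → List (List ℕ) → Set where
    stop : Raise c b [] (b ∷ [])
    step : Up 0 a b c b̄ e → Raise b̄ a C C′ → Raise c b (a ∷ C) (b̄ ∷ C′)

  Raise-functional : Raise c b C C′ → Raise c b C D → C′ ≡ D
  Raise-functional stop stop = refl
  Raise-functional (step up r) (step up′ r′)
    with refl , refl ← Up-functional up up′
    with refl ← Raise-functional r r′ = refl

  data Pop (μ : List ℕ) : List ℕ → List ℕ → List ℕ → List (List ℕ) → Set where
    pop : LR μ ws (a ∷ C) → H a b → sum a + w ≡ sum b → Pop μ (w ∷ ws) b a C

  LR-pop : LR μ ws (b ∷ a ∷ C) → Pop μ ws b a C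
  LR-pop (one h p) = pop none h p
  LR-pop (more l h _ p) = pop l h p

  -- The output chain does not contain the counters `e`. Both inputs have the weights `ws`, so once
  -- the shapes further down agree, `b` and `ā` have the same size, and `Up-sum` yields equal
  -- counters.
  Raise-injective : Raise c b C C′ → Raise c ā D C′ → LR μ ws (b ∷ C) → LR μ ws (ā ∷ D) → b ≡ ā × C ≡ D
  Raise-injective stop stop l l′ = refl , refl
  Raise-injective {c = c} (step {a = a} {b = b} {b̄ = b̄} {e = e} up r) (step {b = b′} {e = e′} up′ r′) l l′
    with pop {w = w} m _ p ← LR-pop l | pop m′ _ p′ ← LR-pop l′
    with refl , refl ← Raise-injective r r′ m m′
    with refl ← (e ≡ e′) ∋ (≡-by ((Up-sum up) ⊞ sym (Up-sum up′) ⊞ sym p ⊞ p′) (lin 8 (λ x₁ x₂ x₃ x₄ x₅ e e′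
          w → e :+ (con 0 :+ (x₂ :+ x₃) :+ (e′ :+ (x₁ :+ x₅)) :+ (x₁ :+ w) :+ x₄) := e′ :+ (e :+ (x₁ :+ x₅)
          :+ (con 0 :+ (x₄ :+ x₃)) :+ x₂ :+ (x₁ :+ w))) refl (sum a) (sum b) (sum b̄) (sum b′) (sum c) e e′ w))
    with refl , _ ← Up-injective up up′ = refl , refl

  -- The letters that remain `i + 1` are those matched with an original `i`; hence the new top
  -- weight is the old one minus `e`. The other half of the interlacing of weights, that each weight
  -- is at most the new weight one place lower, is the inequality `e₂ ≤ e₁` translated into sizes.
  Raise-exists : LR μ ws (b ∷ C) → H b c →
                 ∃[ C′ ] ∃[ ws′ ] Raise c b C C′ × LR μ ws′ (c ∷ C′) × RS ws ws′
  Raise-exists none h with x , p ← split≤ (HS-sum (proj₂ h)) = _ , _ , stop , one h p , last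
  Raise-exists {μ = μ} {c = c} (one {b = b} {w = w} h p) h′
    with u , k , k′ ← common h h′
    with b̄ , e , up , g , g′ ← Up-exists {w = 0} k k′ (m≤m+n u 0)
    with _ , l ← Up-Lat up (z≤n {0})
    with x , q ← split≤ (HS-sum g) | y , q′ ← split≤ (HS-sum g′)
    = _ , _ , step up stop , more (one (_ , g) q) (_ , g′) l q′
    , cons (≤-slack e (≤-reflexive (Up-sum up) ⊕ ≤-reflexive (sym p) ⊕ ≤-reflexive q′) (lin 7 (λ x₁ x₂ x₃ x₄
          e w y → y :+ (con 0 :+ (x₁ :+ x₂) :+ (x₄ :+ w) :+ x₃) :+ e := w :+ (e :+ (x₄ :+ x₃) :+ x₁ :+ (x₂ :+
          y))) refl (sum b) (sum b̄) (sum c) (sum μ) e w y))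
           (≤-by (≤-reflexive p ⊕ ≤-reflexive (sym q) ⊕ (Pw-sum (Up-pw up))) (lin 5 (λ x₁ x₂ x₃ w x → w :+
                 (x₁ :+ (x₃ :+ x) :+ x₂) := x :+ (x₃ :+ w :+ x₂ :+ x₁)) refl (sum b) (sum b̄) (sum μ) w x)) last
  Raise-exists {c = c} (more {b = a} {a = o} {c = b} {e = e₁} {x = w} l h lat p) h′
    with u , k , k′ ← common h h′
    with b̄ , e , up , g , g′ ← Up-exists {w = 0} k k′ (m≤m+n u 0)
    with _ , _ , step {b̄ = ā} {e = e₂} up₂ r , m , rs ← Raise-exists l (_ , g)
    with (_ , lat₃) , e₂≤e₁ ← Up-Up-Lat {w₃ = 0} lat up up₂ z≤n refl
    with pop {w = x} m′ _ q ← LR-pop m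
    with y , q′ ← split≤ (HS-sum g′)
    = _ , _ , step up (step up₂ r) , more m (_ , g′) lat₃ q′
    , cons (≤-slack e (≤-reflexive (Up-sum up) ⊕ ≤-reflexive (sym p) ⊕ ≤-reflexive q′) (lin 7 (λ x₁ x₂ x₃ x₄
          e w y → y :+ (con 0 :+ (x₂ :+ x₃) :+ (x₁ :+ w) :+ x₄) :+ e := w :+ (e :+ (x₁ :+ x₄) :+ x₂ :+ (x₃ :+
          y))) refl (sum a) (sum b) (sum b̄) (sum c) e w y))
           (≤-by (≤-reflexive p ⊕ ≤-reflexive (sym q) ⊕ e₂≤e₁ ⊕ ≤-reflexive (sym (Up-sum up₂)) ⊕ ≤-reflexive
                 (Lat-sum lat)) (lin 9 (λ x₁ x₂ x₃ x₄ x₅ e₁ e₂ w x → w :+ (x₂ :+ (x₅ :+ x) :+ e₁ :+ (e₂ :+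
                 (x₄ :+ x₃)) :+ (con 0 :+ (x₁ :+ x₁))) := x :+ (x₁ :+ w :+ x₃ :+ e₂ :+ (con 0 :+ (x₁ :+ x₅))
                 :+ (e₁ :+ (x₂ :+ x₄)))) refl (sum a) (sum b) (sum b̄) (sum o) (sum ā) e₁ e₂ w x)) rs

  -- `Raise` repairs from the top downwards, so the rest of the chain has to be lowered before its
  -- top shape.
  Lower-exists : LR μ ws′ (c ∷ b̄ ∷ C′) → RS ws ws′ →
                 ∃[ b ] ∃[ C ] Raise c b C (b̄ ∷ C′) × LR μ ws (b ∷ C) × H b c
  Lower-exists (one h p) last = _ , _ , stop , none , h
  Lower-exists {μ = μ} {c = c} {b̄ = b̄} (more {w = y} {ws = ws″} {a = ā} {C = C″} {e = e₀} {x = x} l h lat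
        p) (cons {w = w} {ws = ws} x≤w w≤y rs)
    with pop {w = y′} m ha q ← LR-pop l
    with Lower-exists l rs
  ... | a , .[] , stop , none , ha′
    with u , k , k′ ← common ha′ h
    with e , x+e≡w ← split≤ x≤w
    with b , _ , z≤n , up , g , g′ ← Down-exists {e = e} lat k k′ (≤-by (≤-reflexive (sym (Lat-sum lat)) ⊕
          ≤-reflexive (sym p) ⊕ ≤-reflexive q ⊕ ≤-reflexive x+e≡w ⊕ w≤y) (lin 8 (λ x₁ x₂ x₃ e e₀ w x y → e :+
          (e₀ :+ (x₃ :+ x₁) :+ (x₂ :+ x) :+ x₂ :+ w :+ y) := e₀ :+ (con 0 :+ (x₂ :+ x₂) :+ x₃ :+ (x₁ :+ y) :+
          (x :+ e) :+ w)) refl (sum a) (sum b̄) (sum c) e e₀ w x y))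
    = b , _ , step up stop
    , one (_ , g) (≡-by ((Up-sum up) ⊞ p ⊞ sym x+e≡w) (lin 7 (λ x₁ x₂ x₃ x₄ e w x → x₁ :+ w :+ (con 0 :+ (x₂
          :+ x₃) :+ x₄ :+ (x :+ e)) := x₂ :+ (e :+ (x₁ :+ x₄) :+ (x₃ :+ x) :+ w)) refl (sum a) (sum b) (sum
          b̄) (sum c) e w x))
    , (_ , g′ _ (inj₁ ≤-refl))
  ... | a , _ , r@(step {a = o} up₂ r′) , l′ , ha′
    with u , k , k′ ← common ha′ h
    -- Of the `w` letters `i` in the strip to be recovered, `x` are matched by the remaining letters
    -- `i + 1`; so `w - x` must stay unmatched.
    with e , x+e≡w ← split≤ x≤w
    with e₁ , lat′ ← Lat-lower {v = 0} lat (Up-pw up₂) z≤n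
    with b , _ , z≤n , up , g , g′ ← Down-exists {e = e} lat′ k k′ (≤-by (≤-reflexive (sym (Lat-sum lat′)) ⊕
          ≤-reflexive (sym p) ⊕ ≤-reflexive (LR-sum l) ⊕ ≤-reflexive (sym (LR-sum l′)) ⊕ (RS-sum (cons x≤w
          w≤y rs)) ⊕ ≤-reflexive x+e≡w) (lin 11 (λ x₁ x₂ x₃ x₄ x₅ x₆ e e₁ w x y → e :+ (e₁ :+ (x₃ :+ x₁) :+
          (x₂ :+ x) :+ x₂ :+ (x₆ :+ x₄) :+ (y :+ x₅) :+ w) := e₁ :+ (con 0 :+ (x₂ :+ x₂) :+ x₃ :+ (x₆ :+ (y
          :+ x₅)) :+ x₁ :+ (w :+ x₄) :+ (x :+ e))) refl (sum a) (sum b̄) (sum c) (sum ws) (sum ws″) (sum μ) e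
          e₁ w x y))
    with _ , lat″ ← Down-Down-Lat {w₁ = 0} up up₂ lat (≤-by (≤-reflexive (sym (Lat-sum lat)) ⊕ ≤-reflexive
          (sym p) ⊕ ≤-reflexive q ⊕ ≤-reflexive x+e≡w ⊕ w≤y) (lin 8 (λ x₁ x₂ x₃ e e₀ w x y → e :+ (e₀ :+ (x₂
          :+ x₃) :+ (x₁ :+ x) :+ x₁ :+ w :+ y) := e₀ :+ (con 0 :+ (x₁ :+ x₁) :+ x₂ :+ (x₃ :+ y) :+ (x :+ e)
          :+ w)) refl (sum b̄) (sum c) (sum ā) e e₀ w x y)) refl
    with pop _ _ _ ← LR-pop l′
    = b , _ , step up r
    , more l′ (_ , g) lat″ (≡-by ((Up-sum up) ⊞ p ⊞ sym x+e≡w) (lin 7 (λ x₁ x₂ x₃ x₄ e w x → x₁ :+ w :+ (con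
          0 :+ (x₂ :+ x₃) :+ x₄ :+ (x :+ e)) := x₂ :+ (e :+ (x₁ :+ x₄) :+ (x₃ :+ x) :+ w)) refl (sum a) (sum
          b) (sum b̄) (sum c) e w x))
    , (_ , g′ _ (inj₁ ≤-refl))

-- Cardinalities of predicates and correspondences between them.

module Counting where
  open LinearArithmetic

  private variable
    A B : Set
    P P′ : A → Set
    Q Q′ : B → Set
    m n : ℕ
    xs ys : List A

  record Enum {A : Set} (P : A → Set) (xs : List A) : Set where
    constructor enum
    field
      unique   : Unique xs
      sound    : ∀ {x} → x ∈ xs → P x
      complete : ∀ {x} → P x → x ∈ xs
  open Enum public

  Card : {A : Set} → (A → Set) → ℕ → Set
  Card P n = ∃[ xs ] Enum P xs × length xs ≡ n

  Finite : {A : Set} → (A → Set) → Set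
  Finite P = ∃[ n ] Card P n

  Enum⇒Card : Enum P xs → Card P (length xs)
  Enum⇒Card E = _ , E , refl

  unique-⊆-length : Unique xs → (∀ {x : A} → x ∈ xs → x ∈ ys) → length xs ≤ length ys
  unique-⊆-length [] _ = z≤n
  unique-⊆-length {xs = x ∷ xs} (x∉ ∷ uq) sub
    with as , bs , refl ← ∈-∃++ (sub (here refl)) = begin
    suc (length xs)               ≤⟨ s≤s (unique-⊆-length uq sub′) ⟩
    suc (length (as ++ bs))       ≡⟨ cong suc (length-++ as) ⟩
    suc (length as + length bs)   ≡⟨ +-suc (length as) (length bs) ⟨
    length as + suc (length bs)   ≡⟨ length-++ as ⟨
    length (as ++ x ∷ bs)         ∎
    where
    open ≤-Reasoning
    sub′ : ∀ {y} → y ∈ xs → y ∈ as ++ bs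
    sub′ y∈ with ∈-++⁻ as (sub (there y∈))
    ... | inj₁ y∈as = ∈-++⁺ˡ y∈as
    ... | inj₂ (there y∈bs) = ∈-++⁺ʳ as y∈bs
    ... | inj₂ (here refl) = ⊥-elim (All.lookup x∉ y∈ refl)

  Card-unique : Card P m → Card P n → m ≡ n
  Card-unique (_ , E , refl) (_ , F , refl) =
    ≤-antisym (unique-⊆-length (unique E) (complete F ∘ sound E))
              (unique-⊆-length (unique F) (complete E ∘ sound F))

  Enum-⇔ : (∀ {x} → P x → P′ x) → (∀ {x} → P′ x → P x) → Enum P xs → Enum P′ xs
  Enum-⇔ f g E = enum (unique E) (f ∘ sound E) (complete E ∘ g)

  Card-⇔ : (∀ {x} → P x → P′ x) → (∀ {x} → P′ x → P x) → Card P n → Card P′ n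
  Card-⇔ f g (_ , E , eq) = _ , Enum-⇔ f g E , eq

  Enum-filterᵇ : (p : A → Bool) → Enum P xs → Enum (λ x → P x × True (p x)) (filterᵇ p xs)
  Enum-filterᵇ p E = enum (Unique.filter⁺ (T? ∘ p) (unique E))
    (λ x∈ → let x∈′ , t = ∈-filter⁻ (T? ∘ p) x∈ in sound E x∈′ , t)
    (λ (Px , t) → ∈-filter⁺ (T? ∘ p) (complete E Px) t)

  Finite-⊆ : {A : Set} {P Q : A → Set} → Finite Q → (∀ {x} → P x → Q x) → Decidable P → Finite P
  Finite-⊆ (_ , xs , E , _) P⊆Q P? = _ , filter P? xs
    , enum (Unique.filter⁺ P? (unique E)) (proj₂ ∘ ∈-filter⁻ P? {xs = xs}) (λ Px → ∈-filter⁺ P? (complete E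
          (P⊆Q Px)) Px)
    , refl

  Enum-map : {f : A → B} → (∀ {x y} → f x ≡ f y → x ≡ y) → Enum P xs →
             Enum (λ y → ∃[ x ] P x × y ≡ f x) (map f xs)
  Enum-map {f = f} inj E = enum (Unique.map⁺ inj (unique E))
    (λ y∈ → let x , x∈ , eq = ∈-map⁻ f y∈ in x , sound E x∈ , eq)
    (λ where (x , Px , refl) → ∈-map⁺ f (complete E Px))

  private
    concat-enum : (f : A → List B) {R : A → B → Set} → Unique xs →
                  (∀ {x} → x ∈ xs → Enum (R x) (f x)) →
                  (∀ {x x′ y} → R x y → R x′ y → x ≡ x′) →
                  Enum (λ y → ∃[ x ] x ∈ xs × R x y) (concatMap f xs)
    concat-enum f [] _ _ = enum [] (λ ()) λ ()
    concat-enum {xs = x ∷ xs} f {R} (x∉ ∷ uq) g disj = enum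
      (Unique.++⁺ (unique Ex) (unique rest) λ (y∈ , y∈′) →
        let x′ , x′∈ , r = sound rest y∈′ in All.lookup x∉ x′∈ (disj (sound Ex y∈) r))
      (λ y∈ → case⁻ (∈-++⁻ (f x) y∈))
      λ where (_ , here refl , r) → ∈-++⁺ˡ (complete Ex r)
              (x′ , there x′∈ , r) → ∈-++⁺ʳ (f x) (complete rest (x′ , x′∈ , r))
      where
      Ex = g (here refl)
      rest = concat-enum f uq (g ∘ there) disj
      case⁻ : ∀ {y} → y ∈ f x ⊎ y ∈ concatMap f xs → ∃[ x′ ] x′ ∈ x ∷ xs × R x′ y
      case⁻ (inj₁ y∈) = x , here refl , sound Ex y∈
      case⁻ (inj₂ y∈) = let x′ , x′∈ , r = sound rest y∈ in x′ , there x′∈ , r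

  Enum-concatMap : (f : A → List B) {R : A → B → Set} → Enum P xs →
                   (∀ {x} → P x → Enum (R x) (f x)) →
                   (∀ {x x′ y} → R x y → R x′ y → x ≡ x′) →
                   Enum (λ y → ∃[ x ] P x × R x y) (concatMap f xs)
  Enum-concatMap f E g disj = Enum-⇔ (λ (x , x∈ , r) → x , sound E x∈ , r) (λ (x , Px , r) → x , complete E
        Px , r)
    (concat-enum f (unique E) (g ∘ sound E) disj)

  private
    Σ-card : {Q : A → B → Set} (f : A → ℕ) → Unique xs → (∀ {x} → x ∈ xs → Card (Q x) (f x)) →
             Card (λ (x , y) → x ∈ xs × Q x y) (sum (map f xs))
    Σ-card f [] _ = [] , enum [] (λ ()) (λ ()) , refl
    Σ-card {xs = x ∷ xs} {Q = Q} f (x∉ ∷ uq) g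
      with ys , Ey , lys ← g (here refl) | zs , Ez , eq ← Σ-card f uq (g ∘ there) =
      map (x ,_) ys ++ zs
      , enum (Unique.++⁺ (unique Ey′) (unique Ez) λ (p , q) → dis (sound Ey′ p) (sound Ez q))
             (λ p → snd (∈-++⁻ (map (x ,_) ys) p))
             cmp
      , trans (length-++ (map (x ,_) ys)) (cong₂ _+_ (trans (length-map (x ,_) ys) lys) eq)
      where
      Ey′ = Enum-map {f = x ,_} (λ where refl → refl) Ey
      dis : ∀ {p} → ∃[ y ] Q x y × p ≡ (x , y) → proj₁ p ∈ xs × uncurry Q p → ⊥
      dis (_ , _ , refl) (x∈ , _) = All.lookup x∉ x∈ refl
      snd : ∀ {p} → p ∈ map (x ,_) ys ⊎ p ∈ zs → proj₁ p ∈ x ∷ xs × uncurry Q p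
      snd (inj₁ p) with _ , q , refl ← sound Ey′ p = here refl , q
      snd (inj₂ p) = let x∈ , q = sound Ez p in there x∈ , q
      cmp : ∀ {p} → proj₁ p ∈ x ∷ xs × uncurry Q p → p ∈ map (x ,_) ys ++ zs
      cmp = λ where (here refl , q) → ∈-++⁺ˡ (complete Ey′ (_ , q , refl))
                    (there x∈ , q) → ∈-++⁺ʳ (map (x ,_) ys) (complete Ez (x∈ , q))

  Card-Σ : {A B : Set} {P : A → Set} {xs : List A} {Q : A → B → Set} {f : A → ℕ} → Enum P xs → (∀ {x} → P x →
        Card (Q x) (f x)) →
           Card (λ (x , y) → P x × Q x y) (sum (map f xs))
  Card-Σ {f = f} E g = Card-⇔ (λ (p , q) → sound E p , q) (λ (p , q) → complete E p , q)
    (Σ-card f (unique E) (g ∘ sound E))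

  -- A one-to-one correspondence between P and Q, given by a relation rather than by a pair of functions.
  record Bij {A B : Set} (P : A → Set) (Q : B → Set) : Set₁ where
    field
      R          : A → B → Set
      to         : ∀ {x} → P x → ∃[ y ] Q y × R x y
      from       : ∀ {y} → Q y → ∃[ x ] P x × R x y
      functional : ∀ {x y y′} → P x → Q y → Q y′ → R x y → R x y′ → y ≡ y′
      injective  : ∀ {x x′ y} → P x → P x′ → Q y → R x y → R x′ y → x ≡ x′
  open Bij

  private
    image : (β : Bij P Q) → Unique xs → (∀ {x} → x ∈ xs → P x) →
            ∃[ ys ] Enum (λ y → ∃[ x ] x ∈ xs × Q y × R β x y) ys × length ys ≡ length xs
    image β [] _ = [] , enum [] (λ ()) (λ ()) , refl
    image {xs = x ∷ xs} β (x∉ ∷ uq) ok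
      with ys , E , eq ← image β uq (ok ∘ there) | y , Qy , r ← to β (ok (here refl)) =
      y ∷ ys
      , enum (All.tabulate (λ {y′} y′∈ y≡y′ → let x′ , x′∈ , Qy′ , r′ = sound E y′∈ in
                All.lookup x∉ x′∈ (injective β (ok (here refl)) (ok (there x′∈)) Qy r (subst (R β x′) (sym
                      y≡y′) r′)))
              ∷ unique E)
             (λ where (here refl) → x , here refl , Qy , r
                      (there p) → let x′ , x′∈ , q = sound E p in x′ , there x′∈ , q)
             (λ where (_ , here refl , Qy′ , r′) → here (functional β (ok (here refl)) Qy′ Qy r′ r)
                      (x′ , there x′∈ , q) → there (complete E (x′ , x′∈ , q)))
      , cong suc eq

  Card-Bij : Bij P Q → Card P n → Card Q n
  Card-Bij β (xs , E , refl) with ys , F , eq ← image β (unique E) (sound E) =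
    ys , Enum-⇔ (λ (_ , _ , Qy , _) → Qy) (λ Qy → let x , Px , r = from β Qy in x , complete E Px , Qy , r) F , eq

  maps-Bij : (f : A → B) (g : B → A) → (∀ {x} → P x → Q (f x)) → (∀ {y} → Q y → P (g y)) →
             (∀ {x} → P x → g (f x) ≡ x) → (∀ {y} → Q y → f (g y) ≡ y) → Bij P Q
  maps-Bij f g f-ok g-ok gf fg = record
    { R = λ x y → y ≡ f x
    ; to = λ p → f _ , f-ok p , refl
    ; from = λ q → g _ , g-ok q , sym (fg q)
    ; functional = λ _ _ _ e e′ → trans e (sym e′)
    ; injective = λ p p′ _ e e′ → trans (sym (gf p)) (trans (cong g (trans (sym e) e′)) (gf p′)) }

  -- The relation holds vacuously when one side has no cardinality. Chaining it therefore needs the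
  -- middle predicate to be finite.
  _≈_ : (A → Set) → (B → Set) → Set
  P ≈ Q = ∀ {m n} → Card P m → Card Q n → m ≡ n

  Bij⇒≈ : Bij P Q → P ≈ Q
  Bij⇒≈ β c d = Card-unique (Card-Bij β c) d

  private
    sum-map-cong : ∀ {f g : A → ℕ} → (∀ {x} → x ∈ xs → f x ≡ g x) → sum (map f xs) ≡ sum (map g xs)
    sum-map-cong {xs = []} eq = refl
    sum-map-cong {xs = x ∷ xs} eq = cong₂ _+_ (eq (here refl)) (sum-map-cong (eq ∘ there))

  Σ-≈ : {A B : Set} {P : A → Set} {Q : A → B → Set} {B′ : Set} {Q′ : A → B′ → Set} → Finite P →
        (∀ x → Finite (Q x)) → (∀ x → Finite (Q′ x)) → (∀ {x} → P x → Q x ≈ Q′ x) →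
        (λ (x , y) → P x × Q x y) ≈ (λ (x , y) → P x × Q′ x y)
  Σ-≈ (_ , xs , E , _) fin fin′ eq c d = trans (Card-unique c (Card-Σ E λ {x} _ → proj₂ (fin x)))
    (trans (sum-map-cong λ {x} x∈ → eq (sound E x∈) (proj₂ (fin x)) (proj₂ (fin′ x)))
           (Card-unique (Card-Σ E λ {x} _ → proj₂ (fin′ x)) d))

  Finite-Σ : {A B : Set} {P : A → Set} {Q : A → B → Set} → Finite P → (∀ x → Finite (Q x)) → Finite (λ (x ,
        y) → P x × Q x y)
  Finite-Σ (_ , xs , E , _) fin = _ , Card-Σ E λ {x} _ → proj₂ (fin x)

  ≈-trans : {C : Set} {R : C → Set} → Finite Q → P ≈ Q → Q ≈ R → P ≈ R
  ≈-trans (_ , c) p q d e = trans (p d c) (q c e)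

  sum-cancel : {f g : A → ℕ} {x : A} → Unique xs → x ∈ xs → sum (map f xs) ≡ sum (map g xs) →
               (∀ {y} → y ∈ xs → y ≢ x → f y ≡ g y) → f x ≡ g x
  sum-cancel {f = f} {g} {x} (x∉ ∷ uq) (here refl) eq same =
    +-cancelʳ-≡ _ (f x) (g x) (trans eq (cong (g x +_) (sym (sum-map-cong λ {y} y∈ → same (there y∈) λ where refl → All.lookup x∉ y∈ refl))))
  sum-cancel {f = f} {g} {x} (_∷_ {x = y} y∉ uq) (there x∈) eq same = sum-cancel uq x∈
    (+-cancelˡ-≡ (f y) _ _ (trans eq (cong (_+ _) (sym (same (here refl) λ where refl → All.lookup y∉ x∈ refl)))))
    (same ∘ there)

  -- The subtraction that no bijection provides: two disjoint unions of equal size, whose fibres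
  -- agree in size everywhere else, agree in size at `x`.
  Σ-≈-cancel : {A B : Set} {P : A → Set} {Q : A → B → Set} {B′ : Set} {Q′ : A → B′ → Set} {x : A} → Finite P →
               (∀ x → Finite (Q x)) → (∀ x → Finite (Q′ x)) →
               (λ (x , y) → P x × Q x y) ≈ (λ (x , y) → P x × Q′ x y) →
               P x → (∀ {y} → P y → y ≢ x → Q y ≈ Q′ y) → Q x ≈ Q′ x
  Σ-≈-cancel {x = x} (_ , xs , E , _) fin fin′ eq Px same c d =
    trans (Card-unique c (proj₂ (fin x))) (trans
      (sum-cancel (unique E) (complete E Px)
        (eq (Card-Σ E λ {x} _ → proj₂ (fin x)) (Card-Σ E λ {x} _ → proj₂ (fin′ x)))
        (λ {y} y∈ y≢x → same (sound E y∈) y≢x (proj₂ (fin y)) (proj₂ (fin′ y))))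
      (Card-unique (proj₂ (fin′ x)) d))

-- The Pieri rule by local growth rules.

module PieriRule where
  open LinearArithmetic
  open Strips
  open Counting

  HS-length : HS u μ ƛ → length μ ≡ length ƛ
  HS-length [] = refl
  HS-length (cons _ _ h) = cong suc (HS-length h)

  data Add : List ℕ → List ℕ → List ℕ → Set where
    []   : Add [] [] []
    cons : ∀ {i j k} → i + j ≡ k → Add α β γ → Add (i ∷ α) (j ∷ β) (k ∷ γ)

  Add-sum : Add α β γ → sum α + sum β ≡ sum γ
  Add-sum [] = refl
  Add-sum {α = i ∷ α} {j ∷ β} {k ∷ γ} (cons p add) = (≡-by (p ⊞ (Add-sum add)) (lin 6 (λ x₁ x₂ x₃ i j k → i
        :+ x₁ :+ (j :+ x₂) :+ (k :+ x₃) := k :+ x₃ :+ (i :+ j :+ (x₁ :+ x₂))) refl (sum α) (sum β) (sum γ) i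
        j k))

  Add-length : Add α β γ → length α ≡ length γ × length β ≡ length γ
  Add-length [] = refl , refl
  Add-length (cons _ add) = let p , q = Add-length add in cong suc p , cong suc q

  -- Semistandard tableaux as Gelfand–Tsetlin patterns; the weight lists the largest letter first.
  data S : List ℕ → List ℕ → List (List ℕ) → Set where
    done : All (_≡ 0) ƛ → S ƛ [] []
    step : ∀ {x} → H κ ƛ → sum κ + x ≡ sum ƛ → S κ γ T → S ƛ (x ∷ γ) (κ ∷ T)

  HS-zero : HS 0 μ ƛ → All (_≡ 0) ƛ
  HS-zero [] = []
  HS-zero (cons z≤n z≤n h) = refl ∷ HS-zero h

  zeros-HS : All (_≡ 0) ƛ → HS 0 ƛ ƛ
  zeros-HS [] = []
  zeros-HS (refl ∷ zs) = cons z≤n z≤n (zeros-HS zs)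

  HS-zeros : HS u μ ƛ → All (_≡ 0) ƛ → μ ≡ ƛ
  HS-zeros [] [] = refl
  HS-zeros (cons z≤n _ h) (refl ∷ zs) = cong (0 ∷_) (HS-zeros h zs)

  Tail0 : ℕ → List ℕ → Set
  Tail0 zero xs = All (_≡ 0) xs
  Tail0 (suc k) [] = ⊤
  Tail0 (suc k) (_ ∷ xs) = Tail0 k xs

  HS-Tail0 : ∀ k → HS u κ ƛ → Tail0 k κ → Tail0 (suc k) ƛ
  HS-Tail0 k [] _ = tt
  HS-Tail0 zero (cons _ _ h) (refl ∷ _) = HS-zero h
  HS-Tail0 (suc k) (cons _ _ h) t = HS-Tail0 k h t

  -- A horizontal strip creates at most one new row, so a pattern in `k` letters has at most `k`
  -- nonzero rows.
  S-Tail0 : S ƛ γ T → Tail0 (length γ) ƛ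
  S-Tail0 (done zs) = zs
  S-Tail0 (step (_ , h) _ s) = HS-Tail0 _ h (S-Tail0 s)

  data LastZero : List ℕ → Set where
    here  : LastZero (0 ∷ [])
    there : ∀ {t} → LastZero τ → LastZero (t ∷ τ)

  Tail0-last : ∀ k → Tail0 k τ → k < length τ → LastZero τ
  Tail0-last zero (refl ∷ []) _ = here
  Tail0-last zero (_ ∷ zs@(_ ∷ _)) _ = there (Tail0-last zero zs (s≤s z≤n))
  Tail0-last {τ = _ ∷ _} (suc k) t (s≤s k<) = there (Tail0-last k t k<)

  -- Fomin's local rule: given μ and τ, a shape κ below both together with e extra boxes
  -- corresponds to a shape ƛ above both.
  data Grow : ℕ → List ℕ → List ℕ → List ℕ → List ℕ → Set where
    []   : Grow 0 [] [] [] []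
    cons : ∀ {m t k l} → m ⊔ t + e ≡ l → k + e′ ≡ m ⊓ t → Grow e′ μ τ κ ƛ →
           Grow e (m ∷ μ) (t ∷ τ) (k ∷ κ) (l ∷ ƛ)

  m⊔n+m⊓n : ∀ m n → m ⊔ n + m ⊓ n ≡ m + n
  m⊔n+m⊓n zero n = +-identityʳ n
  m⊔n+m⊓n (suc m) zero = refl
  m⊔n+m⊓n (suc m) (suc n) = cong suc (trans (+-suc _ _) (trans (cong suc (m⊔n+m⊓n m n)) (sym (+-suc m n))))

  Grow-sum : Grow e μ τ κ ƛ → sum ƛ + sum κ ≡ sum μ + sum τ + e
  Grow-sum [] = refl
  Grow-sum {e = e} (cons {e′ = e′} {μ} {τ} {κ} {ƛ} {m = m} {t} {k} {l} p q g) = (≡-by (sym p ⊞ q ⊞ (m⊔n+m⊓n m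
        t) ⊞ (Grow-sum g)) (lin 12 (λ x₁ x₂ x₃ x₄ x₅ x₆ e e′ k l m t → l :+ x₃ :+ (k :+ x₄) :+ (x₂ :+ e :+ x₁
        :+ (m :+ t) :+ (x₅ :+ x₆ :+ e′)) := m :+ x₅ :+ (t :+ x₆) :+ e :+ (l :+ (k :+ e′) :+ (x₂ :+ x₁) :+ (x₃
        :+ x₄))) refl (m ⊓ t) (m ⊔ t) (sum ƛ) (sum κ) (sum μ) (sum τ) e e′ k l m t))

  Grow-functional : Grow e μ τ κ ƛ → Grow e μ τ κ a → ƛ ≡ a
  Grow-functional [] [] = refl
  Grow-functional (cons {k = k} refl q g) (cons refl q′ g′)
    with refl ← +-cancelˡ-≡ k _ _ (trans q (sym q′)) = cong (_ ∷_) (Grow-functional g g′)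

  Grow-injective : Grow e μ τ κ ƛ → Grow e′ μ τ a ƛ → e ≡ e′ × κ ≡ a
  Grow-injective [] [] = refl , refl
  Grow-injective (cons {m = m} {t} {k} {l} p q g) (cons {k = k′} p′ q′ g′)
    with refl , refl ← Grow-injective g g′ =
    +-cancelˡ-≡ (m ⊔ t) _ _ (trans p (sym p′)) , cong (_∷ _) (+-cancelʳ-≡ _ k k′ (trans q (sym q′)))

  -- Each row receives `e` boxes and hands on the smaller of `m` and `t`, minus `k`, to the next
  -- row. Nothing may be left over after the last row; `LastZero τ` ensures this, since it makes
  -- that minimum zero.
  Grow-exists : ∀ {k v v′ e} → HS k κ μ → HS k κ τ → LastZero τ → k + e ≤ v → k + e ≤ v′ →
                ∃[ ƛ ] Grow e μ τ κ ƛ × HS v μ ƛ × HS v′ τ ƛ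
  Grow-exists {e = e} (cons {m = k} {l = m} k≤m m≤ []) (cons {l = .0} z≤n t≤ []) here e≤v e≤v′ = _
    , cons refl (sym (⊓-zeroʳ m)) []
    , cons (≤-trans (m≤m⊔n m 0) (m≤m+n (m ⊔ 0) e)) (≤-trans (+-monoˡ-≤ e (⊔-lub m≤ t≤)) e≤v) []
    , cons z≤n (≤-trans (+-monoˡ-≤ e (⊔-lub m≤ t≤)) e≤v′) []
  Grow-exists {e = e} (cons {m = k} {l = m} k≤m m≤ h) (cons {l = t} k≤t t≤ h′) (there lz) e≤v e≤v′
    with e′ , q ← split≤ (⊓-glb k≤m k≤t)
    with _ , g , i , i′ ← Grow-exists {v = m} {v′ = t} {e = e′} h h′ lz (≤-trans (≤-reflexive q) (m⊓n≤m m t))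
          (≤-trans (≤-reflexive q) (m⊓n≤n m t)) = _
    , cons refl q g
    , cons (≤-trans (m≤m⊔n m t) (m≤m+n (m ⊔ t) e)) (≤-trans (+-monoˡ-≤ e (⊔-lub m≤ t≤)) e≤v) i
    , cons (≤-trans (m≤n⊔m m t) (m≤m+n (m ⊔ t) e)) (≤-trans (+-monoˡ-≤ e (⊔-lub m≤ t≤)) e≤v′) i′

  -- Runs from the last row upwards. The bound `e ≤ v ⊓ v′` is what allows the row above to subtract
  -- `e` and obtain its entry of `κ`.
  Shrink-exists : ∀ {v v′} → HS v μ ƛ → HS v′ τ ƛ →
                  ∃[ e ] ∃[ κ ] e ≤ v ⊓ v′ × Grow e μ τ κ ƛ ×
                                (∀ u → v ⊓ v′ ≤ u + e → HS u κ μ × HS u κ τ)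
  Shrink-exists [] [] = _ , _ , z≤n , [] , λ _ _ → [] , []
  Shrink-exists {v = v} {v′} (cons {m = m} {l = l} m≤l l≤v h) (cons {m = t} t≤l l≤v′ h′)
    with e′ , κ , e′≤ , g , hs ← Shrink-exists h h′
    with e , p ← split≤ (⊔-lub m≤l t≤l)
    with k , q ← split≤ e′≤
    with q′ ← trans (+-comm k e′) q
    with i , i′ ← hs k (≤-reflexive (sym q′))
    = e , k ∷ κ , ≤-trans (≤-trans (m≤n+m e (m ⊔ t)) (≤-reflexive p)) (⊓-glb l≤v l≤v′)
    , cons p q′ g
    , λ u le → let max≤u = +-cancelʳ-≤ e (m ⊔ t) u (≤-trans (≤-trans (≤-reflexive p) (⊓-glb l≤v l≤v′)) le)
                   k≤ = ≤-trans (m≤m+n k e′) (≤-reflexive q′)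
               in cons (≤-trans k≤ (m⊓n≤m m t)) (≤-trans (m≤m⊔n m t) max≤u) i
                , cons (≤-trans k≤ (m⊓n≤n m t)) (≤-trans (m≤n⊔m m t) max≤u) i′

  -- A growth diagram with one local rule per letter. It joins a pattern `T` of shape `μ` and weight
  -- `ε` to a pattern `T′` of shape `ƛ`; `ζ` is the monomial taken from h_x, one exponent for each
  -- letter.
  data Pieri : List ℕ → List ℕ → List ℕ → List (List ℕ) → List ℕ → List (List ℕ) → Set where
    done : Pieri μ [] [] [] μ []
    step : ∀ {i j} → Pieri κ ε ζ T τ T′ → Grow j μ τ κ ƛ → Pieri μ (i ∷ ε) (j ∷ ζ) (κ ∷ T) ƛ (τ ∷ T′)

  -- The inner pattern uses one letter fewer than there are letters in `γ`, so with at least as many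
  -- rows as letters the last row of `τ` is zero and the local rule applies.
  Pieri-exists : length γ ≤ length μ → Add ε ζ γ → S μ ε T →
                 ∃[ ƛ ] ∃[ T′ ] H μ ƛ × S ƛ γ T′ × Pieri μ ε ζ T ƛ T′
  Pieri-exists _ [] (done zs) = _ , _ , (_ , zeros-HS zs) , done zs , done
  Pieri-exists {μ = μ} {ζ = j ∷ _} le (cons {i = i} {k = k} p add) (step {κ = κ} h q s)
    with τ , _ , h′ , s′ , r ← Pieri-exists (≤-pred (≤-trans le (≤-trans (≤-reflexive (sym (HS-length (proj₂
          h)))) (n≤1+n _)))) add s
    with u , i₁ , i₂ ← common h h′
    with ƛ , g , l , l′ ← Grow-exists {v = u + j} {v′ = u + j} i₁ i₂
           (Tail0-last _ (S-Tail0 s′) (≤-trans le (≤-reflexive (trans (sym (HS-length (proj₂ h))) (HS-length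
                 (proj₂ h′)))))) ≤-refl ≤-refl
    = _ , _ , (_ , l)
    , step (_ , l′) (≡-by (sym p ⊞ q ⊞ sym (Grow-sum g)) (lin 7 (λ x₁ x₂ x₃ x₄ i j k → x₄ :+ k :+ (i :+ j :+
          x₃ :+ (x₁ :+ x₂)) := x₁ :+ (k :+ (x₂ :+ i) :+ (x₃ :+ x₄ :+ j))) refl (sum ƛ) (sum κ) (sum μ) (sum
          τ) i j k)) s′
    , step r g

  Pieri-inverse : H μ ƛ → S ƛ γ T′ → ∃[ ε ] ∃[ ζ ] ∃[ T ] Add ε ζ γ × S μ ε T × Pieri μ ε ζ T ƛ T′
  Pieri-inverse (_ , h) (done zs) with refl ← HS-zeros h zs = _ , _ , _ , [] , done zs , done
  Pieri-inverse {μ = μ} {ƛ} h (step {κ = τ} {x = k} h′ q s)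
    with u , i₁ , i₂ ← common h h′
    with e , κ , _ , g , hs ← Shrink-exists i₁ i₂
    with l , l′ ← hs u (≤-trans (m⊓n≤m u u) (m≤m+n u e))
    with _ , _ , _ , add , s′ , r ← Pieri-inverse (_ , l′) s
    with i , p ← split≤ (HS-sum l)
    = _ , _ , _
    , cons (≡-by (sym q ⊞ p ⊞ sym (Grow-sum g)) (lin 7 (λ x₁ x₂ x₃ x₄ e i k → i :+ e :+ (x₄ :+ k :+ x₃ :+ (x₁
          :+ x₂)) := k :+ (x₁ :+ (x₂ :+ i) :+ (x₃ :+ x₄ :+ e))) refl (sum ƛ) (sum κ) (sum μ) (sum τ) e i k)) add
    , step (_ , l) p s′ , step r g

  Pieri-functional : Pieri μ ε ζ T ƛ T′ → Pieri μ ε ζ T a C → ƛ ≡ a × T′ ≡ C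
  Pieri-functional done done = refl , refl
  Pieri-functional (step r g) (step r′ g′)
    with refl , refl ← Pieri-functional r r′
    with refl ← Grow-functional g g′ = refl , refl

  -- The diagram does not constrain the entries of `ε`; they are recovered from the sizes recorded
  -- in the two patterns.
  Pieri-injective : S μ ε T → S μ β C → Pieri μ ε ζ T ƛ T′ → Pieri μ β δ C ƛ T′ → ε ≡ β × ζ ≡ δ × T ≡ C
  Pieri-injective _ _ done done = refl , refl , refl
  Pieri-injective (step _ p s) (step _ p′ s′) (step {κ = κ} r g) (step r′ g′)
    with refl , refl ← Grow-injective g g′
    with refl , refl , refl ← Pieri-injective s s′ r r′
    with refl ← +-cancelˡ-≡ (sum κ) _ _ (trans p (sym p′)) = refl , refl , refl

  S-sum : S ƛ γ T → sum ƛ ≡ sum γ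
  S-sum (done []) = refl
  S-sum (done (refl ∷ zs)) = S-sum (done zs)
  S-sum {ƛ = ƛ} (step {κ = κ} {γ = γ} {x = x} _ p s) = (≡-by (sym p ⊞ (S-sum s)) (lin 4 (λ x₁ x₂ x₃ x → x₁ :+
        (x₃ :+ x :+ x₂) := x :+ x₂ :+ (x₁ :+ x₃)) refl (sum ƛ) (sum γ) (sum κ) x))

-- Decidability and finiteness of the families that are counted.

module Finiteness where
  open import Defs
  open LinearArithmetic
  open Strips
  open Chains
  open Counting
  open PieriRule

  HS? : ∀ u μ ƛ → Dec (HS u μ ƛ)
  HS? u [] [] = yes []
  HS? u [] (_ ∷ _) = no λ ()
  HS? u (_ ∷ _) [] = no λ ()
  HS? u (m ∷ μ) (l ∷ ƛ) = map′ (λ (p , q , h) → cons p q h) (λ where (cons p q h) → p , q , h)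
    (m ≤? l ×-dec l ≤? u ×-dec HS? m μ ƛ)

  HS-self : HS u μ ƛ → HS (sum ƛ) μ ƛ
  HS-self [] = []
  HS-self {ƛ = l ∷ ƛ} (cons p q h) = cons p (m≤m+n l (sum ƛ)) h

  H? : ∀ μ ƛ → Dec (H μ ƛ)
  H? μ ƛ = map′ (sum ƛ ,_) (HS-self ∘ proj₂) (HS? (sum ƛ) μ ƛ)

  Lat? : ∀ w a b c → Dec (∃[ e ] Lat w a b c e)
  Lat? w [] [] [] = yes (w , [])
  Lat? w (x ∷ a) (y ∷ b) (z ∷ c) with z ≤? y + w | z + x ≤? w + (y + y)
  ... | no z≰ | _ = no λ where (_ , cons z≤ _ _) → z≰ z≤
  ... | yes z≤ | no ≰ = no λ where (_ , cons {w′ = w′} _ q _) → ≰ (≤-trans (m≤n+m (z + x) w′) (≤-reflexive q))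
  ... | yes z≤ | yes ≤w with w′ , q ← split≤ ≤w = map′
    (λ (e , l) → e , cons z≤ (trans (+-comm w′ _) q) l)
    (λ where (e , cons {w′ = w″} _ q′ l) → e , subst (λ w → Lat w a b c e) (+-cancelʳ-≡ (z + x) w″ w′ (trans q′ (trans (sym q) (+-comm (z + x) w′)))) l)
    (Lat? w′ a b c)
  Lat? w [] [] (_ ∷ _) = no λ where (_ , ())
  Lat? w [] (_ ∷ _) _ = no λ where (_ , ())
  Lat? w (_ ∷ _) [] _ = no λ where (_ , ())
  Lat? w (_ ∷ _) (_ ∷ _) [] = no λ where (_ , ())

  LR? : ∀ μ ws C → Dec (LR μ ws C)
  LR? μ _ [] = no λ ()
  LR? μ [] (b ∷ []) = map′ (λ where refl → none) (λ where none → refl) (≡-dec _≟_ b μ)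
  LR? μ (_ ∷ _) (b ∷ []) = no λ ()
  LR? μ [] (c ∷ b ∷ C) = no λ ()
  LR? μ (w ∷ []) (c ∷ b ∷ []) = map′ (λ where (refl , h , p) → one h p) (λ where (one h p) → refl , h , p)
    (≡-dec _≟_ b μ ×-dec H? μ c ×-dec (sum μ + w ≟ sum c))
  LR? μ (w ∷ []) (c ∷ b ∷ a ∷ C) = no λ ()
  LR? μ (x ∷ w ∷ ws) (c ∷ b ∷ []) = no λ ()
  LR? μ (x ∷ w ∷ ws) (c ∷ b ∷ a ∷ C) = map′ (λ (l , h , (_ , lat) , p) → more l h lat p) (λ where (more l h lat p) → l , h , (_ , lat) , p)
    (LR? μ (w ∷ ws) (b ∷ a ∷ C) ×-dec H? b c ×-dec Lat? 0 a b c ×-dec (sum b + x ≟ sum c))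

  S? : ∀ ƛ γ T → Dec (S ƛ γ T)
  S? ƛ [] [] = map′ done (λ where (done zs) → zs) (All.all? (_≟ 0) ƛ)
  S? ƛ [] (_ ∷ _) = no λ ()
  S? ƛ (_ ∷ _) [] = no λ ()
  S? ƛ (x ∷ γ) (κ ∷ T) = map′ (λ (h , p , s) → step h p s) (λ where (step h p s) → h , p , s)
    (H? κ ƛ ×-dec (sum κ + x ≟ sum ƛ) ×-dec S? κ γ T)

  Add? : ∀ α β γ → Dec (Add α β γ)
  Add? [] [] [] = yes []
  Add? [] [] (_ ∷ _) = no λ ()
  Add? [] (_ ∷ _) _ = no λ ()
  Add? (_ ∷ _) [] _ = no λ ()
  Add? (_ ∷ _) (_ ∷ _) [] = no λ ()
  Add? (i ∷ α) (j ∷ β) (k ∷ γ) = map′ (λ (p , a) → cons p a) (λ where (cons p a) → p , a)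
    (i + j ≟ k ×-dec Add? α β γ)

  RS? : ∀ ws ws′ → Dec (RS ws ws′)
  RS? [] [] = no λ ()
  RS? [] (x ∷ []) = yes last
  RS? [] (_ ∷ _ ∷ _) = no λ ()
  RS? (_ ∷ _) [] = no λ ()
  RS? (_ ∷ _) (_ ∷ []) = no λ ()
  RS? (w ∷ ws) (x ∷ y ∷ ws′) = map′ (λ (p , q , r) → cons p q r) (λ where (cons p q r) → p , q , r)
    (x ≤? w ×-dec w ≤? y ×-dec RS? ws (y ∷ ws′))

  Enum-rangeFrom : ∀ a k → Enum (λ x → a ≤ x × x < a + k) (rangeFrom a k)
  Enum-rangeFrom a zero = enum [] (λ ()) λ (p , q) → ⊥-elim (<⇒≱ q (≤-trans (≤-reflexive (+-identityʳ a)) p))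
  Enum-rangeFrom a (suc k) with rest ← Enum-rangeFrom (suc a) k = enum
    (All.tabulate (λ y∈ → <⇒≢ (proj₁ (sound rest y∈))) ∷ unique rest)
    (λ where (here refl) → ≤-refl , m<m+n a (s≤s z≤n)
             (there y∈) → let p , q = sound rest y∈ in <⇒≤ p , ≤-trans q (≤-reflexive (sym (+-suc a k))))
    (λ {y} (p , q) → go y p q (a ≟ y))
    where
    go : ∀ y → a ≤ y → y < a + suc k → Dec (a ≡ y) → y ∈ a ∷ rangeFrom (suc a) k
    go y _ _ (yes refl) = here refl
    go y p q (no a≢y) = there (complete (Enum-rangeFrom (suc a) k) (≤∧≢⇒< p a≢y , ≤-trans q (≤-reflexive
          (+-suc a k))))

  private variable
    A B : Set

  Enum-listsOf : {P : A → Set} {xs : List A} → Enum P xs → ∀ k →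
                 Enum (λ ys → length ys ≡ k × All P ys) (listsOf k xs)
  Enum-listsOf E zero = enum ([] ∷ []) (λ where (here refl) → refl , []) λ { {[]} _ → here refl }
  Enum-listsOf {P = P} E (suc k) = Enum-⇔
    (λ where (x , Px , ys , (refl , Pys) , refl) → refl , Px ∷ Pys)
    (λ { {x ∷ ys} (refl , Px ∷ Pys) → x , Px , ys , (refl , Pys) , refl })
    (Enum-concatMap _ E (λ {x} _ → Enum-map {f = x ∷_} ∷-injectiveʳ (Enum-listsOf E k))
      (λ where (_ , _ , refl) (_ , _ , refl) → refl))

  -- The common finite superset: chains and patterns consist of shapes of one length and bounded
  -- size, from which the decidable predicates select.
  Box : ℕ → ℕ → List ℕ → Set
  Box n s xs = length xs ≡ n × sum xs ≤ s

  sum-bounds : ∀ xs → All (_≤ sum xs) xs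
  sum-bounds [] = []
  sum-bounds (x ∷ xs) = m≤m+n x _ ∷ All.map (λ p → ≤-trans p (m≤n+m _ x)) (sum-bounds xs)

  finite-Box : ∀ n s → Finite (Box n s)
  finite-Box n s = Finite-⊆ (_ , Enum⇒Card (Enum-listsOf (Enum-rangeFrom 0 (suc s)) n))
    (λ {xs} (p , q) → p , All.map (λ le → z≤n , s≤s (≤-trans le q)) (sum-bounds xs))
    (λ xs → (length xs ≟ n) ×-dec (sum xs ≤? s))

  finite-Boxes : ∀ k n s → Finite (λ C → length C ≡ k × All (Box n s) C)
  finite-Boxes k n s with _ , xs , E , _ ← finite-Box n s = _ , Enum⇒Card (Enum-listsOf E k)

  S-boxes : S ƛ γ T → length T ≡ length γ × All (Box (length ƛ) (sum ƛ)) T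
  S-boxes (done _) = refl , []
  S-boxes {ƛ} (step (_ , h) _ s) with p , boxes ← S-boxes s =
    cong suc p , (HS-length h , HS-sum h) ∷
    All.map (λ (p , q) → trans p (HS-length h) , ≤-trans q (HS-sum h)) boxes

  finite-S : ∀ ƛ γ → Finite (S ƛ γ)
  finite-S ƛ γ = Finite-⊆ (finite-Boxes (length γ) (length ƛ) (sum ƛ)) S-boxes (S? ƛ γ)

  LR-length : LR μ ws (c ∷ C) → length c ≡ length μ
  LR-length none = refl
  LR-length (one (_ , h) _) = sym (HS-length h)
  LR-length (more l (_ , h) _ _) = trans (sym (HS-length h)) (LR-length l)

  LR-boxes : LR μ ws C → length C ≡ suc (length ws) × All (Box (length μ) (sum μ + sum ws)) C
  LR-boxes {μ = μ} none = refl , (refl , m≤m+n (sum μ) 0) ∷ []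
  LR-boxes {μ = μ} l@(one h p) = refl , (LR-length l , ≤-reflexive (sym (LR-sum l))) ∷ (refl , m≤m+n (sum μ)
        _) ∷ []
  LR-boxes {μ = μ} {ws = x ∷ ws} l@(more l′ h _ p) with q , boxes ← LR-boxes l′ =
    cong suc q , (LR-length l , ≤-reflexive (sym (LR-sum l))) ∷
    All.map (λ (q , r) → q , ≤-trans r (+-monoʳ-≤ (sum μ) (m≤n+m (sum ws) x))) boxes

  finite-LR : ∀ μ ws → Finite (LR μ ws)
  finite-LR μ ws = Finite-⊆ (finite-Boxes (suc (length ws)) (length μ) (sum μ + sum ws)) LR-boxes (LR? μ ws)

  RS-length : RS ws ws′ → length ws′ ≡ suc (length ws)
  RS-length last = refl
  RS-length (cons _ _ r) = cong suc (RS-length r)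

  finite-RS : ∀ ws s → Finite (λ ws′ → RS ws ws′ × sum ws′ ≡ s)
  finite-RS ws s = Finite-⊆ (finite-Box (suc (length ws)) s) (λ (r , p) → RS-length r , ≤-reflexive p)
    (λ ws′ → RS? ws ws′ ×-dec (sum ws′ ≟ s))

  finite-Add : ∀ γ → Finite (λ ((α , β) : List ℕ × List ℕ) → Add α β γ)
  finite-Add γ = Finite-⊆ (Finite-Σ (finite-Box (length γ) (sum γ)) λ _ → finite-Box (length γ) (sum γ))
    (λ {(α , β)} a → let p , q = Add-length a in
       (p , ≤-trans (m≤m+n _ (sum β)) (≤-reflexive (Add-sum a)))
     , (q , ≤-trans (m≤n+m _ (sum α)) (≤-reflexive (Add-sum a))))
    (λ (α , β) → Add? α β γ)

-- The two Pieri expansions and the induction that equates the products.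

module ProductRule where
  open LinearArithmetic
  open Strips
  open Chains
  open Counting
  open PieriRule
  open Finiteness

  zeros : ℕ → List ℕ
  zeros k = replicate k 0

  hd : List (List ℕ) → List ℕ
  hd [] = []
  hd (c ∷ _) = c

  tl : List (List ℕ) → List (List ℕ)
  tl [] = []
  tl (_ ∷ C) = C

  GT : Set
  GT = List (List ℕ)

  -- Its cardinality is the coefficient of the monomial `γ` in s_μ s_ν; that of `LRS` is the
  -- coefficient of the same monomial in the sum over chains. As in `S`, the exponent of the largest
  -- letter comes first.
  Conv : List ℕ → List ℕ → List ℕ → (List ℕ × List ℕ) × (GT × GT) → Set
  Conv μ ν γ ((ε , ζ) , (T , T′)) = Add ε ζ γ × S μ ε T × S ν ζ T′

  LRS : List ℕ → List ℕ → List ℕ → List (List ℕ) × GT → Set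
  LRS μ ws γ (C , T) = LR μ ws C × S (hd C) γ T

  finite-Conv : ∀ μ ν γ → Finite (Conv μ ν γ)
  finite-Conv μ ν γ = Finite-Σ (finite-Add γ) λ (ε , ζ) → Finite-Σ (finite-S μ ε) λ _ → finite-S ν ζ

  finite-LRS : ∀ μ ws γ → Finite (LRS μ ws γ)
  finite-LRS μ ws γ = Finite-Σ (finite-LR μ ws) λ C → finite-S (hd C) γ

  Add-assocˡ : Add β ζ δ → Add α δ γ → ∃[ ε ] Add α β ε × Add ε ζ γ
  Add-assocˡ [] [] = [] , [] , []
  Add-assocˡ (cons {i = b} {j = z} refl s) (cons {i = a} refl t) with ε , s′ , t′ ← Add-assocˡ s t =
    (a + b) ∷ ε , cons refl s′ , cons (+-assoc a b z) t′

  Add-assocʳ : Add α β ε → Add ε ζ γ → ∃[ δ ] Add β ζ δ × Add α δ γ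
  Add-assocʳ [] [] = [] , [] , []
  Add-assocʳ (cons {i = a} {j = b} refl s) (cons {j = z} refl t) with ε , s′ , t′ ← Add-assocʳ s t =
    (b + z) ∷ ε , cons refl s′ , cons (sym (+-assoc a b z)) t′

  Add-functional : Add α β γ → Add α β δ → γ ≡ δ
  Add-functional [] [] = refl
  Add-functional (cons refl s) (cons refl t) = cong (_ ∷_) (Add-functional s t)

  Add-cancelˡ : Add α β γ → Add α δ γ → β ≡ δ
  Add-cancelˡ [] [] = refl
  Add-cancelˡ (cons {i = i} p s) (cons p′ t) = cong₂ _∷_ (+-cancelˡ-≡ i _ _ (trans p (sym p′))) (Add-cancelˡ
        s t)

  Add-zeros : ∀ γ → Add γ (zeros (length γ)) γ
  Add-zeros [] = []
  Add-zeros (x ∷ γ) = cons (+-identityʳ x) (Add-zeros γ)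

  All-zeros : ∀ k → All (_≡ 0) (zeros k)
  All-zeros zero = []
  All-zeros (suc k) = refl ∷ All-zeros k

  zeros-unique : All (_≡ 0) α → α ≡ zeros (length α)
  zeros-unique [] = refl
  zeros-unique (refl ∷ zs) = cong (0 ∷_) (zeros-unique zs)

  sum-zeros : ∀ k → sum (zeros k) ≡ 0
  sum-zeros zero = refl
  sum-zeros (suc k) = sum-zeros k

  S-zeros : ∀ k m → S (zeros k) (zeros m) (replicate m (zeros k))
  S-zeros k zero = done (All-zeros k)
  S-zeros k (suc m) = step (0 , zeros-HS (All-zeros k)) (+-identityʳ _) (S-zeros k m)

  S-zeros-unique : ∀ k → S (zeros k) ζ T → ζ ≡ zeros (length ζ) × T ≡ replicate (length ζ) (zeros k)
  S-zeros-unique k (done _) = refl , refl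
  S-zeros-unique k (step {x = x} (_ , h) p s)
    with refl ← HS-zeros h (All-zeros k)
    with refl ← +-cancelˡ-≡ (sum (zeros k)) x 0 (trans p (sym (+-identityʳ _)))
    with q , r ← S-zeros-unique k s = cong (0 ∷_) q , cong (zeros k ∷_) r

  -- The factor is 1: a zero shape has just one pattern for each number of letters, with weight
  -- zero.
  LR-base : ∀ k → Conv μ (zeros k) γ ≈ LRS μ [] γ
  LR-base {μ} {γ} k = Bij⇒≈ (maps-Bij f g f-ok g-ok gf fg)
    where
    f : (List ℕ × List ℕ) × (GT × GT) → List (List ℕ) × GT
    f (_ , (T , _)) = μ ∷ [] , T
    g : List (List ℕ) × GT → (List ℕ × List ℕ) × (GT × GT)
    g (_ , T) = (γ , zeros (length γ)) , (T , replicate (length γ) (zeros k))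
    gf : ∀ {d} → Conv μ (zeros k) γ d → g (f d) ≡ d
    gf {(ε , ζ) , _} (add , _ , s) with p , refl ← S-zeros-unique k s with q , r ← Add-length add rewrite r
      with refl ← p with refl ← Add-functional (subst (λ n → Add ε (zeros n) ε) q (Add-zeros ε)) add = refl
    f-ok : ∀ {d} → Conv μ (zeros k) γ d → LRS μ [] γ (f d)
    f-ok {d} c with refl ← gf c = none , proj₁ (proj₂ c)
    g-ok : ∀ {d} → LRS μ [] γ d → Conv μ (zeros k) γ (g d)
    g-ok (none , s) = Add-zeros γ , s , S-zeros k (length γ)
    fg : ∀ {d} → LRS μ [] γ d → f (g d) ≡ d
    fg (none , s) = refl

  shape : List ℕ → ℕ → List ℕ
  shape ws k = ws ʳ++ zeros k

  RS-HS : RS ws (x ∷ ws′) → HS x μ ƛ → ∃[ u ] HS u (ws ʳ++ μ) (ws′ ʳ++ ƛ)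
  RS-HS last h = _ , h
  RS-HS (cons p q r) h = RS-HS r (cons q ≤-refl (HS-mono p h))

  HS-RS : ∀ ws {m} → HS u (ws ʳ++ (m ∷ μ)) ƛ →
          ∃[ x ] ∃[ ws′ ] ∃[ τ ] ƛ ≡ ws′ ʳ++ (x ∷ τ) × RS ws (x ∷ ws′) × m ≤ x × HS m μ τ
  HS-RS [] (cons p q h) = _ , _ , _ , refl , last , p , h
  HS-RS (w ∷ ws) h with y , ws′ , .(_ ∷ _) , eq , r , w≤y , cons {l = x} p q h′ ← HS-RS ws h =
    x , y ∷ ws′ , _ , eq , cons q w≤y r , p , h′

  ʳ++-injective : ∀ xs ys {zs zs′ : List ℕ} → length xs ≡ length ys → xs ʳ++ zs ≡ ys ʳ++ zs′ → xs ≡ ys × zs ≡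
        zs′
  ʳ++-injective [] [] _ eq = refl , eq
  ʳ++-injective (x ∷ xs) (y ∷ ys) l eq with refl , refl ← ʳ++-injective xs ys (suc-injective l) eq = refl , refl

  sum-ʳ++ : ∀ xs ys → sum (xs ʳ++ ys) ≡ sum xs + sum ys
  sum-ʳ++ [] ys = refl
  sum-ʳ++ (x ∷ xs) ys = trans (sum-ʳ++ xs (x ∷ ys)) (lin 3 (λ x₁ x₂ x → x₁ :+ (x :+ x₂) := x :+ x₁ :+ x₂)
        refl (sum xs) (sum ys) x)

  sum-shape : ∀ ws k → sum (shape ws k) ≡ sum ws
  sum-shape ws k = trans (sum-ʳ++ ws (zeros k)) (trans (cong (sum ws +_) (sum-zeros k)) (+-identityʳ _))

  -- The additional part of `ws′` takes the place of one padding zero, so both shapes have the same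
  -- length.
  RS⇒H : ∀ k → RS ws ws′ → H (shape ws (suc k)) (shape ws′ k)
  RS⇒H {ws′ = x ∷ ws′} k r = RS-HS r (cons z≤n ≤-refl (zeros-HS (All-zeros k)))

  H⇒RS : ∀ ws k → H (shape ws (suc k)) ƛ → ∃[ ws′ ] ƛ ≡ shape ws′ k × RS ws ws′
  H⇒RS ws k (_ , h) with x , ws′ , τ , refl , r , _ , h′ ← HS-RS ws h =
    x ∷ ws′ , cong (λ τ → ws′ ʳ++ (x ∷ τ)) (trans (zeros-unique (HS-zero h′)) (cong zeros (trans (sym
          (HS-length h′)) (length-replicate k)))) , r

  shape-injective : ∀ k → length ws ≡ length ws′ → shape ws k ≡ shape ws′ k → ws ≡ ws′
  shape-injective {ws} {ws′} k l eq = proj₁ (ʳ++-injective ws ws′ l eq)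

  LR-weights : LR μ ws C → LR μ ws′ C → ws ≡ ws′
  LR-weights none none = refl
  LR-weights {μ = μ} (one _ p) (one _ p′) = cong [_] (+-cancelˡ-≡ (sum μ) _ _ (trans p (sym p′)))
  LR-weights (more {b = b} l _ _ p) (more l′ _ _ p′) =
    cong₂ _∷_ (+-cancelˡ-≡ (sum b) _ _ (trans p (sym p′))) (LR-weights l l′)

  module _ (ws : List ℕ) (x k : ℕ) (μ γ : List ℕ) where
    private
      ν = shape ws (suc k)

      -- Multiplication by h_x: every monomial of degree `x` has coefficient 1 in it, so a term is
      -- just a splitting of the exponents.
      Split : List ℕ × List ℕ → Set
      Split (ε , ζ) = Add ε ζ γ × sum ζ ≡ x

      Above : List ℕ → Set
      Above ws′ = RS ws ws′ × sum ws′ ≡ sum ws + x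

      finite-Split : Finite Split
      finite-Split = Finite-⊆ (finite-Add γ) proj₁ λ (ε , ζ) → Add? ε ζ γ ×-dec (sum ζ ≟ x)

      Conv-Above : List ℕ × ((List ℕ × List ℕ) × (GT × GT)) → Set
      Conv-Above (ws′ , d) = Above ws′ × Conv μ (shape ws′ k) γ d

      Conv-Split : (List ℕ × List ℕ) × ((List ℕ × List ℕ) × (GT × GT)) → Set
      Conv-Split (p , d) = Split p × Conv μ ν (proj₁ p) d

      LRS-Split : (List ℕ × List ℕ) × (List (List ℕ) × GT) → Set
      LRS-Split (p , d) = Split p × LRS μ ws (proj₁ p) d

      LRS-Above : List ℕ × (List (List ℕ) × GT) → Set
      LRS-Above (ws′ , d) = Above ws′ × LRS μ ws′ γ d

    -- The factor h_x is absorbed into s_ν and the pattern of `μ` stays as it is; what remains is to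
    -- reassociate the three exponents.
    Conv-Pieri : length γ ≤ length ν → Bij Conv-Above Conv-Split
    Conv-Pieri le = record { R = R ; to = to ; from = from ; functional = functional ; injective = injective }
      where
      R : List ℕ × ((List ℕ × List ℕ) × (GT × GT)) → (List ℕ × List ℕ) × ((List ℕ × List ℕ) × (GT × GT)) → Set
      R (ws′ , ((β , δ) , (T , T₂))) ((ε , ζ) , ((β′ , δ′) , (T′ , T₂′))) =
        β ≡ β′ × T ≡ T′ × Pieri ν δ′ ζ T₂′ (shape ws′ k) T₂
      to : ∀ {p} → Conv-Above p → ∃[ q ] Conv-Split q × R p q
      to {ws′ , ((β , δ) , (T , T₂))} ((r , p) , add , s₁ , s₂)
        with δ′ , ζ , T₂′ , add′ , s₂′ , π ← Pieri-inverse (RS⇒H k r) s₂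
        with ε , add₁ , add₂ ← Add-assocˡ add′ add
        = ((ε , ζ) , ((β , δ′) , (T , T₂′)))
        , ((add₂ , (≡-by (p ⊞ sym (S-sum s₂) ⊞ (sum-shape ws′ k) ⊞ (S-sum s₂′) ⊞ sym (sum-shape ws (suc k)) ⊞
              (Add-sum add′)) (lin 8 (λ x₁ x₂ x₃ x₄ x₅ x₆ x₇ x → x₆ :+ (x₂ :+ x :+ x₁ :+ x₃ :+ x₅ :+ x₇ :+
              x₄) := x :+ (x₃ :+ x₄ :+ x₁ :+ x₇ :+ x₂ :+ (x₅ :+ x₆))) refl (sum (shape ws′ k)) (sum ws) (sum
              ws′) (sum δ) (sum δ′) (sum ζ) (sum ν) x))) , add₁ , s₁ , s₂′) , refl , refl , π
      from : ∀ {q} → Conv-Split q → ∃[ p ] Conv-Above p × R p q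
      from {(ε , ζ) , ((β , δ′) , (T , T₂′))} ((add₂ , p) , add₁ , s₁ , s₂′)
        with δ , add′ , add ← Add-assocʳ add₁ add₂
        with ƛ , T₂ , h , s₂ , π ← Pieri-exists (≤-trans (≤-reflexive (proj₂ (Add-length add))) le) add′ s₂′
        with ws′ , refl , r ← H⇒RS ws k h
        = (ws′ , ((β , δ) , (T , T₂)))
        , ((r , (≡-by (p ⊞ (S-sum s₂) ⊞ sym (sum-shape ws′ k) ⊞ sym (S-sum s₂′) ⊞ (sum-shape ws (suc k)) ⊞
              sym (Add-sum add′)) (lin 8 (λ x₁ x₂ x₃ x₄ x₅ x₆ x₇ x → x₃ :+ (x :+ x₄ :+ x₁ :+ x₇ :+ x₂ :+ (x₅
              :+ x₆)) := x₂ :+ x :+ (x₆ :+ x₁ :+ x₃ :+ x₅ :+ x₇ :+ x₄)) refl (sum (shape ws′ k)) (sum ws)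
              (sum ws′) (sum δ) (sum δ′) (sum ζ) (sum ν) x))) , add , s₁ , s₂) , refl , refl , π
      functional : ∀ {p q q′} → Conv-Above p → Conv-Split q → Conv-Split q′ → R p q → R p q′ → q ≡ q′
      functional _ ((add , _) , add₁ , _ , s) ((add′ , _) , add₁′ , _ , s′) (refl , refl , π) (refl , refl , π′)
        with refl , refl , refl ← Pieri-injective s s′ π π′
        with refl ← Add-functional add₁ add₁′ = refl
      injective : ∀ {p p′ q} → Conv-Above p → Conv-Above p′ → Conv-Split q → R p q → R p′ q → p ≡ p′
      injective {ws₁ , _} {ws₂ , _} ((r , _) , add , _) ((r′ , _) , add′ , _) _ (refl , refl , π) (refl ,
            refl , π′)
        with eq , refl ← Pieri-functional π π′
        with refl ← Add-cancelˡ add add′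
        with refl ← shape-injective {ws₁} {ws₂} k (trans (RS-length r) (sym (RS-length r′))) eq = refl

    -- Insertion extends the chain by a last shape `c`, and the repair changes only shapes below
    -- `c`; so the pattern of `c` found by insertion can be kept.
    LRS-Pieri : length γ ≤ length μ → Bij LRS-Split LRS-Above
    LRS-Pieri le = record { R = R ; to = to ; from = from ; functional = functional ; injective = injective }
      where
      R : (List ℕ × List ℕ) × (List (List ℕ) × GT) → List ℕ × (List (List ℕ) × GT) → Set
      R ((ε , ζ) , (C , T)) (ws′ , (C′ , T′)) =
        Pieri (hd C) ε ζ T (hd C′) T′ × Raise (hd C′) (hd C) (tl C) (tl C′)
      to : ∀ {p} → LRS-Split p → ∃[ q ] LRS-Above q × R p q
      to {(ε , ζ) , (b ∷ C , T)} ((add , p) , l , s)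
        with c , T′ , h , s′ , π ← Pieri-exists (≤-trans le (≤-reflexive (sym (LR-length l)))) add s
        with C′ , ws′ , ρ , l′ , r ← Raise-exists l h
        = (ws′ , (c ∷ C′ , T′))
        , ((r , (≡-by (p ⊞ sym (S-sum s) ⊞ (S-sum s′) ⊞ sym (Add-sum add) ⊞ sym (LR-sum l) ⊞ (LR-sum l′))
              (lin 9 (λ x₁ x₂ x₃ x₄ x₅ x₆ x₇ x₈ x → x₄ :+ (x :+ x₁ :+ x₅ :+ (x₆ :+ x₇) :+ (x₈ :+ x₃) :+ x₂)
              := x₃ :+ x :+ (x₇ :+ x₆ :+ x₂ :+ x₅ :+ x₁ :+ (x₈ :+ x₄))) refl (sum b) (sum c) (sum ws) (sum
              ws′) (sum γ) (sum ε) (sum ζ) (sum μ) x))) , l′ , s′) , π , ρ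
      from : ∀ {q} → LRS-Above q → ∃[ p ] LRS-Split p × R p q
      from {ws′ , (c ∷ [] , T′)} ((() , _) , none , _)
      from {ws′ , (c ∷ b̄ ∷ C′ , T′)} ((r , p) , l′ , s′)
        with b , C , ρ , l , h ← Lower-exists l′ r
        with ε , ζ , T , add , s , π ← Pieri-inverse h s′
        = ((ε , ζ) , (b ∷ C , T))
        , ((add , (≡-by (p ⊞ (S-sum s) ⊞ sym (S-sum s′) ⊞ (Add-sum add) ⊞ (LR-sum l) ⊞ sym (LR-sum l′)) (lin
              9 (λ x₁ x₂ x₃ x₄ x₅ x₆ x₇ x₈ x → x₇ :+ (x₃ :+ x :+ x₆ :+ x₂ :+ x₅ :+ x₁ :+ (x₈ :+ x₄)) := x :+
              (x₄ :+ x₁ :+ x₅ :+ (x₆ :+ x₇) :+ (x₈ :+ x₃) :+ x₂)) refl (sum b) (sum c) (sum ws) (sum ws′)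
              (sum γ) (sum ε) (sum ζ) (sum μ) x))) , l , s) , π , ρ
      functional : ∀ {p q q′} → LRS-Split p → LRS-Above q → LRS-Above q′ → R p q → R p q′ → q ≡ q′
      functional {_ , (_ ∷ _ , _)} {_ , (_ ∷ _ , _)} {_ , (_ ∷ _ , _)} _ (_ , l , _) (_ , l′ , _) (π , ρ) (π′
            , ρ′)
        with refl , refl ← Pieri-functional π π′
        with refl ← Raise-functional ρ ρ′
        with refl ← LR-weights l l′ = refl
      functional {_ , ([] , _)} (_ , () , _)
      functional {_ , (_ ∷ _ , _)} {_ , ([] , _)} _ (_ , () , _)
      functional {_ , (_ ∷ _ , _)} {_ , (_ ∷ _ , _)} {_ , ([] , _)} _ _ (_ , () , _)
      injective : ∀ {p p′ q} → LRS-Split p → LRS-Split p′ → LRS-Above q → R p q → R p′ q → p ≡ p′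
      injective {_ , (_ ∷ _ , _)} {_ , (_ ∷ _ , _)} {_ , (_ ∷ _ , _)} (_ , l , s) (_ , l′ , s′) _ (π , ρ) (π′
            , ρ′)
        with refl , refl ← Raise-injective ρ ρ′ l l′
        with refl , refl , refl ← Pieri-injective s s′ π π′ = refl
      injective {_ , ([] , _)} (_ , () , _)
      injective {_ , (_ ∷ _ , _)} {_ , ([] , _)} _ (_ , () , _)
      injective {_ , (_ ∷ _ , _)} {_ , (_ ∷ _ , _)} {_ , ([] , _)} _ _ (_ , () , _)

    Above-≈ : length γ ≤ length ν → length γ ≤ length μ → (∀ {ε} → length ε ≡ length γ → Conv μ ν ε ≈ LRS μ
          ws ε) →
              Conv-Above ≈ LRS-Above
    Above-≈ le le′ ih = ≈-trans (Finite-Σ finite-Split λ p → finite-Conv μ ν (proj₁ p)) (Bij⇒≈ (Conv-Pieri le))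
      (≈-trans (Finite-Σ finite-Split λ p → finite-LRS μ ws (proj₁ p))
        (Σ-≈ finite-Split (λ p → finite-Conv μ ν (proj₁ p)) (λ p → finite-LRS μ ws (proj₁ p)) λ (add , _) →
              ih (proj₁ (Add-length add)))
        (Bij⇒≈ (LRS-Pieri le′)))

  RS-self : RS ws (x ∷ ws′) → RS ws′ (x ∷ ws′)
  RS-self last = last
  RS-self (cons p q r) = cons (≤-trans p q) ≤-refl (RS-self r)

  RS-pw : RS ws (x ∷ ws′) → Pointwise _≤_ ws ws′
  RS-pw last = []
  RS-pw (cons p q r) = q ∷ RS-pw r

  Pw-sum-≡ : Pointwise _≤_ α β → sum α ≡ sum β → α ≡ β
  Pw-sum-≡ [] _ = refl
  Pw-sum-≡ {a ∷ α} {b ∷ β} (p ∷ ps) eq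
    with refl ← (a ≡ b) ∋ (≤-antisym (≤-by p (lin 2 (λ a b → a :+ b := b :+ a) refl a b)) (≤-by (≤-reflexive
          (sym eq) ⊕ (Pw-sum ps)) (lin 4 (λ x₁ x₂ a b → b :+ (a :+ x₁ :+ x₂) := a :+ (b :+ x₂ :+ x₁)) refl
          (sum α) (sum β) a b)))
    = cong (a ∷_) (Pw-sum-≡ ps (+-cancelˡ-≡ a _ _ eq))

  -- Since `ws ≤ ws′` termwise and the totals are fixed, `y` is at most `x`, and equality leaves no
  -- room for `ws′` to differ from `ws`.
  Above-last : RS ws (y ∷ ws′) → sum (y ∷ ws′) ≡ sum ws + x → y ∷ ws′ ≢ x ∷ ws → y < x
  Above-last {ws} {y} {ws′} {x} r p ≢ = ≤∧≢⇒< (≤-by (≤-reflexive p ⊕ (Pw-sum (RS-pw r))) (lin 4 (λ x₁ x₂ x y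
        → y :+ (x₁ :+ x :+ x₂) := x :+ (y :+ x₂ :+ x₁)) refl (sum ws) (sum ws′) x y))
    λ where refl → ≢ (cong (y ∷_) (sym (Pw-sum-≡ (RS-pw r) (≡-by (sym p) (lin 3 (λ x₁ x₂ y → x₁ :+ (y :+ x₂) := x₂ :+ (x₁ :+ y)) refl (sum ws) (sum ws′) y)))))

  -- Partitions listed from the smallest part. The use of `RS` makes `x ∷ ws` itself a term of the
  -- Pieri sum over `ws`.
  data Decr : List ℕ → Set where
    [] : Decr []
    _∷_ : ∀ x → RS ws (x ∷ ws) → Decr (x ∷ ws)

  Decr-tail : RS ws (x ∷ ws) → Decr ws
  Decr-tail last = []
  Decr-tail (cons _ _ r) = _ ∷ r

  -- Every ws′ above ws other than x ∷ ws has a last part below x, so all other terms cancel.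
  LR-rule : ∀ n k ws μ γ → length ws ≡ n → Decr ws → length γ ≤ n + k → length γ ≤ length μ →
            Conv μ (shape ws k) γ ≈ LRS μ ws γ
  LR-rule zero k [] μ γ _ _ _ _ = LR-base k
  LR-rule (suc n) k (x ∷ ws) μ γ l (x ∷ r) = <-rec P inner x ws (suc-injective l) r
    where
    P : ℕ → Set
    P x = ∀ ws → length ws ≡ n → RS ws (x ∷ ws) → length γ ≤ suc n + k → length γ ≤ length μ →
          Conv μ (shape (x ∷ ws) k) γ ≈ LRS μ (x ∷ ws) γ
    inner : ∀ x → (∀ {y} → y < x → P y) → P x
    inner x ih ws l r le le′ = Σ-≈-cancel {x = x ∷ ws} (finite-RS ws (sum ws + x))
      (λ ws′ → finite-Conv μ (shape ws′ k) γ) (λ ws′ → finite-LRS μ ws′ γ)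
      (Above-≈ ws x k μ γ
        (≤-trans le (≤-reflexive (sym (trans (length-ʳ++ ws) (trans (cong₂ _+_ l (length-replicate (suc k)))
              (+-suc n k))))))
        le′
        -- One part fewer is balanced by one zero more, so the padded shape keeps its number of
        -- rows.
        λ {ε} eq → LR-rule n (suc k) ws μ ε l (Decr-tail r)
          (≤-trans (≤-reflexive eq) (≤-trans le (≤-reflexive (sym (+-suc n k))))) (≤-trans (≤-reflexive eq)
                le′))
      (r , +-comm x (sum ws))
      other
      where
      other : ∀ {ws′} → RS ws ws′ × sum ws′ ≡ sum ws + x → ws′ ≢ x ∷ ws → Conv μ (shape ws′ k) γ ≈ LRS μ ws′ γ
      other {y ∷ ws′} (r′ , p) ≢ =
        ih (Above-last r′ p ≢) ws′ (trans (suc-injective (RS-length r′)) l) (RS-self r′) le le′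

-- Access to the local functions of the definitions.

module HiddenNames where
  open import Defs

  -- The local functions of Defs have no names outside of it. Each name below is solved by unification from the
  -- equation next to it; where needed, `with` first turns the arguments of the local function into variables.
  mutual
    part : List (List ℕ) → List ℕ → ℕ → ℕ
    part = _
    hasContent-part : ∀ α t → hasContent α t ≡ allᵇ (λ c → count c (concat t) ≡ᵇ part t α c) (upto1 (length α))
    hasContent-part α t = refl

  mutual
    cols : List (List ℕ) → Bool
    cols = _
    isSSYT-cols : ∀ t → isSSYT t ≡ allᵇ rowWeak t ∧ cols t
    isSSYT-cols t = refl

  mutual
    steps : List ℕ → List ℕ → List ℕ → ℕ → List ℕ → List (List ℕ) → Bool
    steps = _
    kconds : List ℕ → List ℕ → List ℕ → List ℕ → List (List ℕ) → Bool
    kconds = _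
    validSeq-unfold : ∀ μ ν p q s → validSeq μ ν (p ∷ q ∷ s) ≡
      eqList p μ ∧ (suc (suc (length s)) ≡ᵇ suc (u₁ ν)) ∧
      (isPartition q ∧ validStep p q (rIdx 1 ν) ∧ steps μ ν p 2 q s) ∧ kconds μ ν p q s
    validSeq-unfold μ ν p q s with 2
    ... | i = refl

  mutual
    extend : List ℕ → List ℕ → ℕ → List ℕ → List (List (List ℕ))
    extend = _
    candidates-extend : ∀ μ ν → candidates μ ν ≡ map (μ ∷_) (extend μ ν (size μ) (map (λ i → rIdx i ν) (upto1
          (u₁ ν))))
    candidates-extend μ ν with sum μ | map (λ i → rIdx i ν) (upto1 (u₁ ν))
    ... | n | as = refl

  mutual
    code : List ℕ → ℕ → List ℕ → List Letter
    code = _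
    codeMid-code : ∀ ƛ → codeMid ƛ ≡ code ƛ 0 (reverse ƛ)
    codeMid-code ƛ with 0 | reverse ƛ
    ... | p | ps = refl

  mutual
    findU : List ℕ → ℕ → List Letter → ℕ
    findU = _
    rIdx-findU : ∀ ƛ i → rIdx i ƛ ≡ findU ƛ i (reverse (codeMid ƛ))
    rIdx-findU ƛ i with reverse (codeMid ƛ)
    ... | w = refl

  mutual
    countAfterR : List ℕ → List Letter → ℕ
    countAfterR = _
    u₁-countAfterR : ∀ ƛ → u₁ ƛ ≡ countAfterR ƛ (codeMid ƛ)
    u₁-countAfterR ƛ with codeMid ƛ
    ... | w = refl

-- Semistandard tableaux as Gelfand-Tsetlin patterns.

module Tableaux where
  open import Defs
  open LinearArithmetic
  open Strips
  open Counting
  open PieriRule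
  open Finiteness
  open HiddenNames

  private variable
    k m n l i : ℕ
    r r′ s s′ : List ℕ
    t t′ : List (List ℕ)

  count-≡ : ∀ c xs → count c (c ∷ xs) ≡ suc (count c xs)
  count-≡ c xs with c ≡ᵇ c | ≡⇒≡ᵇ c c refl
  ... | true | _ = refl

  count-≢ : ∀ c x xs → c ≢ x → count c (x ∷ xs) ≡ count c xs
  count-≢ c x xs c≢x with c ≡ᵇ x | ≡ᵇ⇒≡ c x
  ... | true | eq = ⊥-elim (c≢x (eq tt))
  ... | false | _ = refl

  count-cong : ∀ c x xs ys → count c xs ≡ count c ys → count c (x ∷ xs) ≡ count c (x ∷ ys)
  count-cong c x _ _ eq with c ≡ᵇ x
  ... | true = cong suc eq
  ... | false = eq

  count-++ : ∀ c xs ys → count c (xs ++ ys) ≡ count c xs + count c ys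
  count-++ c [] ys = refl
  count-++ c (x ∷ xs) ys with c ≡ᵇ x
  ... | true = cong suc (count-++ c xs ys)
  ... | false = count-++ c xs ys

  -- A weakly increasing row r with letters at most m + 1 is its part r′ with letters at most m
  -- followed by k copies of m + 1.
  data Ext (m : ℕ) : List ℕ → ℕ → List ℕ → Set where
    nil  : Ext m [] 0 []
    big  : Ext m [] k r → Ext m [] (suc k) (suc m ∷ r)
    keep : i ≤ m → Ext m r′ k r → Ext m (i ∷ r′) k (i ∷ r)

  RowOk : ℕ → ℕ → List ℕ → Set
  RowOk n l r = length r ≡ l × All (λ c → 1 ≤ c × c ≤ n) r × AllPairs _≤_ r

  Ext-length : Ext m r′ k r → length r′ + k ≡ length r
  Ext-length nil = refl
  Ext-length (big x) = cong suc (Ext-length x)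
  Ext-length (keep _ x) = cong suc (Ext-length x)

  Ext-bound : Ext m r′ k r → All (_≤ m) r′
  Ext-bound nil = []
  Ext-bound (big x) = []
  Ext-bound (keep p x) = p ∷ Ext-bound x

  Ext-exists : All (_≤ suc m) r → AllPairs _≤_ r → ∃[ r′ ] ∃[ k ] Ext m r′ k r
  Ext-exists [] [] = _ , _ , nil
  Ext-exists {m = m} {r = c ∷ r} (c≤ ∷ bs) (p ∷ ps) with c ≤? m
  ... | yes c≤m with _ , _ , x ← Ext-exists bs ps = _ , _ , keep c≤m x
  ... | no c≰m with refl ← ≤-antisym c≤ (≰⇒> c≰m) = _ , _ , bigs bs p
    where
    bigs : ∀ {r} → All (_≤ suc m) r → All (suc m ≤_) r → Ext m [] (suc (length r)) (suc m ∷ r)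
    bigs [] [] = big nil
    bigs (q ∷ qs) (p ∷ ps) with refl ← ≤-antisym q p = big (bigs qs ps)

  Ext-injective : Ext m r′ k r → Ext m s′ n r → r′ ≡ s′
  Ext-injective nil nil = refl
  Ext-injective (big x) (big y) = refl
  Ext-injective (big x) (keep p y) = ⊥-elim (<-irrefl refl p)
  Ext-injective (keep p x) (big y) = ⊥-elim (<-irrefl refl p)
  Ext-injective (keep _ x) (keep _ y) = cong (_ ∷_) (Ext-injective x y)

  Ext-functional : Ext m r′ k r → Ext m r′ k s → r ≡ s
  Ext-functional nil nil = refl
  Ext-functional (big x) (big y) = cong (_ ∷_) (Ext-functional x y)
  Ext-functional (keep _ x) (keep _ y) = cong (_ ∷_) (Ext-functional x y)

  Ext-⊆ : {P : ℕ → Set} → Ext m r′ k r → All P r → All P r′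
  Ext-⊆ nil _ = []
  Ext-⊆ (big _) _ = []
  Ext-⊆ (keep _ x) (p ∷ ps) = p ∷ Ext-⊆ x ps

  Ext-⊇ : {P : ℕ → Set} → P (suc m) → Ext m r′ k r → All P r′ → All P r
  Ext-⊇ _ nil _ = []
  Ext-⊇ q (big x) _ = q ∷ Ext-⊇ q x []
  Ext-⊇ q (keep _ x) (p ∷ ps) = p ∷ Ext-⊇ q x ps

  Ext-AllPairs⁻ : Ext m r′ k r → AllPairs _≤_ r → AllPairs _≤_ r′
  Ext-AllPairs⁻ nil _ = []
  Ext-AllPairs⁻ (big _) _ = []
  Ext-AllPairs⁻ (keep _ x) (p ∷ ps) = Ext-⊆ x p ∷ Ext-AllPairs⁻ x ps

  Ext-AllPairs⁺ : Ext m r′ k r → AllPairs _≤_ r′ → AllPairs _≤_ r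
  Ext-AllPairs⁺ nil _ = []
  Ext-AllPairs⁺ (big x) _ = Ext-⊇ ≤-refl x [] ∷ Ext-AllPairs⁺ x []
  Ext-AllPairs⁺ (keep c≤m x) (p ∷ ps) = Ext-⊇ (m≤n⇒m≤1+n c≤m) x p ∷ Ext-AllPairs⁺ x ps

  Ext-RowOk⁻ : Ext m r′ k r → RowOk (suc m) l r → RowOk m (length r′) r′
  Ext-RowOk⁻ x (_ , bs , ps) =
    refl , All.zipWith (λ ((p , _) , q) → p , q) (Ext-⊆ x bs , Ext-bound x) , Ext-AllPairs⁻ x ps

  Ext-build : All (_≤ m) r → ∀ k → ∃[ s ] Ext m r k s
  Ext-build [] zero = _ , nil
  Ext-build [] (suc k) = _ , big (proj₂ (Ext-build [] k))
  Ext-build (p ∷ ps) k = _ , keep p (proj₂ (Ext-build ps k))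

  Ext-RowOk⁺ : RowOk m l r → l + k ≡ n → ∃[ s ] Ext m r k s × RowOk (suc m) n s
  Ext-RowOk⁺ {k = k} (refl , bs , ps) refl with s , x ← Ext-build (All.map proj₂ bs) k =
    s , x , sym (Ext-length x)
    , Ext-⊇ (s≤s z≤n , ≤-refl) x (All.map (λ (p , q) → p , m≤n⇒m≤1+n q) bs)
    , Ext-AllPairs⁺ x ps

  Ext-count : Ext m r′ k r → count (suc m) r ≡ k
  Ext-count nil = refl
  Ext-count {m = m} (big {r = r} x) = trans (count-≡ (suc m) r) (cong suc (Ext-count x))
  Ext-count {m = m} (keep {i = i} {r = r} c≤m x) = trans (count-≢ (suc m) i r (λ where refl → <-irrefl refl c≤m)) (Ext-count x)

  Ext-count-≤ : i ≤ m → Ext m r′ k r → count i r′ ≡ count i r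
  Ext-count-≤ c≤m nil = refl
  Ext-count-≤ {i = i} {m = m} i≤m (big {r = r} x) = trans (Ext-count-≤ i≤m x) (sym (count-≢ i (suc m) r (λ where refl → <-irrefl refl i≤m)))
  Ext-count-≤ {i = i} i≤m (keep {i = d} {r′ = r′} {r = r} _ x) = count-cong i d r′ r (Ext-count-≤ i≤m x)

  data Col : List ℕ → List ℕ → Set where
    []  : Col r []
    _∷_ : ∀ {x y} → x < y → Col r s → Col (x ∷ r) (y ∷ s)

  -- With `m + 1` the largest letter, column strictness leaves nothing below an entry `m + 1`. So
  -- the lower row fits under the truncated upper row, which is the horizontal strip condition on
  -- shapes.
  Col⁻ : Ext m r′ k r → Ext m s′ n s → Col r s → Col r′ s′ × length s ≤ length r′
  Col⁻ x nil [] = [] , z≤n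
  Col⁻ (big x) (big y) (p ∷ _) = ⊥-elim (<-irrefl refl p)
  Col⁻ (big x) (keep q y) (p ∷ _) = ⊥-elim (<-asym (s≤s q) p)
  Col⁻ (keep _ x) (big y) (_ ∷ c) = [] , s≤s (proj₂ (Col⁻ x y c))
  Col⁻ (keep _ x) (keep _ y) (p ∷ c) with d , q ← Col⁻ x y c = p ∷ d , s≤s q

  Col⁺ : Ext m r′ k r → Ext m s′ n s → Col r′ s′ → length s ≤ length r′ → Col r s
  Col⁺ x nil _ _ = []
  Col⁺ (keep p x) (big y) [] (s≤s q) = s≤s p ∷ Col⁺ x y [] q
  Col⁺ (keep _ x) (keep _ y) (p ∷ c) (s≤s q) = p ∷ Col⁺ x y c q

  Rows : ℕ → List ℕ → List (List ℕ) → Set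
  Rows n = Pointwise (RowOk n)

  Strip : ℕ → List (List ℕ) → List (List ℕ) → Set
  Strip m = Pointwise λ r′ r → ∃[ k ] Ext m r′ k r

  head≤ : List ℕ → ℕ → Set
  head≤ [] _ = ⊤
  head≤ (l ∷ _) u = l ≤ u

  -- The first bound `u` of the strip is left open: it comes from the truncated row above, by
  -- `Col⁻`, and only the top row may choose it freely.
  strip : Rows (suc m) ƛ t → Linked Col t →
          ∃[ t′ ] Strip m t′ t × Rows m (map length t′) t′ × Linked Col t′ × (∀ {u} → head≤ ƛ u → HS u (map
                length t′) ƛ)
  strip [] _ = [] , [] , [] , [] , λ _ → []
  strip (ok@(refl , bs , ps) ∷ []) [-] with r′ , k , x ← Ext-exists (All.map proj₂ bs) ps =
    r′ ∷ [] , (k , x) ∷ [] , Ext-RowOk⁻ x ok ∷ [] , [-] , λ p → cons (≤-trans (m≤m+n (length r′) k)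
          (≤-reflexive (Ext-length x))) p []
  strip (ok@(refl , bs , ps) ∷ oks@((refl , _) ∷ _)) (c ∷ cs)
    with r′ , k , x ← Ext-exists (All.map proj₂ bs) ps
    with _ ∷ t′ , (_ , y) ∷ st , oks′ , cs′ , hs ← strip oks cs
    with d , q ← Col⁻ x y c
    = r′ ∷ _ ∷ t′ , (k , x) ∷ (_ , y) ∷ st , Ext-RowOk⁻ x ok ∷ oks′ , d ∷ cs′
    , λ p → cons (≤-trans (m≤m+n (length r′) k) (≤-reflexive (Ext-length x))) p (hs q)

  fill : Rows m κ t′ → HS u κ ƛ → Linked Col t′ → ∃[ t ] Strip m t′ t × Rows (suc m) ƛ t × Linked Col t
  fill [] [] [] = [] , [] , [] , []
  fill (ok ∷ []) (cons p _ []) _ with k , q ← split≤ p with s , x , ok′ ← Ext-RowOk⁺ ok q =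
    _ , (k , x) ∷ [] , ok′ ∷ [] , [-]
  fill (ok@(refl , _) ∷ oks) (cons p _ h@(cons _ l≤ _)) (c ∷ cs) with k , q ← split≤ p with s , x , ok′ ←
        Ext-RowOk⁺ ok q
    with _ ∷ t , st@((_ , y) ∷ _) , oks′@((eq , _) ∷ _) , cs′ ← fill oks h cs =
    _ , (k , x) ∷ st , ok′ ∷ oks′ , Col⁺ x y c (≤-trans (≤-reflexive eq) l≤) ∷ cs′

  Rows-length : Rows n ƛ t → map length t ≡ ƛ
  Rows-length [] = refl
  Rows-length ((eq , _) ∷ oks) = cong₂ _∷_ eq (Rows-length oks)

  Strip-count : Strip m t′ t → sum (map length t′) + count (suc m) (concat t) ≡ sum (map length t)
  Strip-count [] = refl
  Strip-count {m = m} (_∷_ {x = r′} {y = r} {xs = t′} {ys = t} (k , x) st) = (≡-by ((count-++ (suc m) r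
        (concat t)) ⊞ (Ext-count x) ⊞ (Ext-length x) ⊞ (Strip-count st)) (lin 8 (λ x₁ x₂ x₃ x₄ x₅ x₆ x₇ k →
        x₅ :+ x₇ :+ x₂ :+ (x₃ :+ x₁ :+ k :+ x₄ :+ x₆) := x₄ :+ x₆ :+ (x₂ :+ x₃ :+ (x₅ :+ k) :+ (x₇ :+ x₁)))
        refl (count (suc m) (concat t)) (count (suc m) (r ++ concat t)) (count (suc m) r) (length r) (length
        r′) (sum (map length t)) (sum (map length t′)) k))

  Strip-count-≤ : i ≤ m → Strip m t′ t → count i (concat t′) ≡ count i (concat t)
  Strip-count-≤ c≤m [] = refl
  Strip-count-≤ {i = i} c≤m (_∷_ {x = r′} {y = r} {xs = t′} {ys = t} (k , x) st) =
    trans (count-++ i r′ (concat t′)) (trans (cong₂ _+_ (Ext-count-≤ c≤m x) (Strip-count-≤ c≤m st)) (sym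
          (count-++ i r (concat t))))

  Strip-injective : Strip m t t′ → Strip m T t′ → t ≡ T
  Strip-injective [] [] = refl
  Strip-injective ((_ , x) ∷ p) ((_ , y) ∷ q) = cong₂ _∷_ (Ext-injective x y) (Strip-injective p q)

  Strip-functional : Strip m t′ t → Strip m t′ T → map length t ≡ map length T → t ≡ T
  Strip-functional [] [] _ = refl
  Strip-functional (_∷_ {x = r′} (k , x) p) ((n , y) ∷ q) eq
    with eq₁ , eq₂ ← ∷-injective eq
    with refl ← +-cancelˡ-≡ (length r′) k n (trans (Ext-length x) (trans eq₁ (sym (Ext-length y))))
    = cong₂ _∷_ (Ext-functional x y) (Strip-functional p q eq₂)

  Content : List ℕ → List (List ℕ) → Set
  Content [] t = ⊤
  Content (x ∷ γ) t = count (suc (length γ)) (concat t) ≡ x × Content γ t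

  Content-cong : ∀ γ → (∀ {c} → c ≤ length γ → count c (concat t) ≡ count c (concat t′)) → Content γ t →
        Content γ t′
  Content-cong [] eq _ = tt
  Content-cong (x ∷ γ) eq (p , q) = trans (sym (eq ≤-refl)) p , Content-cong γ (eq ∘ m≤n⇒m≤1+n) q

  Tab : List ℕ → List ℕ → List (List ℕ) → Set
  Tab ƛ γ t = Rows (length γ) ƛ t × Linked Col t × Content γ t

  data Shapes : ℕ → List (List ℕ) → List (List ℕ) → Set where
    stop : Shapes 0 t []
    step : Strip m t′ t → map length t′ ≡ κ → Shapes m t′ T → Shapes (suc m) t (κ ∷ T)

  Rows-zero : Rows 0 ƛ t → All (_≡ 0) ƛ × t ≡ replicate (length ƛ) []
  Rows-zero [] = [] , refl
  Rows-zero ((refl , [] , _) ∷ oks) with zs , eq ← Rows-zero oks = refl ∷ zs , cong ([] ∷_) eq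
  Rows-zero ((refl , (s≤s _ , ()) ∷ _ , _) ∷ oks)

  Rows-empty : All (_≡ 0) ƛ → Rows n ƛ (replicate (length ƛ) []) × Linked Col (replicate (length ƛ) [])
  Rows-empty [] = [] , []
  Rows-empty (refl ∷ []) = (refl , [] , []) ∷ [] , [-]
  Rows-empty (refl ∷ zs@(_ ∷ _)) with oks , cs ← Rows-empty zs = (refl , [] , []) ∷ oks , [] ∷ cs

  head≤-sum : ∀ ƛ → head≤ ƛ (sum ƛ)
  head≤-sum [] = tt
  head≤-sum (l ∷ ƛ) = m≤m+n l (sum ƛ)

  Tab⇒S : ∀ γ → Tab ƛ γ t → ∃[ T ] S ƛ γ T × Shapes (length γ) t T
  Tab⇒S [] (oks , _) = _ , done (proj₁ (Rows-zero oks)) , stop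
  Tab⇒S {ƛ = ƛ} (x ∷ γ) (oks , cs , p , q)
    with t′ , st , oks′ , cs′ , hs ← strip oks cs
    with T , s , r ← Tab⇒S γ (oks′ , cs′ , Content-cong γ (λ c≤ → sym (Strip-count-≤ c≤ st)) q)
    = _ , step (sum ƛ , hs (head≤-sum ƛ)) (trans (cong (sum (map length t′) +_) (sym p)) (trans (Strip-count
          st) (cong sum (Rows-length oks)))) s
    , step st refl r

  S⇒Tab : ∀ γ → S ƛ γ T → ∃[ t ] Tab ƛ γ t × Shapes (length γ) t T
  S⇒Tab [] (done zs) with oks , cs ← Rows-empty zs = _ , (oks , cs , tt) , stop
  S⇒Tab (x ∷ γ) (step (_ , h) p s)
    with t′ , (oks , cs , q) , r ← S⇒Tab γ s
    with t , st , oks′ , cs′ ← fill oks h cs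
    with refl ← Rows-length oks | refl ← Rows-length oks′
    = t , (oks′ , cs′ , +-cancelˡ-≡ (sum (map length t′)) _ _ (trans (Strip-count st) (sym p)) , Content-cong
          γ (λ c≤ → Strip-count-≤ c≤ st) q)
    , step st refl r

  Shapes-functional : Shapes m t T → Shapes m t T′ → T ≡ T′
  Shapes-functional stop stop = refl
  Shapes-functional (step st refl r) (step st′ refl r′) with refl ← Strip-injective st st′ = cong (_ ∷_)
        (Shapes-functional r r′)

  -- `Strip` does not say that the truncated filling is again a tableau; `strip` computes a
  -- truncation that is one, and `Strip-injective` identifies the two.
  Shapes-injective : Rows m ƛ t → Linked Col t → Rows m ƛ t′ → Linked Col t′ → Shapes m t T → Shapes m t′ T →
        t ≡ t′
  Shapes-injective oks _ oks′ _ stop stop = trans (proj₂ (Rows-zero oks)) (sym (proj₂ (Rows-zero oks′)))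
  Shapes-injective oks cs oks′ cs′ (step st eq r) (step st′ eq′ r′)
    with t₁ , st₁ , oks₁ , cs₁ , _ ← strip oks cs | t₂ , st₂ , oks₂ , cs₂ , _ ← strip oks′ cs′
    with refl ← Strip-injective st st₁ | refl ← Strip-injective st′ st₂
    with refl ← Shapes-injective (subst (λ κ → Rows _ κ t₁) eq oks₁) cs₁ (subst (λ κ → Rows _ κ t₂) eq′ oks₂)
          cs₂ r r′
    = Strip-functional st st′ (trans (Rows-length oks) (sym (Rows-length oks′)))

  Tab-S : ∀ ƛ γ → Bij (Tab ƛ γ) (S ƛ γ)
  Tab-S ƛ γ = record
    { R = Shapes (length γ)
    ; to = Tab⇒S γ
    ; from = S⇒Tab γ
    ; functional = λ _ _ _ → Shapes-functional
    ; injective = λ (oks , cs , _) (oks′ , cs′ , _) _ → Shapes-injective oks cs oks′ cs′ }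

-- From the Boolean definition of Schur coefficients to patterns.

module SchurCoefficients where
  open import Defs
  open LinearArithmetic
  open Strips
  open Counting
  open PieriRule
  open Finiteness
  open ProductRule
  open HiddenNames
  open Tableaux

  private variable
    A : Set
    n : ℕ
    r r′ : List ℕ
    t t′ : List (List ℕ)

  ∧⁻ : ∀ {p q} → True (p ∧ q) → True p × True q
  ∧⁻ {true} q = tt , q

  ∧⁺ : ∀ {p q} → True p → True q → True (p ∧ q)
  ∧⁺ {true} _ q = q

  allᵇ⁻ : ∀ (p : A → Bool) xs → True (allᵇ p xs) → All (True ∘ p) xs
  allᵇ⁻ p [] _ = []
  allᵇ⁻ p (x ∷ xs) h = let q , hs = ∧⁻ h in q ∷ allᵇ⁻ p xs hs

  allᵇ⁺ : ∀ (p : A → Bool) {xs} → All (True ∘ p) xs → True (allᵇ p xs)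
  allᵇ⁺ p [] = tt
  allᵇ⁺ p (q ∷ hs) = ∧⁺ q (allᵇ⁺ p hs)

  rowWeak⁻ : ∀ r → True (rowWeak r) → AllPairs _≤_ r
  rowWeak⁻ [] _ = []
  rowWeak⁻ (x ∷ []) _ = [] ∷ []
  rowWeak⁻ (x ∷ y ∷ r) h = let p , hs = ∧⁻ {x ≤ᵇ y} h in glue (≤ᵇ⇒≤ x y p) (rowWeak⁻ (y ∷ r) hs)
    where
    glue : x ≤ y → AllPairs _≤_ (y ∷ r) → AllPairs _≤_ (x ∷ y ∷ r)
    glue p (q ∷ qs) = (p ∷ All.map (≤-trans p) q) ∷ q ∷ qs

  rowWeak⁺ : ∀ {r} → AllPairs _≤_ r → True (rowWeak r)
  rowWeak⁺ [] = tt
  rowWeak⁺ (_ ∷ []) = tt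
  rowWeak⁺ ((p ∷ _) ∷ ps@(_ ∷ _)) = ∧⁺ (≤⇒≤ᵇ p) (rowWeak⁺ ps)

  colStrict⁻ : ∀ r s → True (colStrict r s) → Col r s
  colStrict⁻ r [] _ = []
  colStrict⁻ (x ∷ r) (y ∷ s) h = let p , hs = ∧⁻ {x <ᵇ y} h in <ᵇ⇒< x y p ∷ colStrict⁻ r s hs

  colStrict⁺ : ∀ {r s} → Col r s → True (colStrict r s)
  colStrict⁺ [] = tt
  colStrict⁺ (p ∷ c) = ∧⁺ (<⇒<ᵇ p) (colStrict⁺ c)

  cols⁻ : ∀ t → True (cols t) → Linked Col t
  cols⁻ [] _ = []
  cols⁻ (r ∷ []) _ = [-]
  cols⁻ (r ∷ s ∷ t) h = let p , hs = ∧⁻ {colStrict r s} h in colStrict⁻ r s p ∷ cols⁻ (s ∷ t) hs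

  cols⁺ : Linked Col t → True (cols t)
  cols⁺ [] = tt
  cols⁺ [-] = tt
  cols⁺ (p ∷ c) = ∧⁺ (colStrict⁺ p) (cols⁺ c)

  upto1⁻ : ∀ {P : ℕ → Set} n → All P (upto1 n) → ∀ {c} → 1 ≤ c → c ≤ n → P c
  upto1⁻ n ps p q = All.lookup ps (complete (Enum-rangeFrom 1 n) (p , s≤s q))

  upto1⁺ : ∀ {P : ℕ → Set} n → (∀ {c} → 1 ≤ c → c ≤ n → P c) → All P (upto1 n)
  upto1⁺ n f = All.tabulate λ c∈ → let p , q = sound (Enum-rangeFrom 1 n) c∈ in f p (≤-pred q)

  part-∷ʳ-< : ∀ t α x c → c < length α → part t (α ∷ʳ x) (suc c) ≡ part t α (suc c)
  part-∷ʳ-< t (a ∷ α) x zero _ = refl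
  part-∷ʳ-< t (a ∷ α) x (suc c) (s≤s p) = part-∷ʳ-< t α x c p

  part-∷ʳ-≡ : ∀ t α x → part t (α ∷ʳ x) (suc (length α)) ≡ x
  part-∷ʳ-≡ t [] x = refl
  part-∷ʳ-≡ t (a ∷ α) x = part-∷ʳ-≡ t α x

  -- Exponent vectors begin with the letter 1, whereas patterns remove the largest letter first;
  -- hence the `reverse`.
  Content⁻ : ∀ γ t {w} → (∀ {c} → 1 ≤ c → c ≤ length γ → count c (concat t) ≡ part w (reverse γ) c) → Content
        γ t
  Content⁻ [] t f = tt
  Content⁻ (x ∷ γ) t {w} f rewrite unfold-reverse x γ =
    trans (f (s≤s z≤n) ≤-refl) (trans (cong (λ n → part w (reverse γ ∷ʳ x) (suc n)) (sym (length-reverse γ)))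
          (part-∷ʳ-≡ w (reverse γ) x))
    , Content⁻ γ t {w} λ { {suc c} p q → trans (f p (m≤n⇒m≤1+n q)) (part-∷ʳ-< w (reverse γ) x c (≤-trans q
          (≤-reflexive (sym (length-reverse γ))))) }

  Content⁺ : ∀ γ t {w} → Content γ t → ∀ c → 1 ≤ c → c ≤ length γ → count c (concat t) ≡ part w (reverse γ) c
  Content⁺ (x ∷ γ) t {w} (p , q) (suc c) _ (s≤s c≤) rewrite unfold-reverse x γ with c ≟ length γ
  ... | yes refl = trans p (sym (trans (cong (λ n → part w (reverse γ ∷ʳ x) (suc n)) (sym (length-reverse
        γ))) (part-∷ʳ-≡ w (reverse γ) x)))
  ... | no c≢ with c< ← ≤∧≢⇒< c≤ c≢ =
    trans (Content⁺ γ t {w} q (suc c) (s≤s z≤n) c<) (sym (part-∷ʳ-< w (reverse γ) x c (≤-trans c<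
          (≤-reflexive (sym (length-reverse γ))))))

  hasContent⁻ : ∀ α t → True (hasContent α t) → Content (reverse α) t
  hasContent⁻ α t h = Content⁻ (reverse α) t {t} λ {c} p q → trans
    (≡ᵇ⇒≡ (count c (concat t)) _ (upto1⁻ (length α) (allᵇ⁻ (λ c → count c (concat t) ≡ᵇ part t α c) _ h) p
          (≤-trans q (≤-reflexive (length-reverse α)))))
    (cong (λ β → part t β c) (sym (reverse-involutive α)))

  hasContent⁺ : ∀ α t → Content (reverse α) t → True (hasContent α t)
  hasContent⁺ α t h = allᵇ⁺ (λ c → count c (concat t) ≡ᵇ part t α c) (upto1⁺ (length α) λ {c} p q → ≡⇒≡ᵇ
        (count c (concat t)) _ (trans
    (Content⁺ (reverse α) t {t} h c p (≤-trans q (≤-reflexive (sym (length-reverse α)))))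
    (cong (λ β → part t β c) (reverse-involutive α))))

  Enum-fillings : ∀ ƛ n → Enum (Pointwise (λ l r → length r ≡ l × All (λ c → 1 ≤ c × c < suc n) r) ƛ)
        (fillings ƛ n)
  Enum-fillings [] n = enum ([] ∷ []) (λ where (here refl) → []) (λ where [] → here refl)
  Enum-fillings (l ∷ ƛ) n = Enum-⇔
    (λ where (r , ok , t , oks , refl) → ok ∷ oks)
    (λ where (ok ∷ oks) → _ , ok , _ , oks , refl)
    (Enum-concatMap _ (Enum-listsOf (Enum-rangeFrom 1 n) l) (λ {r} _ → Enum-map {f = r ∷_} ∷-injectiveʳ
          (Enum-fillings ƛ n))
      λ where (_ , _ , refl) (_ , _ , refl) → refl)

  Tab-card : ∀ ƛ α → Card (Tab ƛ (reverse α)) (schurCoeff ƛ α)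
  Tab-card ƛ α = Card-⇔ ⇒ ⇐ (Enum⇒Card (Enum-filterᵇ (λ t → isSSYT t ∧ hasContent α t) (Enum-fillings ƛ
        (length α))))
    where
    Fill : List (List ℕ) → Set
    Fill t = Pointwise (λ l r → length r ≡ l × All (λ c → 1 ≤ c × c < suc (length α)) r) ƛ t
    rows : ∀ {ƛ t} → Pointwise (λ l r → length r ≡ l × All (λ c → 1 ≤ c × c < suc (length α)) r) ƛ t → All
          (AllPairs _≤_) t → Rows (length (reverse α)) ƛ t
    rows [] [] = []
    rows ((eq , bs) ∷ oks) (w ∷ ws) =
      (eq , All.map (λ (p , q) → p , ≤-trans (≤-pred q) (≤-reflexive (sym (length-reverse α)))) bs , w) ∷
            rows oks ws
    rows⁻ : ∀ {ƛ t} → Rows (length (reverse α)) ƛ t → Pointwise (λ l r → length r ≡ l × All (λ c → 1 ≤ c × c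
          < suc (length α)) r) ƛ t × All (AllPairs _≤_) t
    rows⁻ [] = [] , []
    rows⁻ ((eq , bs , w) ∷ oks) with ps , ws ← rows⁻ oks =
      (eq , All.map (λ (p , q) → p , s≤s (≤-trans q (≤-reflexive (length-reverse α)))) bs) ∷ ps , w ∷ ws
    ⇒ : ∀ {t} → Fill t × True (isSSYT t ∧ hasContent α t) → Tab ƛ (reverse α) t
    ⇒ {t} (oks , h) with p , q ← ∧⁻ {isSSYT t} h with ws , cs ← ∧⁻ {allᵇ rowWeak t} p =
      rows oks (All.map (λ {r} → rowWeak⁻ r) (allᵇ⁻ rowWeak t ws)) , cols⁻ t cs , hasContent⁻ α t q
    ⇐ : ∀ {t} → Tab ƛ (reverse α) t → Fill t × True (isSSYT t ∧ hasContent α t)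
    ⇐ {t} (oks , cs , q) with ps , ws ← rows⁻ oks =
      ps , ∧⁺ {isSSYT t} (∧⁺ {allᵇ rowWeak t} (allᵇ⁺ rowWeak (All.map rowWeak⁺ ws)) (cols⁺ cs)) (hasContent⁺
            α t q)

  empties : ℕ → List (List ℕ)
  empties k = replicate k []

  Rows-pad : ∀ k → Rows n ƛ t → Rows n (ƛ ++ zeros k) (t ++ empties k)
  Rows-pad zero [] = []
  Rows-pad (suc k) [] = (refl , [] , []) ∷ Rows-pad k []
  Rows-pad k (ok ∷ oks) = ok ∷ Rows-pad k oks

  Rows-unpad : ∀ ƛ k → Rows n (ƛ ++ zeros k) t → ∃[ t′ ] t ≡ t′ ++ empties k × Rows n ƛ t′
  Rows-unpad [] zero [] = [] , refl , []
  Rows-unpad [] (suc k) (_∷_ {y = []} _ oks) with [] , eq , [] ← Rows-unpad [] k oks = [] , cong ([] ∷_) eq , []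
  Rows-unpad (_ ∷ ƛ) k (ok ∷ oks) with t′ , eq , oks′ ← Rows-unpad ƛ k oks = _ , cong (_ ∷_) eq , ok ∷ oks′

  Linked-pad : ∀ k → Linked Col t → Linked Col (t ++ empties k)
  Linked-pad zero [] = []
  Linked-pad (suc zero) [] = [-]
  Linked-pad (suc (suc k)) [] = [] ∷ Linked-pad (suc k) []
  Linked-pad zero [-] = [-]
  Linked-pad (suc k) [-] = [] ∷ Linked-pad (suc k) []
  Linked-pad k (c ∷ cs) = c ∷ Linked-pad k cs

  Linked-unpad : ∀ t k → Linked Col (t ++ empties k) → Linked Col t
  Linked-unpad [] k _ = []
  Linked-unpad (r ∷ []) k _ = [-]
  Linked-unpad (r ∷ s ∷ t) k (c ∷ cs) = c ∷ Linked-unpad (s ∷ t) k cs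

  concat-pad : ∀ t k → concat (t ++ empties k) ≡ concat t
  concat-pad [] zero = refl
  concat-pad [] (suc k) = concat-pad [] k
  concat-pad (r ∷ t) k = cong (r ++_) (concat-pad t k)

  -- Zero parts contribute empty rows only, so padding does not affect the count.
  Tab-pad : ∀ ƛ k γ → Bij (Tab ƛ γ) (Tab (ƛ ++ zeros k) γ)
  Tab-pad ƛ k γ = record
    { R = λ t t′ → t′ ≡ t ++ empties k
    ; to = λ {t} (oks , cs , q) → _ , (Rows-pad k oks , Linked-pad k cs , Content-cong γ (λ {c} _ → cong
          (count c) (sym (concat-pad t k))) q) , refl
    ; from = from′
    ; functional = λ _ _ _ e e′ → trans e (sym e′)
    ; injective = λ {t} {t′} _ _ _ e e′ → ++-cancelʳ (empties k) t t′ (trans (sym e) e′) }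
    where
    from′ : ∀ {t′} → Tab (ƛ ++ zeros k) γ t′ → ∃[ t ] Tab ƛ γ t × t′ ≡ t ++ empties k
    from′ (oks , cs , q) with t , refl , oks′ ← Rows-unpad ƛ k oks =
      t , (oks′ , Linked-unpad t k cs , Content-cong γ (λ {c} _ → cong (count c) (concat-pad t k)) q) , refl

  S-card : ∀ ƛ k α → Card (S (ƛ ++ zeros k) (reverse α)) (schurCoeff ƛ α)
  S-card ƛ k α = Card-Bij (Tab-S (ƛ ++ zeros k) (reverse α)) (Card-Bij (Tab-pad ƛ k (reverse α)) (Tab-card ƛ α))

  Enum-below : ∀ α → Enum (λ β → Pointwise _≤_ β α) (below α)
  Enum-below [] = enum ([] ∷ []) (λ where (here refl) → []) (λ where [] → here refl)
  Enum-below (a ∷ α) = Enum-⇔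
    (λ where (b , (_ , s≤s p) , _ , ps , refl) → p ∷ ps)
    (λ where (p ∷ ps) → _ , (z≤n , s≤s p) , _ , ps , refl)
    (Enum-concatMap _ (Enum-rangeFrom 0 (suc a)) (λ {b} _ → Enum-map {f = b ∷_} ∷-injectiveʳ (Enum-below α))
      λ where (_ , _ , refl) (_ , _ , refl) → refl)

  Card-× : ∀ {A B : Set} {P : A → Set} {Q : B → Set} {m n} → Card P m → Card Q n → Card (λ (x , y) → P x × Q
        y) (m * n)
  Card-× {n = n} (xs , E , refl) d = subst (Card _) (sum-const xs) (Card-Σ {f = λ _ → n} E λ _ → d)
    where
    sum-const : ∀ {A : Set} (xs : List A) → sum (map (λ _ → n) xs) ≡ length xs * n
    sum-const [] = refl
    sum-const (_ ∷ xs) = cong (n +_) (sum-const xs)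

  Add-∸ : Pointwise _≤_ β α → Add β (zipWith _∸_ α β) α
  Add-∸ [] = []
  Add-∸ (p ∷ ps) = cons (m+[n∸m]≡n p) (Add-∸ ps)

  Add-∷ʳ : ∀ {i j k} → Add α β γ → i + j ≡ k → Add (α ∷ʳ i) (β ∷ʳ j) (γ ∷ʳ k)
  Add-∷ʳ [] q = cons q []
  Add-∷ʳ (cons p add) q = cons p (Add-∷ʳ add q)

  Add-reverse : Add α β γ → Add (reverse α) (reverse β) (reverse γ)
  Add-reverse [] = []
  Add-reverse {i ∷ α} {j ∷ β} {k ∷ γ} (cons p add)
    rewrite unfold-reverse i α | unfold-reverse j β | unfold-reverse k γ = Add-∷ʳ (Add-reverse add) p

  Add-≤ : Add α β γ → Pointwise _≤_ α γ
  Add-≤ [] = []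
  Add-≤ (cons {i = i} {j} refl add) = m≤m+n i j ∷ Add-≤ add

  Conv-card : ∀ μ j ν k α → Card (Conv (μ ++ zeros j) (ν ++ zeros k) (reverse α)) (schurProdCoeff μ ν α)
  Conv-card μ j ν k α = Card-Bij (maps-Bij f g f-ok g-ok gf fg) (Card-Σ (Enum-below α) λ {β} _ →
    Card-× (S-card μ j β) (S-card ν k (zipWith _∸_ α β)))
    where
    P : List ℕ × (GT × GT) → Set
    P (β , (T , T′)) = Pointwise _≤_ β α × S (μ ++ zeros j) (reverse β) T × S (ν ++ zeros k) (reverse
          (zipWith _∸_ α β)) T′
    f : List ℕ × (GT × GT) → (List ℕ × List ℕ) × (GT × GT)
    f (β , d) = (reverse β , reverse (zipWith _∸_ α β)) , d
    g : (List ℕ × List ℕ) × (GT × GT) → List ℕ × (GT × GT)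
    g ((ε , _) , d) = reverse ε , d
    gf : ∀ {x} → P x → g (f x) ≡ x
    gf {β , d} _ = cong (_, d) (reverse-involutive β)
    f-ok : ∀ {x} → P x → Conv (μ ++ zeros j) (ν ++ zeros k) (reverse α) (f x)
    f-ok (le , s , s′) = Add-reverse (Add-∸ le) , s , s′
    rev : ∀ {ε ζ} → Add ε ζ (reverse α) → Add (reverse ε) (reverse ζ) α
    rev add = subst (Add _ _) (reverse-involutive α) (Add-reverse add)
    diff : ∀ {ε ζ} → Add ε ζ (reverse α) → reverse (zipWith _∸_ α (reverse ε)) ≡ ζ
    diff {ε} {ζ} add = trans (cong reverse (Add-cancelˡ (Add-∸ (Add-≤ (rev add))) (rev add)))
          (reverse-involutive ζ)
    fg : ∀ {y} → Conv (μ ++ zeros j) (ν ++ zeros k) (reverse α) y → f (g y) ≡ y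
    fg {(ε , ζ) , d} (add , _) = cong (_, d) (cong₂ _,_ (reverse-involutive ε) (diff add))
    g-ok : ∀ {y} → Conv (μ ++ zeros j) (ν ++ zeros k) (reverse α) y → P (g y)
    g-ok {(ε , ζ) , (T , T′)} (add , s , s′) = Add-≤ (rev add)
      , subst (λ ε → S _ ε T) (sym (reverse-involutive ε)) s , subst (λ ζ → S _ ζ T′) (sym (diff add)) s′

-- Reading parts, lengths and partial sums off a code.

module Codes where
  open import Defs
  open LinearArithmetic
  open Strips
  open Counting
  open PieriRule
  open Finiteness
  open ProductRule
  open HiddenNames
  open SchurCoefficients

  private variable
    p q r : List ℕ

  nth : List ℕ → ℕ → ℕ
  nth [] _ = 0
  nth (x ∷ xs) zero = x
  nth (x ∷ xs) (suc j) = nth xs j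

  data Par : List ℕ → Set where
    []   : Par []
    cons : ∀ {x} → nth p 0 ≤ x → 1 ≤ x → Par p → Par (x ∷ p)

  Par⁻ : ∀ p → True (isPartition p) → Par p
  Par⁻ [] _ = []
  Par⁻ (x ∷ []) h = cons z≤n (≤ᵇ⇒≤ 1 x h) []
  Par⁻ (x ∷ y ∷ p) h = let h₁ , h₂ = ∧⁻ {y ≤ᵇ x} h in glue (≤ᵇ⇒≤ y x h₁) (Par⁻ (y ∷ p) h₂)
    where
    glue : y ≤ x → Par (y ∷ p) → Par (x ∷ y ∷ p)
    glue le π@(cons _ 1≤y _) = cons le (≤-trans 1≤y le) π

  Par⁺ : Par p → True (isPartition p)
  Par⁺ [] = tt
  Par⁺ (cons _ q []) = ≤⇒≤ᵇ q
  Par⁺ (cons p _ π@(cons _ _ _)) = ∧⁺ (≤⇒≤ᵇ p) (Par⁺ π)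

  Par-positive : Par p → All (1 ≤_) p
  Par-positive [] = []
  Par-positive (cons _ q π) = q ∷ Par-positive π

  lastOf : ℕ → List ℕ → ℕ
  lastOf p [] = p
  lastOf p (q ∷ qs) = lastOf q qs

  lastOf-∷ʳ : ∀ p qs q → lastOf p (qs ∷ʳ q) ≡ q
  lastOf-∷ʳ p [] q = refl
  lastOf-∷ʳ p (x ∷ qs) q = lastOf-∷ʳ x qs q

  lastOf-reverse : ∀ p → lastOf 0 (reverse p) ≡ nth p 0
  lastOf-reverse [] = refl
  lastOf-reverse (x ∷ p) = trans (cong (lastOf 0) (unfold-reverse x p)) (lastOf-∷ʳ 0 (reverse p) x)

  code-∷ʳ : ∀ ƛ p qs q → code ƛ p (qs ∷ʳ q) ≡ code ƛ p qs ++ (replicate (q ∸ lastOf p qs) R ++ [ U ])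
  code-∷ʳ ƛ p [] q = refl
  code-∷ʳ ƛ p (x ∷ qs) q = begin
    replicate (x ∸ p) R ++ (U ∷ code ƛ x (qs ∷ʳ q))                 ≡⟨ cong (λ w → replicate (x ∸ p) R ++ (U
          ∷ w)) (code-∷ʳ ƛ x qs q) ⟩
    replicate (x ∸ p) R ++ ((U ∷ code ƛ x qs) ++ (replicate (q ∸ lastOf x qs) R ++ [ U ]))  ≡⟨ ++-assoc
          (replicate (x ∸ p) R) _ _ ⟨
    (replicate (x ∸ p) R ++ (U ∷ code ƛ x qs)) ++ (replicate (q ∸ lastOf x qs) R ++ [ U ])  ∎
    where open ≡-Reasoning

  -- The code read from the right, the direction in which `rIdx` counts the U's: now the first row
  -- comes first, and recursion on the partition is possible.
  revCode : List ℕ → List Letter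
  revCode [] = []
  revCode (x ∷ p) = U ∷ (replicate (x ∸ nth p 0) R ++ revCode p)

  replicate-∷ʳ : ∀ {A : Set} n (x : A) → replicate n x ∷ʳ x ≡ x ∷ replicate n x
  replicate-∷ʳ zero x = refl
  replicate-∷ʳ (suc n) x = cong (x ∷_) (replicate-∷ʳ n x)

  reverse-replicate : ∀ {A : Set} n (x : A) → reverse (replicate n x) ≡ replicate n x
  reverse-replicate zero x = refl
  reverse-replicate (suc n) x = trans (unfold-reverse x (replicate n x)) (trans (cong (_∷ʳ x)
        (reverse-replicate n x)) (replicate-∷ʳ n x))

  reverse-code : ∀ ƛ p → reverse (code ƛ 0 (reverse p)) ≡ revCode p
  reverse-code ƛ [] = refl
  reverse-code ƛ (x ∷ p) = begin
    reverse (code ƛ 0 (reverse (x ∷ p)))                                            ≡⟨ cong (reverse ∘ code ƛ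
          0) (unfold-reverse x p) ⟩
    reverse (code ƛ 0 (reverse p ∷ʳ x))                                             ≡⟨ cong reverse (code-∷ʳ
          ƛ 0 (reverse p) x) ⟩
    reverse (code ƛ 0 (reverse p) ++ (Rs (x ∸ lastOf 0 (reverse p)) ++ [ U ]))       ≡⟨ reverse-++ (code ƛ 0
          (reverse p)) _ ⟩
    reverse (Rs (x ∸ lastOf 0 (reverse p)) ++ [ U ]) ++ reverse (code ƛ 0 (reverse p)) ≡⟨ cong₂ _++_
          (reverse-++ (Rs (x ∸ lastOf 0 (reverse p))) [ U ]) (reverse-code ƛ p) ⟩
    U ∷ (reverse (Rs (x ∸ lastOf 0 (reverse p))) ++ revCode p)                       ≡⟨ cong (λ w → U ∷ (w ++
          revCode p)) (reverse-replicate (x ∸ lastOf 0 (reverse p)) R) ⟩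
    U ∷ (Rs (x ∸ lastOf 0 (reverse p)) ++ revCode p)                                 ≡⟨ cong (λ n → U ∷ (Rs
          (x ∸ n) ++ revCode p)) (lastOf-reverse p) ⟩
    revCode (x ∷ p)                                                                  ∎
    where
    open ≡-Reasoning
    Rs = λ n → replicate n R

  countR-R : ∀ n w → countR (replicate n R ++ w) ≡ n + countR w
  countR-R zero w = refl
  countR-R (suc n) w = cong suc (countR-R n w)

  -- The differences of consecutive parts telescope; the order of the parts makes each truncated
  -- subtraction exact.
  countR-revCode : Par p → countR (revCode p) ≡ nth p 0
  countR-revCode [] = refl
  countR-revCode (cons {p} {x} le _ π) = trans (countR-R (x ∸ nth p 0) (revCode p)) (trans (cong (x ∸ nth p 0
        +_) (countR-revCode π)) (m∸n+n≡m le))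

  findU-R : ∀ ƛ i n w → findU ƛ i (replicate n R ++ w) ≡ findU ƛ i w
  findU-R ƛ i zero w = refl
  findU-R ƛ i (suc n) w = findU-R ƛ i n w

  findU-revCode : ∀ ƛ j → Par p → findU ƛ (suc j) (revCode p) ≡ nth p j
  findU-revCode ƛ j [] = refl
  findU-revCode ƛ zero π@(cons _ _ _) = countR-revCode π
  findU-revCode ƛ (suc j) (cons {p} {x} _ _ π) = trans (findU-R ƛ (suc j) (x ∸ nth p 0) (revCode p))
        (findU-revCode ƛ j π)

  rIdx-nth : ∀ j → Par p → rIdx (suc j) p ≡ nth p j
  rIdx-nth {p} j π = begin
    rIdx (suc j) p                               ≡⟨ rIdx-findU p (suc j) ⟩
    findU p (suc j) (reverse (codeMid p))        ≡⟨ cong (findU p (suc j) ∘ reverse) (codeMid-code p) ⟩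
    findU p (suc j) (reverse (code p 0 (reverse p))) ≡⟨ cong (findU p (suc j)) (reverse-code p p) ⟩
    findU p (suc j) (revCode p)                  ≡⟨ findU-revCode p j π ⟩
    nth p j                                      ∎
    where open ≡-Reasoning

  countU-R : ∀ n w → countU (replicate n R ++ w) ≡ countU w
  countU-R zero w = refl
  countU-R (suc n) w = countU-R n w

  countU-code : ∀ ƛ p qs → countU (code ƛ p qs) ≡ length qs
  countU-code ƛ p [] = refl
  countU-code ƛ p (q ∷ qs) = trans (countU-R (q ∸ p) (U ∷ code ƛ q qs)) (cong suc (countU-code ƛ q qs))

  -- The smallest part is positive, so this stretch of the code begins with an R and none of its U's
  -- precedes the first R.
  countAfterR-code : ∀ ƛ qs → All (1 ≤_) qs → countAfterR ƛ (code ƛ 0 qs) ≡ length qs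
  countAfterR-code ƛ [] _ = refl
  countAfterR-code ƛ (suc q ∷ qs) (s≤s _ ∷ _) = trans (countU-R q (U ∷ code ƛ (suc q) qs)) (cong suc
        (countU-code ƛ (suc q) qs))

  All-reverse : ∀ {A : Set} {P : A → Set} {xs} → All P xs → All P (reverse xs)
  All-reverse [] = []
  All-reverse {xs = x ∷ xs} (p ∷ ps) = subst (All _) (sym (unfold-reverse x xs)) (All.∷ʳ⁺ (All-reverse ps) p)

  u₁-length : Par p → u₁ p ≡ length p
  u₁-length {p} π = begin
    u₁ p                                   ≡⟨ u₁-countAfterR p ⟩
    countAfterR p (codeMid p)              ≡⟨ cong (countAfterR p) (codeMid-code p) ⟩
    countAfterR p (code p 0 (reverse p))   ≡⟨ countAfterR-code p (reverse p) (All-reverse (Par-positive π)) ⟩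
    length (reverse p)                     ≡⟨ length-reverse p ⟩
    length p                               ∎
    where open ≡-Reasoning

  nth-≥ : ∀ p j → length p ≤ j → nth p j ≡ 0
  nth-≥ [] j _ = refl
  nth-≥ (x ∷ p) (suc j) (s≤s le) = nth-≥ p j le

  Par-nth : Par p → ∀ j → j < length p → 1 ≤ nth p j
  Par-nth (cons _ q _) zero _ = q
  Par-nth (cons _ _ π) (suc j) (s≤s lt) = Par-nth π j lt

  -- Differences of these partial sums for consecutive shapes are the numbers k(i,j), so the
  -- condition on them can be stated without subtraction.
  prefix : List ℕ → ℕ → ℕ
  prefix p zero = 0
  prefix [] (suc j) = 0
  prefix (x ∷ p) (suc j) = x + prefix p j

  prefix-suc : ∀ p j → prefix p (suc j) ≡ prefix p j + nth p j
  prefix-suc [] zero = refl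
  prefix-suc [] (suc j) = refl
  prefix-suc (x ∷ p) zero = +-identityʳ x
  prefix-suc (x ∷ []) (suc zero) = sym (+-identityʳ (x + 0))
  prefix-suc (x ∷ []) (suc (suc j)) = sym (+-identityʳ (x + 0))
  prefix-suc (x ∷ p@(_ ∷ _)) (suc j) = trans (cong (x +_) (prefix-suc p j)) (sym (+-assoc x (prefix p j) (nth
        p j)))

  prefix-all : ∀ p j → length p ≤ j → prefix p j ≡ sum p
  prefix-all [] zero _ = refl
  prefix-all [] (suc j) _ = refl
  prefix-all (x ∷ p) (suc j) (s≤s le) = cong (x +_) (prefix-all p j le)

  Pads : List ℕ → List ℕ → Set
  Pads p c = ∃[ k ] c ≡ p ++ zeros k

  nth-zeros : ∀ k j → nth (zeros k) j ≡ 0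
  nth-zeros zero j = refl
  nth-zeros (suc k) zero = refl
  nth-zeros (suc k) (suc j) = nth-zeros k j

  Pads-nth : Pads p c → ∀ j → nth c j ≡ nth p j
  Pads-nth {[]} (k , refl) j = nth-zeros k j
  Pads-nth {x ∷ p} (k , refl) zero = refl
  Pads-nth {x ∷ p} (k , refl) (suc j) = Pads-nth {p} (k , refl) j

  Pads-prefix : Pads p c → ∀ j → prefix c j ≡ prefix p j
  Pads-prefix ρ zero = refl
  Pads-prefix {p} {c} ρ (suc j) = trans (prefix-suc c j) (trans (cong₂ _+_ (Pads-prefix ρ j) (Pads-nth ρ j))
        (sym (prefix-suc p j)))

  Pads-sum : Pads p c → sum c ≡ sum p
  Pads-sum {p} (k , refl) = trans (sum-++ p (zeros k)) (trans (cong (sum p +_) (sum-zeros k)) (+-identityʳ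
        (sum p)))

  nth⇒HS : ∀ {u} → length a ≡ length b → nth b 0 ≤ u → (∀ j → nth a j ≤ nth b j) → (∀ j → nth b (suc j) ≤ nth
        a j) → HS u a b
  nth⇒HS {[]} {[]} _ _ _ _ = []
  nth⇒HS {x ∷ a} {y ∷ b} l p f g = cons (f 0) p (nth⇒HS (suc-injective l) (g 0) (f ∘ suc) (g ∘ suc))

  HS⇒nth : ∀ {u} → HS u a b → ∀ j → nth a j ≤ nth b j × nth b (suc j) ≤ nth a j
  HS⇒nth [] j = z≤n , z≤n
  HS⇒nth (cons p q []) zero = p , z≤n
  HS⇒nth (cons p q (cons _ r _)) zero = p , r
  HS⇒nth (cons p q h) (suc j) = HS⇒nth h j

  -- The offset `w` stands for the rows already read. The strip from `a` to `b` gives `x ≤ y`, which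
  -- keeps the next counter nonnegative.
  prefix⇒Lat : ∀ {u} w → length b ≡ length c → HS u a b → (∀ j → prefix c (suc j) + prefix a j ≤ w + prefix b
        (suc j) + prefix b j) → ∃[ e ] Lat w a b c e
  prefix⇒Lat {[]} {[]} w _ [] f = w , []
  prefix⇒Lat {y ∷ b} {z ∷ c} {x ∷ a} w l (cons x≤y _ h) f
    with z≤ ← (z ≤ y + w) ∋ (≤-by (f 0) (lin 3 (λ w y z → z :+ (w :+ (y :+ con 0) :+ con 0) := y :+ w :+ (z
          :+ con 0 :+ con 0)) refl w y z))
    with w′ , eq ← split≤ (z + x ≤ w + (y + y) ∋ (≤-by (z≤ ⊕ x≤y) (lin 4 (λ w x y z → z :+ x :+ (y :+ w :+ y)
          := w :+ (y :+ y) :+ (z :+ x)) refl w x y z)))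
    with e , l′ ← prefix⇒Lat w′ (suc-injective l) h (λ j →
      (≤-by (≤-reflexive (sym eq) ⊕ (f (suc j))) (lin 9 (λ x₁ x₂ x₃ x₄ w w′ x y z → x₄ :+ x₁ :+ (z :+ x :+ w′
            :+ (w :+ (y :+ x₂) :+ (y :+ x₃))) := w′ :+ x₂ :+ x₃ :+ (w :+ (y :+ y) :+ (z :+ x₄ :+ (x :+ x₁))))
            refl (prefix a j) (prefix b (suc j)) (prefix b j) (prefix c (suc j)) w w′ x y z)))
    = e , cons z≤ (trans (+-comm w′ _) eq) l′

  Lat⇒prefix : ∀ {w e} → Lat w a b c e → ∀ j → prefix c (suc j) + prefix a j ≤ w + prefix b (suc j) + prefix b j
  Lat⇒prefix [] zero = z≤n
  Lat⇒prefix [] (suc j) = z≤n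
  Lat⇒prefix {w = w} (cons {x = x} {y} {z} p q l) zero = (≤-by p (lin 3 (λ w y z → z :+ con 0 :+ con 0 :+ (y
        :+ w) := w :+ (y :+ con 0) :+ con 0 :+ z) refl w y z))
  Lat⇒prefix {x ∷ a} {y ∷ b} {z ∷ c} {w = w} (cons {w′ = w′} p q l) (suc j) =
    (≤-by (≤-reflexive q ⊕ (Lat⇒prefix l j)) (lin 9 (λ x₁ x₂ x₃ x₄ w w′ x y z → z :+ x₄ :+ (x :+ x₁) :+ (w :+
          (y :+ y) :+ (w′ :+ x₂ :+ x₃)) := w :+ (y :+ x₂) :+ (y :+ x₃) :+ (w′ :+ (z :+ x) :+ (x₄ :+ x₁)))
          refl (prefix a j) (prefix b (suc j)) (prefix b j) (prefix c (suc j)) w w′ x y z))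

-- Moves of U's as horizontal strips, and the condition on the switches.

module Moves where
  open import Defs
  open LinearArithmetic
  open Strips
  open Counting
  open PieriRule
  open Finiteness
  open ProductRule
  open HiddenNames
  open SchurCoefficients
  open Codes

  private variable
    p q r : List ℕ
    n : ℕ

  ⇒ᵇ⁻ : ∀ {x y} → True (x ⇒ᵇ y) → True x → True y
  ⇒ᵇ⁻ {true} h _ = h

  ⇒ᵇ⁺ : ∀ {x y} → (True x → True y) → True (x ⇒ᵇ y)
  ⇒ᵇ⁺ {true} f = f tt
  ⇒ᵇ⁺ {false} f = tt

  -- Horizontal strips for partitions without padding. The second half is the rule that no U passes
  -- the starting position of the next U to its right.
  Interlace : List ℕ → List ℕ → Set
  Interlace p q = (∀ j → nth p j ≤ nth q j) × (∀ j → nth q (suc j) ≤ nth p j)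

  -- A part further down in `q` would lie below a zero part of `p`. This is why, outside the finite
  -- part of the code, only the U immediately left of the first R can move.
  Interlace-length : Par q → Interlace p q → length q ≤ suc (length p)
  Interlace-length {q} {p} π (_ , g) with length q ≤? suc (length p)
  ... | yes le = le
  ... | no ≰ = ⊥-elim (1≰0 (≤-trans (Par-nth π _ (≰⇒> ≰)) (≤-trans (g (length p)) (≤-reflexive (nth-≥ p
        (length p) ≤-refl)))))

  moved-nth : ∀ j → Par p → Par q → nth p j ≤ nth q j → moved p q (suc j) + nth p j ≡ nth q j
  moved-nth {p} {q} j π ρ le = trans (cong (_+ nth p j) (cong₂ _∸_ (rIdx-nth j ρ) (rIdx-nth j π))) (m∸n+n≡m le)

  sum-moved : ∀ i n → Par p → Par q → (∀ j → nth p j ≤ nth q j) →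
              sum (map (moved p q) (rangeFrom (suc i) n)) + prefix p (i + n) + prefix q i ≡ prefix q (i + n)
                    + prefix p i
  sum-moved {p} {q} i zero π ρ f rewrite +-identityʳ i = +-comm (prefix p i) (prefix q i)
  sum-moved {p} {q} i (suc n) π ρ f rewrite +-suc i n = (≡-by ((sum-moved (suc i) n π ρ f) ⊞ (moved-nth i π ρ
        (f i)) ⊞ (prefix-suc p i) ⊞ sym (prefix-suc q i)) (lin 10 (λ x₁ x₂ x₃ x₄ x₅ x₆ x₇ x₈ x₉ x₁₀ → x₁ :+
        x₁₀ :+ x₄ :+ x₉ :+ (x₇ :+ x₅ :+ x₃ :+ (x₆ :+ x₂) :+ x₈) := x₇ :+ x₆ :+ (x₁₀ :+ x₄ :+ x₈ :+ (x₁ :+ x₂)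
        :+ x₅ :+ (x₉ :+ x₃))) refl (moved p q (suc i)) (nth p i) (nth q i) (prefix p (suc (i + n))) (prefix p
        (suc i)) (prefix p i) (prefix q (suc (i + n))) (prefix q (suc i)) (prefix q i) (sum (map (moved p q)
        (rangeFrom (suc (suc i)) n)))))

  kSw-prefix : ∀ n → Par p → Par q → (∀ j → nth p j ≤ nth q j) → kSw p q n + prefix p n ≡ prefix q n
  kSw-prefix {p} {q} n π ρ f = (≡-by (sum-moved 0 n π ρ f) (lin 3 (λ x₁ x₂ x₃ → x₁ :+ x₂ :+ (x₃ :+ con 0) :=
        x₃ :+ (x₁ :+ x₂ :+ con 0)) refl (kSw p q n) (prefix p n) (prefix q n)))

  total-moved : Par p → Par q → Interlace p q → sum (map (moved p q) (upto1 (movable p))) + sum p ≡ sum q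
  total-moved {p} {q} π ρ i@(f , _) rewrite u₁-length π = trans
    (cong (kSw p q (suc (length p)) +_) (sym (prefix-all p (suc (length p)) (n≤1+n _))))
    (trans (kSw-prefix (suc (length p)) π ρ f) (prefix-all q (suc (length p)) (Interlace-length {p = p} ρ i)))

  private
    legal : List ℕ → List ℕ → ℕ → Bool
    legal p q j = (rIdx j p ≤ᵇ rIdx j q)
                ∧ ((movable p <ᵇ j) ⇒ᵇ (rIdx j q ≡ᵇ rIdx j p))
                ∧ ((2 ≤ᵇ j) ⇒ᵇ (rIdx j q ≤ᵇ rIdx (j ∸ 1) p))

    legal⁻ : ∀ j → Par p → Par q → True (legal p q (suc j)) → nth p j ≤ nth q j
    legal⁻ {p} {q} j π ρ h = subst₂ _≤_ (rIdx-nth j π) (rIdx-nth j ρ) (≤ᵇ⇒≤ (rIdx (suc j) p) (rIdx (suc j) q)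
          (proj₁ (∧⁻ {rIdx (suc j) p ≤ᵇ rIdx (suc j) q} h)))

    legal⁻′ : ∀ j → Par p → Par q → True (legal p q (suc (suc j))) → nth q (suc j) ≤ nth p j
    legal⁻′ {p} {q} j π ρ h = subst₂ _≤_ (rIdx-nth (suc j) ρ) (rIdx-nth j π) (≤ᵇ⇒≤ (rIdx (suc (suc j)) q)
          (rIdx (suc j) p)
      (⇒ᵇ⁻ {2 ≤ᵇ suc (suc j)} (proj₂ (∧⁻ {(movable p <ᵇ suc (suc j)) ⇒ᵇ (rIdx (suc (suc j)) q ≡ᵇ rIdx (suc
            (suc j)) p)}
        (proj₂ (∧⁻ {rIdx (suc (suc j)) p ≤ᵇ rIdx (suc (suc j)) q} h)))) tt))

    legal⁺ : ∀ j → Par p → Par q → Interlace p q → True (legal p q (suc j))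
    legal⁺ {p} {q} j π ρ i@(f , g) =
      ∧⁺ {rIdx (suc j) p ≤ᵇ rIdx (suc j) q} (≤⇒≤ᵇ (subst₂ _≤_ (sym (rIdx-nth j π)) (sym (rIdx-nth j ρ)) (f j)))
      (∧⁺ {(movable p <ᵇ suc j) ⇒ᵇ (rIdx (suc j) q ≡ᵇ rIdx (suc j) p)}
        (⇒ᵇ⁺ {movable p <ᵇ suc j} (λ h → ≡⇒≡ᵇ (rIdx (suc j) q) (rIdx (suc j) p) (trans (rIdx-nth j ρ) (trans
              (still (≤-pred (<ᵇ⇒< (movable p) (suc j) h))) (sym (rIdx-nth j π))))))
        (⇒ᵇ⁺ {2 ≤ᵇ suc j} (below-prev j)))
      where
      still : movable p ≤ j → nth q j ≡ nth p j
      still le rewrite u₁-length π = trans (nth-≥ q j (≤-trans (Interlace-length {p = p} ρ i) le)) (sym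
            (nth-≥ p j (≤-trans (n≤1+n _) le)))
      below-prev : ∀ j → True (2 ≤ᵇ suc j) → True (rIdx (suc j) q ≤ᵇ rIdx j p)
      below-prev (suc j) _ = ≤⇒≤ᵇ (subst₂ _≤_ (sym (rIdx-nth (suc j) ρ)) (sym (rIdx-nth j π)) (g j))

  validStep⁻ : ∀ a → Par p → Par q → True (validStep p q a) → Interlace p q × sum p + a ≡ sum q
  validStep⁻ {p} {q} a π ρ h with h₁ , h₂ ← ∧⁻ {allᵇ (legal p q) (upto1 (bound p q))} h =
    (f , g) , trans (+-comm (sum p) a) (trans (cong (_+ sum p) (sym (≡ᵇ⇒≡ _ a h₂))) (total-moved π ρ (f , g)))
    where
    legals : ∀ {j} → 1 ≤ j → j ≤ bound p q → True (legal p q j)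
    legals = upto1⁻ (bound p q) (allᵇ⁻ (legal p q) _ h₁)
    f : ∀ j → nth p j ≤ nth q j
    f j with length p ≤? j
    ... | yes le = ≤-trans (≤-reflexive (nth-≥ p j le)) z≤n
    ... | no ≰ = legal⁻ j π ρ (legals (s≤s z≤n) (≤-trans (≰⇒> ≰) (≤-trans (m≤m+n _ (length q)) (m≤m+n _ 2))))
    g : ∀ j → nth q (suc j) ≤ nth p j
    g j with length q ≤? suc j
    ... | yes le = ≤-trans (≤-reflexive (nth-≥ q (suc j) le)) z≤n
    ... | no ≰ = legal⁻′ j π ρ (legals (s≤s z≤n) (≤-trans (≰⇒> ≰) (≤-trans (m≤n+m _ (length p)) (m≤m+n _ 2))))

  validStep⁺ : ∀ a → Par p → Par q → Interlace p q → sum p + a ≡ sum q → True (validStep p q a)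
  validStep⁺ {p} {q} a π ρ i eq = ∧⁺ {allᵇ (legal p q) (upto1 (bound p q))}
    (allᵇ⁺ (legal p q) (upto1⁺ (bound p q) λ { {suc j} _ _ → legal⁺ j π ρ i }))
    (≡⇒≡ᵇ _ a (+-cancelʳ-≡ (sum p) _ a (trans (total-moved π ρ i) (trans (sym eq) (+-comm (sum p) a)))))

  -- The inequality between k(i+1,j+1) and k(i,j) with all subtracted terms moved to the other side.
  Lattice : List ℕ → List ℕ → List ℕ → Set
  Lattice p q r = ∀ j → prefix r (suc j) + prefix p j ≤ prefix q (suc j) + prefix q j

  kSw-Lattice : ∀ j → Par p → Par q → Par r → Interlace p q → Interlace q r →
                kSw q r (suc j) + (prefix q (suc j) + prefix q j) ≡ prefix r (suc j) + prefix q j ×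
                kSw p q j + (prefix q (suc j) + prefix p j) ≡ prefix q (suc j) + prefix q j
  kSw-Lattice {p} {q} {r} j π ρ σ (f , _) (g , _) =
    (≡-by ((kSw-prefix (suc j) ρ σ g)) (lin 4 (λ x₁ x₂ x₃ x₄ → x₁ :+ (x₂ :+ x₃) :+ x₄ := x₄ :+ x₃ :+ (x₁ :+
          x₂)) refl (kSw q r (suc j)) (prefix q (suc j)) (prefix q j) (prefix r (suc j))))
    , (≡-by (kSw-prefix j π ρ f) (lin 4 (λ x₁ x₂ x₃ x₄ → x₁ :+ (x₃ :+ x₂) :+ x₄ := x₃ :+ x₄ :+ (x₁ :+ x₂))
          refl (kSw p q j) (prefix p j) (prefix q (suc j)) (prefix q j)))

  kSw⇒prefix : ∀ j → Par p → Par q → Par r → Interlace p q → Interlace q r →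
               kSw q r (suc j) ≤ kSw p q j → prefix r (suc j) + prefix p j ≤ prefix q (suc j) + prefix q j
  kSw⇒prefix {p} {q} {r} j π ρ σ i i′ le with e₁ , e₂ ← kSw-Lattice j π ρ σ i i′ =
    (≤-by (le ⊕ ≤-reflexive (sym e₁) ⊕ ≤-reflexive e₂) (lin 6 (λ x₁ x₂ x₃ x₄ x₅ x₆ → x₆ :+ x₃ :+ (x₁ :+ (x₂
          :+ (x₄ :+ x₅)) :+ (x₄ :+ x₅)) := x₄ :+ x₅ :+ (x₂ :+ (x₆ :+ x₅) :+ (x₁ :+ (x₄ :+ x₃)))) refl (kSw p
          q j) (kSw q r (suc j)) (prefix p j) (prefix q (suc j)) (prefix q j) (prefix r (suc j))))

  prefix⇒kSw : ∀ j → Par p → Par q → Par r → Interlace p q → Interlace q r →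
               prefix r (suc j) + prefix p j ≤ prefix q (suc j) + prefix q j → kSw q r (suc j) ≤ kSw p q j
  prefix⇒kSw {p} {q} {r} j π ρ σ i i′ le with e₁ , e₂ ← kSw-Lattice j π ρ σ i i′ =
    (≤-by (le ⊕ ≤-reflexive e₁ ⊕ ≤-reflexive (sym e₂)) (lin 6 (λ x₁ x₂ x₃ x₄ x₅ x₆ → x₂ :+ (x₄ :+ x₅ :+ (x₆
          :+ x₅) :+ (x₁ :+ (x₄ :+ x₃))) := x₁ :+ (x₆ :+ x₃ :+ (x₂ :+ (x₄ :+ x₅)) :+ (x₄ :+ x₅))) refl (kSw p
          q j) (kSw q r (suc j)) (prefix p j) (prefix q (suc j)) (prefix q j) (prefix r (suc j))))

  kCond⁻ : Par p → Par q → Par r → Interlace p q → Interlace q r → True (kCond p q r) → Lattice p q r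
  kCond⁻ {p} {q} {r} π ρ σ i i′ h = lattice
    where
    B = length p + length q + length r + 2
    small : ∀ j → suc j ≤ B → prefix r (suc j) + prefix p j ≤ prefix q (suc j) + prefix q j
    small j le = kSw⇒prefix j π ρ σ i i′ (≤ᵇ⇒≤ (kSw q r (suc j)) (kSw p q j)
      (upto1⁻ B (allᵇ⁻ (λ j → kSw q r j ≤ᵇ kSw p q (j ∸ 1)) _ h) (s≤s z≤n) le))
    J = length p + length q + length r
    B≡ : B ≡ suc (suc J)
    B≡ = +-comm J 2
    p≤J : length p ≤ J
    p≤J = ≤-trans (m≤m+n _ (length q)) (m≤m+n _ (length r))
    q≤J : length q ≤ J
    q≤J = ≤-trans (m≤n+m _ (length p)) (m≤m+n _ (length r))
    r≤J : length r ≤ J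
    r≤J = m≤n+m (length r) (length p + length q)
    stable : ∀ s j → length s ≤ J → J ≤ j → prefix s j ≡ prefix s J
    stable s j le le′ = trans (prefix-all s j (≤-trans le le′)) (sym (prefix-all s J le))
    stable′ : ∀ s j → length s ≤ J → J ≤ j → prefix s (suc j) ≡ prefix s (suc J)
    stable′ s j le le′ = trans (prefix-all s (suc j) (≤-trans le (≤-trans le′ (n≤1+n j)))) (sym (prefix-all s
          (suc J) (≤-trans le (n≤1+n J))))
    lattice : Lattice p q r
    lattice j with J ≤? j
    ... | no ≰ = small j (≤-trans (≰⇒> ≰) (≤-trans (≤-trans (n≤1+n J) (n≤1+n _)) (≤-reflexive (sym B≡))))
    -- From `J` on all partial sums are constant, so the instance at `J`, which lies within the
    -- tested range, covers every larger index.
    ... | yes J≤j rewrite stable p j p≤J J≤j | stable q j q≤J J≤j | stable′ q j q≤J J≤j | stable′ r j r≤J J≤j =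
      small J (≤-trans (n≤1+n (suc J)) (≤-reflexive (sym B≡)))

  kCond⁺ : Par p → Par q → Par r → Interlace p q → Interlace q r → Lattice p q r → True (kCond p q r)
  kCond⁺ {p} {q} {r} π ρ σ i i′ f = allᵇ⁺ (λ j → kSw q r j ≤ᵇ kSw p q (j ∸ 1)) (upto1⁺ (length p + length q +
        length r + 2)
    λ { {suc j} _ _ → ≤⇒≤ᵇ (prefix⇒kSw j π ρ σ i i′ (f j)) })

  H⇒Interlace : Pads p a → Pads q b → H a b → Interlace p q
  H⇒Interlace π ρ (_ , h) =
    (λ j → subst₂ _≤_ (Pads-nth π j) (Pads-nth ρ j) (proj₁ (HS⇒nth h j)))
    , λ j → subst₂ _≤_ (Pads-nth ρ (suc j)) (Pads-nth π j) (proj₂ (HS⇒nth h j))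

  Interlace⇒H : Pads p a → Pads q b → length a ≡ length b → Interlace p q → H a b
  Interlace⇒H π ρ l (f , g) = _ , nth⇒HS l ≤-refl
    (λ j → subst₂ _≤_ (sym (Pads-nth π j)) (sym (Pads-nth ρ j)) (f j))
    (λ j → subst₂ _≤_ (sym (Pads-nth ρ (suc j))) (sym (Pads-nth π j)) (g j))

  Lat⇒Lattice : ∀ {e} → Pads p a → Pads q b → Pads r c → Lat 0 a b c e → Lattice p q r
  Lat⇒Lattice π ρ σ l j = subst₂ _≤_
    (cong₂ _+_ (Pads-prefix σ (suc j)) (Pads-prefix π j)) (cong₂ _+_ (Pads-prefix ρ (suc j)) (Pads-prefix ρ
          j)) (Lat⇒prefix l j)

  Lattice⇒Lat : Pads p a → Pads q b → Pads r c → length b ≡ length c → H a b → Lattice p q r → ∃[ e ] Lat 0 a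
        b c e
  Lattice⇒Lat π ρ σ l (_ , h) f = prefix⇒Lat 0 l h λ j → subst₂ _≤_
    (sym (cong₂ _+_ (Pads-prefix σ (suc j)) (Pads-prefix π j))) (sym (cong₂ _+_ (Pads-prefix ρ (suc j))
          (Pads-prefix ρ j))) (f j)

-- Valid sequences as chains of padded shapes.

module Sequences where
  open import Defs
  open LinearArithmetic
  open Strips
  open Chains
  open Counting
  open PieriRule
  open Finiteness
  open ProductRule
  open HiddenNames
  open SchurCoefficients
  open Codes
  open Moves

  private variable
    p q r as : List ℕ
    ps ds : List (List ℕ)

  Par-length : Par p → length p ≤ sum p
  Par-length [] = z≤n
  Par-length (cons _ q π) = +-mono-≤ q (Par-length π)

  Enum-partitionsOf : ∀ n → Enum (λ p → Par p × sum p ≡ n) (partitionsOf n)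
  Enum-partitionsOf n = Enum-⇔
    (λ {p} (_ , h) → let h₁ , h₂ = ∧⁻ {isPartition p} h in Par⁻ p h₁ , ≡ᵇ⇒≡ (sum p) n h₂)
    (λ {p} (π , eq) →
      (length p , (z≤n , s≤s (≤-trans (Par-length π) (≤-reflexive eq))) , refl
      , All.zipWith (λ (le , ge) → ge , s≤s (≤-trans le (≤-reflexive eq))) (sum-bounds p , Par-positive π))
      , ∧⁺ {isPartition p} (Par⁺ π) (≡⇒≡ᵇ (sum p) n eq))
    (Enum-filterᵇ (λ p → isPartition p ∧ (sum p ≡ᵇ n))
      (Enum-concatMap _ (Enum-rangeFrom 0 (suc n)) (λ {k} _ → Enum-listsOf (Enum-rangeFrom 1 n) k)
        λ (eq , _) (eq′ , _) → trans (sym eq) eq′))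

  data Sizes : ℕ → List ℕ → List (List ℕ) → Set where
    []   : ∀ {n} → Sizes n [] []
    cons : ∀ {n a} → Par p × sum p ≡ n + a → Sizes (n + a) as ps → Sizes n (a ∷ as) (p ∷ ps)

  Enum-extend : ∀ μ ν n as → Enum (Sizes n as) (extend μ ν n as)
  Enum-extend μ ν n [] = enum ([] ∷ []) (λ where (here refl) → []) (λ where [] → here refl)
  Enum-extend μ ν n (a ∷ as) = Enum-⇔
    (λ where (p , π , ps , ss , refl) → cons π ss)
    (λ where (cons π ss) → _ , π , _ , ss , refl)
    (Enum-concatMap _ (Enum-partitionsOf (n + a)) (λ {p} _ → Enum-map {f = p ∷_} ∷-injectiveʳ (Enum-extend μ
          ν (n + a) as))
      λ where (_ , _ , refl) (_ , _ , refl) → refl)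

  -- The condition involves three consecutive shapes, so the two preceding ones are carried along.
  -- The first step has no condition and is treated apart, in `Valid`.
  data Walk : List ℕ → List ℕ → List ℕ → List (List ℕ) → Set where
    []   : Walk p q [] []
    step : ∀ {a} → Par r → Interlace q r → sum q + a ≡ sum r → Lattice p q r → Walk q r as ps → Walk p q (a ∷
          as) (r ∷ ps)

  data Valid : List ℕ → List ℕ → List (List ℕ) → Set where
    []    : Valid p [] []
    start : ∀ {a} → Par q → Interlace p q → sum p + a ≡ sum q → Walk p q as ps → Valid p (a ∷ as) (q ∷ ps)

  Walk-Sizes : Walk p q as ps → Sizes (sum q) as ps
  Walk-Sizes [] = []
  Walk-Sizes {as = _ ∷ as} {_ ∷ ps} (step π _ eq _ w) = cons (π , sym eq) (subst (λ n → Sizes n as ps) (sym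
        eq) (Walk-Sizes w))

  Valid-Sizes : Valid p as ps → Sizes (sum p) as ps
  Valid-Sizes [] = []
  Valid-Sizes {as = _ ∷ as} {_ ∷ ps} (start π _ eq w) = cons (π , sym eq) (subst (λ n → Sizes n as ps) (sym
        eq) (Walk-Sizes w))

  eqList⁻ : ∀ p q → True (eqList p q) → p ≡ q
  eqList⁻ [] [] _ = refl
  eqList⁻ (x ∷ p) (y ∷ q) h = let h₁ , h₂ = ∧⁻ {x ≡ᵇ y} h in cong₂ _∷_ (≡ᵇ⇒≡ x y h₁) (eqList⁻ p q h₂)

  eqList⁺ : ∀ p → True (eqList p p)
  eqList⁺ [] = tt
  eqList⁺ (x ∷ p) = ∧⁺ {x ≡ᵇ x} (≡⇒≡ᵇ x x refl) (eqList⁺ p)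

  module _ {ν : List ℕ} (μ : List ℕ) where

    steps⁻ : ∀ i {n} → Par p → Par q → Interlace p q → (∀ j → nth as j ≡ rIdx (i + j) ν) → Sizes n as ps →
             True (steps μ ν p i q ps) → True (kconds μ ν p q ps) → Walk p q as ps
    steps⁻ i π ρ il f [] _ _ = []
    steps⁻ {p} {q} {a ∷ as} {r ∷ ps} i π ρ il f (cons (σ , _) ss) h k
      with _ , h₂ ← ∧⁻ {isPartition r} h
      with h₃ , h₄ ← ∧⁻ {validStep q r (rIdx i ν)} h₂
      with k₁ , k₂ ← ∧⁻ {kCond p q r} k
      with il′ , eq ← validStep⁻ (rIdx i ν) ρ σ h₃
      = step σ il′ (trans (cong (sum q +_) (trans (f 0) (cong (λ i → rIdx i ν) (+-identityʳ i)))) eq) (kCond⁻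
            π ρ σ il il′ k₁)
        (steps⁻ (suc i) ρ σ il′ (λ j → trans (f (suc j)) (cong (λ i → rIdx i ν) (+-suc i j))) ss h₄ k₂)

    steps⁺ : ∀ i → Par p → Par q → Interlace p q → (∀ j → nth as j ≡ rIdx (i + j) ν) → Walk p q as ps →
             True (steps μ ν p i q ps) × True (kconds μ ν p q ps)
    steps⁺ i π ρ il f [] = tt , tt
    steps⁺ {p} {q} {a ∷ as} {r ∷ ps} i π ρ il f (step σ il′ eq lat w)
      with h , k ← steps⁺ (suc i) ρ σ il′ (λ j → trans (f (suc j)) (cong (λ i → rIdx i ν) (+-suc i j))) w
      = ∧⁺ {isPartition r} (Par⁺ σ) (∧⁺ {validStep q r (rIdx i ν)} (validStep⁺ (rIdx i ν) ρ σ il′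
          (trans (cong (sum q +_) (sym (trans (f 0) (cong (λ i → rIdx i ν) (+-identityʳ i))))) eq)) h)
      , ∧⁺ {kCond p q r} (kCond⁺ π ρ σ il il′ lat) k

  Sizes-length : ∀ {n} → Sizes n as ps → length as ≡ length ps
  Sizes-length [] = refl
  Sizes-length (cons _ ss) = cong suc (Sizes-length ss)

  validSeq⁻ : ∀ μ ν ps → Par μ → Par ν → Sizes (sum μ) ν ps → True (validSeq μ ν (μ ∷ ps)) → Valid μ ν ps
  validSeq⁻ μ [] [] π ρ ss h = []
  validSeq⁻ μ (a ∷ ν) (q ∷ ps) π ρ (cons (σ , _) ss) h
    with _ , h₁ ← ∧⁻ {eqList μ μ} h
    with _ , h₂ ← ∧⁻ {suc (suc (length ps)) ≡ᵇ suc (u₁ (a ∷ ν))} h₁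
    with h₃ , k ← ∧⁻ {isPartition q ∧ validStep μ q (rIdx 1 (a ∷ ν)) ∧ steps μ (a ∷ ν) μ 2 q ps} h₂
    with _ , h₄ ← ∧⁻ {isPartition q} h₃
    with h₅ , h₆ ← ∧⁻ {validStep μ q (rIdx 1 (a ∷ ν))} h₄
    with il , eq ← validStep⁻ (rIdx 1 (a ∷ ν)) π σ h₅
    = start σ il (trans (cong (sum μ +_) (sym (rIdx-nth 0 ρ))) eq)
        (steps⁻ {ν = a ∷ ν} μ 2 π σ il (λ j → sym (rIdx-nth (suc j) ρ)) ss h₆ k)

  validSeq⁺ : ∀ μ ν ps → Par μ → Par ν → Valid μ ν ps → True (validSeq μ ν (μ ∷ ps))
  validSeq⁺ μ [] [] π ρ [] = ∧⁺ {eqList μ μ} (eqList⁺ μ) tt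
  validSeq⁺ μ (a ∷ ν) (q ∷ ps) π ρ (start σ il eq w)
    with h , k ← steps⁺ {ν = a ∷ ν} μ 2 π σ il (λ j → sym (rIdx-nth (suc j) ρ)) w
    = ∧⁺ {eqList μ μ} (eqList⁺ μ) (∧⁺ {suc (suc (length ps)) ≡ᵇ suc (u₁ (a ∷ ν))}
        (≡⇒≡ᵇ (suc (suc (length ps))) (suc (u₁ (a ∷ ν))) (cong suc (sym (trans (u₁-length ρ) (cong suc
              (Sizes-length (Walk-Sizes w)))))))
        (∧⁺ {isPartition q ∧ validStep μ q (rIdx 1 (a ∷ ν)) ∧ steps μ (a ∷ ν) μ 2 q ps}
          (∧⁺ {isPartition q} (Par⁺ σ) (∧⁺ {validStep μ q (rIdx 1 (a ∷ ν))}
            (validStep⁺ (rIdx 1 (a ∷ ν)) π σ il (trans (cong (sum μ +_) (rIdx-nth 0 ρ)) eq)) h)) k))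

  rIdx-list : ∀ i as p → (∀ j → nth as j ≡ rIdx (i + j) p) → map (λ i → rIdx i p) (rangeFrom i (length as)) ≡ as
  rIdx-list i [] p f = refl
  rIdx-list i (a ∷ as) p f = cong₂ _∷_ (sym (trans (f 0) (cong (λ i → rIdx i p) (+-identityʳ i))))
    (rIdx-list (suc i) as p (λ j → trans (f (suc j)) (cong (λ i → rIdx i p) (+-suc i j))))

  ValidSeq : List ℕ → List ℕ → List (List ℕ) → Set
  ValidSeq μ ν s = ∃[ ps ] s ≡ μ ∷ ps × Valid μ ν ps

  Enum-valid : ∀ μ ν → Par μ → Par ν → Enum (ValidSeq μ ν) (filterᵇ (validSeq μ ν) (candidates μ ν))
  Enum-valid μ ν π ρ = Enum-⇔
    (λ where ((ps , ss , refl) , h) → ps , refl , validSeq⁻ μ ν ps π ρ ss h)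
    (λ where (ps , refl , v) → (ps , Valid-Sizes v , refl) , validSeq⁺ μ ν ps π ρ v)
    (Enum-filterᵇ (validSeq μ ν) (subst (Enum _) (sym eq) (Enum-map {f = μ ∷_} ∷-injectiveʳ (Enum-extend μ ν
          (sum μ) ν))))
    where
    eq : candidates μ ν ≡ map (μ ∷_) (extend μ ν (sum μ) ν)
    eq = trans (candidates-extend μ ν) (cong (map (μ ∷_) ∘ extend μ ν (sum μ))
      (trans (cong (λ n → map (λ i → rIdx i ν) (upto1 n)) (u₁-length ρ)) (rIdx-list 1 ν ν (λ j → sym
            (rIdx-nth j ρ)))))

  Pads-exists : ∀ n → length p ≤ n → ∃[ c ] Pads p c × length c ≡ n
  Pads-exists {p} n le = p ++ zeros (n ∸ length p) , (_ , refl)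
    , trans (length-++ p) (trans (cong (length p +_) (length-replicate (n ∸ length p))) (m+[n∸m]≡n le))

  -- The upper shape of a horizontal strip is weakly decreasing, so its zeros form a tail that can
  -- be cut off.
  unpad : ∀ {u} → HS u a b → ∃[ p ] Par p × Pads p b
  unpad [] = [] , [] , 0 , refl
  unpad (cons {l = zero} z≤n _ h) = [] , [] , _ , cong (0 ∷_) (zeros-unique (HS-zero h))
  unpad (cons {l = suc l} p _ h) with t , π , ρ@(k , eq) ← unpad h =
    suc l ∷ t , cons (≤-trans (≤-reflexive (sym (Pads-nth ρ 0))) (≤-trans (bounded h) p)) (s≤s z≤n) π , k ,
          cong (suc l ∷_) eq
    where
    bounded : ∀ {u a b} → HS u a b → nth b 0 ≤ u
    bounded [] = z≤n
    bounded (cons _ q _) = q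

  Pads-functional : Pads p c → Pads p b → length c ≡ length b → c ≡ b
  Pads-functional {p} (k , refl) (k′ , refl) l = cong (λ k → p ++ zeros k)
    (+-cancelˡ-≡ (length p) k k′ (trans (sym (len k)) (trans l (len k′))))
    where
    len : ∀ k → length (p ++ zeros k) ≡ length p + k
    len k = trans (length-++ p) (cong (length p +_) (length-replicate k))

  Pads-injective : Par p → Par q → Pads p c → Pads q c → p ≡ q
  Pads-injective [] [] _ _ = refl
  Pads-injective [] (cons _ (s≤s _) _) (suc k , ()) (k′ , refl)
  Pads-injective (cons _ (s≤s _) _) [] (k , refl) (suc k′ , ())
  Pads-injective (cons _ _ π) (cons _ _ ρ) (k , refl) (k′ , eq) with refl , eq′ ← ∷-injective eq =
    cong (_ ∷_) (Pads-injective π ρ (k , refl) (k′ , eq′))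

  module _ (μ : List ℕ) where

    -- A partition has no more parts than boxes, so a length `n` that bounds the final size
    -- accommodates every shape on the way. Chains begin with the last shape, which is why the new
    -- ones are stacked in reverse order.
    Walk⇒LR : ∀ n → Walk p q as ps → Pads p a → Pads q b → length a ≡ n → length b ≡ n → sum q + sum as ≤ n →
          LR μ ws (b ∷ a ∷ C) →
              ∃[ ds ] Pointwise Pads ps ds × All (λ d → length d ≡ n) ds × LR μ (as ʳ++ ws) (ds ʳ++ (b ∷ a ∷ C))
    Walk⇒LR n [] _ _ _ _ _ l = [] , [] , [] , l
    Walk⇒LR {q = q} {b = b} n (step {r = r} {as = as} {a = x} σ il eq lat w) π ρ la lb le l
      with le′ ← (sum r + sum as ≤ n) ∋ ≤-trans (≤-reflexive (trans (cong (_+ sum as) (sym eq)) (+-assoc (sum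
            q) x (sum as)))) le
      with d , τ , ld ← Pads-exists {r} n (≤-trans (Par-length σ) (≤-trans (m≤m+n (sum r) (sum as)) le′))
      with pop _ h _ ← LR-pop l
      with h′ ← Interlace⇒H ρ τ (trans lb (sym ld)) il
      with ds , πs , ls , l′ ← Walk⇒LR n w ρ τ lb ld le′
             (more l h′ (proj₂ (Lattice⇒Lat π ρ τ (trans lb (sym ld)) h lat)) (trans (cong (_+ x) (Pads-sum
                   ρ)) (trans eq (sym (Pads-sum τ)))))
      = d ∷ ds , τ ∷ πs , ld ∷ ls , l′

    -- Sequences are read from their first step, which lies deepest in a chain; the later steps have
    -- to be peeled off to reach it.
    LR-drop : ∀ as ds → length as ≡ length ds → LR μ (as ʳ++ (x ∷ ws)) (ds ʳ++ (c ∷ b ∷ C)) → LR μ (x ∷ ws)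
          (c ∷ b ∷ C)
    LR-drop [] [] _ l = l
    LR-drop (a ∷ as) (d ∷ ds) eq l with more l′ _ _ _ ← LR-drop as ds (suc-injective eq) l = l′

    LR⇒Walk : ∀ as ds → length as ≡ length ds → Pads p a → Pads q b → LR μ (as ʳ++ (x ∷ ws)) (ds ʳ++ (b ∷ a ∷
          C)) →
              ∃[ ps ] Pointwise Pads ps ds × Walk p q as ps
    LR⇒Walk [] [] _ _ _ _ = [] , [] , []
    LR⇒Walk {q = q} (y ∷ as) (d ∷ ds) eq π ρ l
      with more l′ h lat e ← LR-drop as ds (suc-injective eq) l
      with r , σ , τ ← unpad (proj₂ h)
      with ps , πs , w ← LR⇒Walk as ds (suc-injective eq) ρ τ l
      = r ∷ ps , τ ∷ πs , step σ (H⇒Interlace ρ τ h)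
          (trans (cong (_+ y) (sym (Pads-sum ρ))) (trans e (Pads-sum τ))) (Lat⇒Lattice π ρ τ lat) w

  last-Pads : ∀ ps ds → Pointwise Pads ps ds → Pads p c → Pads (lastOr p ps) (hd (ds ʳ++ (c ∷ C)))
  last-Pads [] [] [] π = π
  last-Pads (_ ∷ ps) (_ ∷ ds) (ρ ∷ πs) π = last-Pads ps ds πs ρ

  LR-lengths : LR μ ws C → All (λ d → length d ≡ length μ) C
  LR-lengths l = All.map proj₁ (proj₂ (LR-boxes l))

-- The expansion of the product, coefficient by coefficient.

module Expansion where
  open import Defs
  open LinearArithmetic
  open Strips
  open Chains
  open Counting
  open PieriRule
  open Finiteness
  open ProductRule
  open SchurCoefficients
  open Codes
  open Moves
  open Sequences

  private variable
    p q r as : List ℕ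
    ps ds es : List (List ℕ)
    n : ℕ

  Pads-length : Pads p c → length c ≡ n → c ≡ p ++ zeros (n ∸ length p)
  Pads-length {p} (k , refl) refl = cong (λ k → p ++ zeros k) (sym (trans (cong (_∸ length p) len) (m+n∸m≡n
        (length p) k)))
    where
    len : length (p ++ zeros k) ≡ length p + k
    len = trans (length-++ p) (cong (length p +_) (length-replicate k))

  hd-length : LR μ ws C → length (hd C) ≡ length μ
  hd-length {C = _ ∷ _} l = LR-length l

  Padded : ℕ → List (List ℕ) → List (List ℕ) → Set
  Padded n ps ds = Pointwise Pads ps ds × All (λ d → length d ≡ n) ds

  Padded-functional : Padded n ps ds → Padded n ps es → ds ≡ es
  Padded-functional ([] , _) ([] , _) = refl
  Padded-functional (π ∷ πs , l ∷ ls) (ρ ∷ ρs , k ∷ ks) =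
    cong₂ _∷_ (Pads-functional π ρ (trans l (sym k))) (Padded-functional (πs , ls) (ρs , ks))

  Padded-injective : All Par ps → All Par es → Pointwise Pads ps ds → Pointwise Pads es ds → ps ≡ es
  Padded-injective [] [] [] [] = refl
  Padded-injective (p ∷ ps) (q ∷ qs) (π ∷ πs) (ρ ∷ ρs) = cong₂ _∷_ (Pads-injective p q π ρ) (Padded-injective
        ps qs πs ρs)

  Walk-Par : Walk p q as ps → All Par ps
  Walk-Par [] = []
  Walk-Par (step π _ _ _ w) = π ∷ Walk-Par w

  Valid-Par : Valid p as ps → All Par ps
  Valid-Par [] = []
  Valid-Par (start π _ _ w) = π ∷ Walk-Par w

  head≤′ : List ℕ → List ℕ → Set
  head≤′ p [] = ⊤
  head≤′ p (w ∷ _) = nth p 0 ≤ w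

  Par-Decr : Par p → Decr ws → head≤′ p ws → Decr (p ʳ++ ws)
  Par-Decr [] d _ = d
  Par-Decr (cons le _ π) [] _ = Par-Decr π (_ ∷ last) le
  Par-Decr (cons le _ π) (w ∷ r) q = Par-Decr π (_ ∷ cons q ≤-refl r) le

  module _ {μ ν : List ℕ} (π : Par μ) (ρ : Par ν) (m : ℕ) where
    private
      -- The first two summands leave room for every shape of size at most |μ| + |ν|, and `m`
      -- provides a row for each variable.
      k = sum μ + sum ν + m
      M = μ ++ zeros k
      N = length M

      ∣M∣ : N ≡ length μ + k
      ∣M∣ = trans (length-++ μ) (cong (length μ +_) (length-replicate k))

      fits : sum μ + sum ν ≤ N
      fits = ≤-trans (≤-trans (m≤m+n _ m) (m≤n+m k (length μ))) (≤-reflexive (sym ∣M∣))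

      padμ : Pads μ M
      padμ = k , refl

    pad : List ℕ → List ℕ
    pad p = p ++ zeros (N ∸ length p)

    Valid⇒LR : ∀ {as ps} → sum μ + sum as ≤ N → Valid μ as ps → ∃[ ds ] Padded N ps ds × LR M (reverse as)
          (reverse (M ∷ ds))
    Valid⇒LR _ [] = [] , ([] , []) , none
    Valid⇒LR le (start {q = q} {as = as} {a = a} σ il eq w)
      with le′ ← (sum q + sum as ≤ N) ∋ (≤-by (le ⊕ ≤-reflexive (sym eq)) (lin 5 (λ x₁ x₂ x₃ N a → x₂ :+ x₁
            :+ (N :+ (x₃ :+ a)) := N :+ (x₃ :+ (a :+ x₁) :+ x₂)) refl (sum as) (sum q) (sum μ) N a))
      with d , τ , l ← Pads-exists {q} N (≤-trans (Par-length σ) (≤-trans (m≤m+n (sum q) (sum as)) le′))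
      with ds , πs , ls , lr ← Walk⇒LR M N w padμ τ refl l le′
             (one (Interlace⇒H padμ τ (sym l) il) (trans (cong (_+ a) (Pads-sum padμ)) (trans eq (sym
                   (Pads-sum τ)))))
      = d ∷ ds , (τ ∷ πs , l ∷ ls) , lr

    LR⇒Valid : ∀ as ds → length ds ≡ suc (length as) → LR M (reverse as) (reverse ds) →
               ∃[ ps ] Pointwise Pads (μ ∷ ps) ds × Valid μ as ps
    LR⇒Valid [] (d ∷ []) _ none = [] , padμ ∷ [] , []
    LR⇒Valid (a ∷ as) (d ∷ d′ ∷ ds) eq l
      with one h e ← LR-drop M as ds (suc-injective (suc-injective (sym eq))) l
      with q , σ , τ ← unpad (proj₂ h)
      with ps , πs , w ← LR⇒Walk M as ds (suc-injective (suc-injective (sym eq))) padμ τ l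
      = q ∷ ps , padμ ∷ τ ∷ πs
      , start σ (H⇒Interlace padμ τ h) (trans (cong (_+ a) (sym (Pads-sum padμ))) (trans e (Pads-sum τ))) w

    private
      hd-pad : ∀ {ws ps D} → Pointwise Pads (μ ∷ ps) D → LR M ws (reverse D) → hd (reverse D) ≡ pad (lastOr μ
            ps)
      hd-pad {ps = ps} {_ ∷ ds} (τ ∷ πs) l = Pads-length (last-Pads ps ds πs τ) (hd-length l)

    Valid-LRS : ∀ γ → Bij (λ (s , T) → ValidSeq μ ν s × S (pad (lastOr μ s)) γ T) (LRS M (reverse ν) γ)
    Valid-LRS γ = record { R = Rel ; to = to′ ; from = from′ ; functional = functional′ ; injective =
          injective′ }
      where
      Left : List (List ℕ) × GT → Set
      Left (s , T) = ValidSeq μ ν s × S (pad (lastOr μ s)) γ T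
      Rel : List (List ℕ) × GT → List (List ℕ) × GT → Set
      Rel (s , T) (C , T′) = (∃[ ds ] Padded N s ds × C ≡ reverse ds) × T ≡ T′
      to′ : ∀ {x} → Left x → ∃[ y ] LRS M (reverse ν) γ y × Rel x y
      to′ ((ps , refl , v) , s) with ds , (πs , ls) , l ← Valid⇒LR fits v =
        _ , (l , subst (λ c → S c γ _) (sym (hd-pad (padμ ∷ πs) l)) s) , (M ∷ ds , (padμ ∷ πs , refl ∷ ls) ,
              refl) , refl
      from′ : ∀ {y} → LRS M (reverse ν) γ y → ∃[ x ] Left x × Rel x y
      from′ {C , T} (l , s)
        with l′ ← subst (LR M (reverse ν)) (sym (reverse-involutive C)) l
        with ps , πs , v ← LR⇒Valid ν (reverse C) (trans (length-reverse C) (trans (proj₁ (LR-boxes l)) (cong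
              suc (length-reverse ν)))) l′
        = (μ ∷ ps , T)
        , ((ps , refl , v) , subst (λ c → S c γ T) (trans (cong hd (sym (reverse-involutive C))) (hd-pad πs
              l′)) s)
        , (reverse C , (πs , All-reverse (LR-lengths l)) , sym (reverse-involutive C)) , refl
      functional′ : ∀ {x y y′} → Left x → LRS M (reverse ν) γ y → LRS M (reverse ν) γ y′ → Rel x y → Rel x y′
            → y ≡ y′
      functional′ _ _ _ ((ds , pd , refl) , refl) ((es , pe , refl) , refl) with refl ← Padded-functional pd
            pe = refl
      injective′ : ∀ {x x′ y} → Left x → Left x′ → LRS M (reverse ν) γ y → Rel x y → Rel x′ y → x ≡ x′
      injective′ ((ps , refl , v) , _) ((ps′ , refl , v′) , _) _ ((ds , (pd , _) , eq) , refl) ((es , (pe ,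
            _) , eq′) , refl)
        with refl ← reverse-injective {x = ds} {y = es} (trans (sym eq) eq′)
        with refl ← Padded-injective (π ∷ Valid-Par v) (π ∷ Valid-Par v′) pd pe = refl

  -- The monomial has as many variables as `α` has entries. Padding brings both factors to at least
  -- that many rows, as `LR-rule` demands, without changing a coefficient.
  product-expansion : ∀ {μ ν} → Par μ → Par ν → ∀ α →
    schurProdCoeff μ ν α ≡ sum (map (λ s → schurCoeff (lastOr μ s) α) (filterᵇ (validSeq μ ν) (candidates μ ν)))
  product-expansion {μ} {ν} π ρ α = LR-rule (length ν) m (reverse ν) M rα (length-reverse ν) decr le le′
    (subst (λ ƛ → Card (Conv M ƛ rα) (schurProdCoeff μ ν α)) shape-ν (Conv-card μ (sum μ + sum ν + m) ν m α))
    (Card-Bij (Valid-LRS π ρ m rα) (Card-Σ (Enum-valid μ ν π ρ) λ {s} _ → S-card (lastOr μ s) _ α))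
    where
    m = length α
    M = μ ++ zeros (sum μ + sum ν + m)
    rα = reverse α
    shape-ν : ν ++ zeros m ≡ shape (reverse ν) m
    shape-ν = sym (trans (ʳ++-defn (reverse ν)) (cong (_++ zeros m) (reverse-involutive ν)))
    le : length rα ≤ length ν + m
    le = ≤-trans (≤-reflexive (length-reverse α)) (m≤n+m m (length ν))
    le′ : length rα ≤ length M
    le′ = ≤-trans (≤-reflexive (length-reverse α)) (≤-trans (≤-trans (m≤n+m m (sum μ + sum ν)) (m≤n+m _
          (length μ)))
      (≤-reflexive (sym (trans (length-++ μ) (cong (length μ +_) (length-replicate _))))))
    decr : Decr (reverse ν)
    decr = Par-Decr ρ [] tt

-- Linear independence of Schur functions by dominance.

module Independence where
  open import Defs
  open LinearArithmetic
  open Strips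
  open Chains
  open Counting
  open PieriRule
  open Finiteness
  open ProductRule
  open SchurCoefficients
  open Codes
  open Moves
  open Sequences
  open Expansion

  private variable
    p q as : List ℕ
    ps : List (List ℕ)

  Walk-last : Par q → Walk p q as ps → Par (lastOr q ps) × sum (lastOr q ps) ≡ sum q + sum as
  Walk-last {q} π [] = π , sym (+-identityʳ (sum q))
  Walk-last {q} π (step {as = as} {a = a} σ _ eq _ w) with ρ , e ← Walk-last σ w =
    ρ , trans e (trans (cong (_+ sum as) (sym eq)) (+-assoc (sum q) a (sum as)))

  Valid-last : Par p → Valid p as ps → Par (lastOr p ps) × sum (lastOr p ps) ≡ sum p + sum as
  Valid-last {p} π [] = π , sym (+-identityʳ (sum p))
  Valid-last {p} π (start {as = as} {a = a} σ _ eq w) with ρ , e ← Walk-last σ w =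
    ρ , trans e (trans (cong (_+ sum as) (sym eq)) (+-assoc (sum p) a (sum as)))

  indicator : Bool → ℕ
  indicator b = if b then 1 else 0

  eqList-≢ : ∀ p q → p ≢ q → eqList p q ≡ false
  eqList-≢ p q p≢q with eqList p q | eqList⁻ p q
  ... | true  | f = ⊥-elim (p≢q (f tt))
  ... | false | _ = refl

  eqList-refl : ∀ p → eqList p p ≡ true
  eqList-refl p with eqList p p | eqList⁺ p
  ... | true | _ = refl

  sum-map-+ : ∀ {A : Set} (f g : A → ℕ) xs → sum (map (λ x → f x + g x) xs) ≡ sum (map f xs) + sum (map g xs)
  sum-map-+ f g [] = refl
  sum-map-+ f g (x ∷ xs) = (≡-by (sum-map-+ f g xs) (lin 5 (λ x₁ x₂ x₃ x₄ x₅ → x₁ :+ x₂ :+ x₃ :+ (x₄ :+ x₅)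
        := x₁ :+ x₄ :+ (x₂ :+ x₅) :+ x₃) refl (f x) (g x) (sum (map (λ x → f x + g x) xs)) (sum (map f xs))
        (sum (map g xs))))

  sum-map-≗ : ∀ {A : Set} {f g : A → ℕ} xs → (∀ x → f x ≡ g x) → sum (map f xs) ≡ sum (map g xs)
  sum-map-≗ xs eq = cong sum (map-cong eq xs)

  sum-map-0 : ∀ {A : Set} (xs : List A) → sum (map (λ _ → 0) xs) ≡ 0
  sum-map-0 [] = refl
  sum-map-0 (_ ∷ xs) = sum-map-0 xs

  select : ∀ (f : List ℕ → ℕ) {xs} → Unique xs → q ∈ xs → sum (map (λ p → indicator (eqList q p) * f p) xs) ≡
        f q
  select {q} f {_ ∷ xs} (q∉ ∷ _) (here refl) rewrite eqList-refl q = trans (cong₂ _+_ (+-identityʳ (f q))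
        (others xs q∉)) (+-identityʳ (f q))
    where
    others : ∀ xs → All (q ≢_) xs → sum (map (λ p → indicator (eqList q p) * f p) xs) ≡ 0
    others [] [] = refl
    others (p ∷ xs) (q≢p ∷ ne) rewrite eqList-≢ q p q≢p = others xs ne
  select {q} f (_∷_ {x = p} p∉ uq) (there q∈) rewrite eqList-≢ q p (λ where refl → All.lookup p∉ q∈ refl) = select f uq q∈

  -- Each `v` is counted in exactly one term on the right, because `xs` contains `l v` and has no
  -- repetitions.
  regroup : ∀ {A : Set} (l : A → List ℕ) (f : List ℕ → ℕ) {xs} → Unique xs → ∀ vs → (∀ {v} → v ∈ vs → l v ∈
        xs) →
            sum (map (f ∘ l) vs) ≡ sum (map (λ p → length (filterᵇ (λ v → eqList (l v) p) vs) * f p) xs)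
  regroup l f {xs} uq [] _ = sym (sum-map-0 xs)
  regroup l f {xs} uq (v ∷ vs) l∈ = begin
    f (l v) + sum (map (f ∘ l) vs)                                                        ≡⟨ cong₂ _+_ (sym
          (select f uq (l∈ (here refl)))) (regroup l f uq vs (l∈ ∘ there)) ⟩
    sum (map (λ p → ι p * f p) xs) + sum (map (λ p → N vs p * f p) xs)                    ≡⟨ sum-map-+ (λ p →
          ι p * f p) (λ p → N vs p * f p) xs ⟨
    sum (map (λ p → ι p * f p + N vs p * f p) xs)                                         ≡⟨ sum-map-≗ xs (λ
          p → trans (sym (*-distribʳ-+ (f p) (ι p) (N vs p))) (cong (_* f p) (sym (N-∷ p)))) ⟩
    sum (map (λ p → N (v ∷ vs) p * f p) xs)                                               ∎
    where
    open ≡-Reasoning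
    ι = λ p → indicator (eqList (l v) p)
    N = λ vs p → length (filterᵇ (λ v → eqList (l v) p) vs)
    N-∷ : ∀ p → N (v ∷ vs) p ≡ ι p + N vs p
    N-∷ p with eqList (l v) p
    ... | true = refl
    ... | false = refl

  filterᵇ-∧ : ∀ {A : Set} (p q : A → Bool) xs → filterᵇ (λ x → p x ∧ q x) xs ≡ filterᵇ q (filterᵇ p xs)
  filterᵇ-∧ p q [] = refl
  filterᵇ-∧ p q (x ∷ xs) with p x
  ... | false = filterᵇ-∧ p q xs
  ... | true with q x
  ... | true = cong (x ∷_) (filterᵇ-∧ p q xs)
  ... | false = filterᵇ-∧ p q xs

  prefix-≤-sum : ∀ p j → prefix p j ≤ sum p
  prefix-≤-sum p zero = z≤n
  prefix-≤-sum [] (suc j) = z≤n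
  prefix-≤-sum (x ∷ p) (suc j) = +-monoʳ-≤ x (prefix-≤-sum p j)

  prefix-mono : ∀ {u} → HS u a b → ∀ j → prefix a j ≤ prefix b j
  prefix-mono h zero = z≤n
  prefix-mono [] (suc j) = z≤n
  prefix-mono (cons p _ h) (suc j) = +-mono-≤ p (prefix-mono h j)

  prefix-∷ʳ : ∀ p x j → j ≤ length p → prefix (p ∷ʳ x) j ≡ prefix p j
  prefix-∷ʳ p x zero _ = refl
  prefix-∷ʳ (y ∷ p) x (suc j) (s≤s le) = cong (y +_) (prefix-∷ʳ p x j le)

  sum-reverse : ∀ p → sum (reverse p) ≡ sum p
  sum-reverse p = trans (sum-ʳ++ p []) (+-identityʳ (sum p))

  Tail0-prefix : ∀ k j → Tail0 k ƛ → k ≤ j → prefix ƛ j ≡ sum ƛ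
  Tail0-prefix {[]} k zero _ _ = refl
  Tail0-prefix {[]} k (suc j) _ _ = refl
  Tail0-prefix {_ ∷ ƛ} zero zero (refl ∷ zs) _ = Tail0-prefix {ƛ} zero zero zs z≤n
  Tail0-prefix {_ ∷ ƛ} zero (suc j) (refl ∷ zs) _ = Tail0-prefix {ƛ} zero j zs z≤n
  Tail0-prefix {x ∷ ƛ} (suc k) (suc j) t (s≤s le) = cong (x +_) (Tail0-prefix {ƛ} k j t le)

  -- Removing the largest letter shrinks the shape and leaves the earlier exponents alone. When `j`
  -- exceeds the number of remaining letters, all boxes lie in the first `j` rows and both sides are
  -- compared with the total.
  S-dominates : S ƛ γ T → ∀ j → prefix (reverse γ) j ≤ prefix ƛ j
  S-dominates (done _) zero = z≤n
  S-dominates (done _) (suc j) = z≤n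
  S-dominates {ƛ} {x ∷ γ} s@(step (_ , h) _ s′) j with j ≤? length γ
  ... | yes le = begin
    prefix (reverse (x ∷ γ)) j  ≡⟨ cong (λ p → prefix p j) (unfold-reverse x γ) ⟩
    prefix (reverse γ ∷ʳ x) j   ≡⟨ prefix-∷ʳ (reverse γ) x j (≤-trans le (≤-reflexive (sym (length-reverse
          γ)))) ⟩
    prefix (reverse γ) j        ≤⟨ S-dominates s′ j ⟩
    prefix _ j                  ≤⟨ prefix-mono h j ⟩
    prefix ƛ j                  ∎
    where open ≤-Reasoning
  ... | no ≰ = begin
    prefix (reverse (x ∷ γ)) j  ≤⟨ prefix-≤-sum (reverse (x ∷ γ)) j ⟩
    sum (reverse (x ∷ γ))       ≡⟨ sum-reverse (x ∷ γ) ⟩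
    sum (x ∷ γ)                 ≡⟨ S-sum s ⟨
    sum ƛ                       ≡⟨ Tail0-prefix {ƛ} (suc (length γ)) j (S-Tail0 s) (≰⇒> ≰) ⟨
    prefix ƛ j                  ∎
    where open ≤-Reasoning

  -- The tableau whose row `j` consists of letters `j`: its pattern arises by dropping the last part
  -- again and again.
  S-highest : ∀ k → Decr ws → ∃[ T ] S (shape ws k) ws T
  S-highest k [] = _ , done (All-zeros k)
  S-highest {x ∷ ws} k (x ∷ r) with _ , s ← S-highest (suc k) (Decr-tail r) =
    _ , step (RS⇒H k r) (trans (cong (_+ x) (sum-shape ws (suc k))) (trans (+-comm (sum ws) x) (sym
          (sum-shape (x ∷ ws) k)))) s

  -- Strictly increasing in the dominance order.
  rank : ℕ → List ℕ → ℕ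
  rank zero p = 0
  rank (suc m) p = prefix p m + rank m p

  rank-mono : ∀ m → (∀ j → prefix p j ≤ prefix q j) → rank m p ≤ rank m q
  rank-mono zero f = z≤n
  rank-mono (suc m) f = +-mono-≤ (f m) (rank-mono m f)

  rank-injective : ∀ m → (∀ j → prefix p j ≤ prefix q j) → rank m q ≤ rank m p → ∀ {j} → j < m → prefix p j ≡
        prefix q j
  rank-injective {p} {q} (suc m) f le {j} (s≤s j≤m) with j ≟ m
  ... | yes refl = (≤-antisym (≤-by (f m) (lin 2 (λ x₁ x₂ → x₁ :+ x₂ := x₂ :+ x₁) refl (prefix p m) (prefix q
        m))) (≤-by ((rank-mono m f) ⊕ le) (lin 4 (λ x₁ x₂ x₃ x₄ → x₂ :+ (x₄ :+ (x₁ :+ x₃)) := x₁ :+ (x₃ :+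
        (x₂ :+ x₄))) refl (prefix p m) (prefix q m) (rank m p) (rank m q))))
  ... | no j≢m = rank-injective m f (≤-by ((f m) ⊕ le) (lin 4 (λ x₁ x₂ x₃ x₄ → x₄ :+ (x₂ :+ (x₁ :+ x₃)) := x₃
        :+ (x₁ :+ (x₂ :+ x₄))) refl (prefix p m) (prefix q m) (rank m p) (rank m q))) (≤∧≢⇒< j≤m j≢m)

  rank-bound : ∀ m p → rank m p ≤ m * sum p
  rank-bound zero p = z≤n
  rank-bound (suc m) p = +-mono-≤ (prefix-≤-sum p m) (rank-bound m p)

  nth-ext : Par p → Par q → (∀ j → nth p j ≡ nth q j) → p ≡ q
  nth-ext [] [] f = refl
  nth-ext [] (cons _ (s≤s _) _) f with () ← f 0
  nth-ext (cons _ (s≤s _) _) [] f with () ← f 0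
  nth-ext (cons _ _ π) (cons _ _ ρ) f = cong₂ _∷_ (f 0) (nth-ext π ρ (f ∘ suc))

  prefix-ext : ∀ n → Par p → Par q → sum p ≡ n → sum q ≡ n → (∀ {j} → j < suc n → prefix p j ≡ prefix q j) →
        p ≡ q
  prefix-ext {p} {q} n π ρ e e′ f = nth-ext π ρ nths
    where
    nths : ∀ j → nth p j ≡ nth q j
    nths j with n ≤? j
    ... | yes le = trans (nth-≥ p j (≤-trans (Par-length π) (≤-trans (≤-reflexive e) le))) (sym (nth-≥ q j
          (≤-trans (Par-length ρ) (≤-trans (≤-reflexive e′) le))))
    ... | no ≰ = +-cancelˡ-≡ (prefix p j) _ _ (trans (sym (prefix-suc p j)) (trans (f (s≤s (≰⇒> ≰)))
                   (trans (prefix-suc q j) (cong (_+ nth q j) (sym (f (m≤n⇒m≤1+n (≰⇒> ≰))))))))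

  Card-witness : ∀ {A : Set} {P : A → Set} {n} → Card P n → n ≢ 0 → ∃[ x ] P x
  Card-witness ([] , _ , refl) n≢0 = ⊥-elim (n≢0 refl)
  Card-witness (x ∷ _ , E , _) _ = x , sound E (here refl)

  Card-nonzero : ∀ {A : Set} {P : A → Set} {n x} → Card P n → P x → 1 ≤ n
  Card-nonzero ([] , E , _) Px with () ← complete E Px
  Card-nonzero (_ ∷ _ , _ , refl) _ = s≤s z≤n

  schurCoeff-diagonal : Par p → 1 ≤ schurCoeff p p
  schurCoeff-diagonal {p} π with T , s ← S-highest 0 (Par-Decr π [] tt) =
    Card-nonzero (S-card p 0 p) (subst (λ ƛ → S ƛ (reverse p) T) eq s)
    where
    eq : shape (reverse p) 0 ≡ p ++ zeros 0
    eq = trans (ʳ++-defn (reverse p)) (cong (_++ []) (reverse-involutive p))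

  schurCoeff-dominates : ∀ p q → schurCoeff p q ≢ 0 → ∀ j → prefix q j ≤ prefix p j
  schurCoeff-dominates p q ≢0 j with _ , s ← Card-witness (S-card p 0 q) ≢0 =
    subst₂ _≤_ (cong (λ q → prefix q j) (reverse-involutive q)) (Pads-prefix {p = p} (0 , refl) j)
          (S-dominates s j)

  -- Compare the coefficients of the monomial `q`. A shape `p` other than `q` that contributes
  -- dominates `q` and has larger rank, so its two terms agree by induction and cancel; the
  -- coefficient left over is positive.
  schur-independent : ∀ n (f g : List ℕ → ℕ) →
    (∀ α → sum (map (λ p → f p * schurCoeff p α) (partitionsOf n)) ≡ sum (map (λ p → g p * schurCoeff p α)
          (partitionsOf n))) →
    ∀ q → Par q → sum q ≡ n → f q ≡ g q
  -- No rank exceeds `suc n * n`, so this is enough fuel for an induction from high rank to low. The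
  -- rank uses the partial sums up to `n`, which determine a partition of `n`.
  schur-independent n f g eq q π e = go (suc n * n) q π e (m≤n+m (suc n * n) (rank (suc n) q))
    where
    go : ∀ d q → Par q → sum q ≡ n → suc n * n ≤ rank (suc n) q + d → f q ≡ g q
    higher : ∀ d q → suc n * n ≤ rank (suc n) q + d → ∀ p → Par p → sum p ≡ n → rank (suc n) q < rank (suc n)
          p → f p ≡ g p
    higher zero q le p ρ e′ lt = ⊥-elim (<⇒≱ lt (≤-trans (rank-bound (suc n) p) (≤-trans (≤-reflexive (cong
          (suc n *_) e′)) (≤-trans le (≤-reflexive (+-identityʳ _))))))
    higher (suc d) q le p ρ e′ lt = go d p ρ e′ (≤-trans le (≤-trans (≤-reflexive (+-suc (rank (suc n) q) d))
          (+-monoˡ-≤ d lt)))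
    go d q π e le = *-cancelʳ-≡ (f q) (g q) (schurCoeff q q) {{>-nonZero (schurCoeff-diagonal π)}}
      (sum-cancel (unique E) (complete E (π , e)) (eq q) other)
      where
      E = Enum-partitionsOf n
      other : ∀ {p} → p ∈ partitionsOf n → p ≢ q → f p * schurCoeff p q ≡ g p * schurCoeff p q
      other {p} p∈ p≢q with schurCoeff p q ≟ 0
      ... | yes z = trans (cong (f p *_) z) (trans (*-zeroʳ (f p)) (sym (trans (cong (g p *_) z) (*-zeroʳ (g
            p)))))
      ... | no ≢0 with ρ , e′ ← sound E p∈ = cong (_* schurCoeff p q) (higher d q le p ρ e′ (≰⇒> λ ge →
              p≢q (sym (prefix-ext n π ρ e e′ (rank-injective (suc n) (schurCoeff-dominates p q ≢0) ge)))))

-- Collecting the expansion by last shape.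

open import Defs
open import Data.Bool using (T)
open Counting
open SchurCoefficients
open Codes
open Sequences
open Expansion
open Independence

theorem5p1 : (μ ν : List ℕ) → T (isPartition μ) → T (isPartition ν) →
    -- s_μ s_ν = Σ_{valid sequences (μ⁰,…,μ^l)} s_{μ^l}, coefficientwise on every monomial x^α
    ((α : List ℕ) →
      schurProdCoeff μ ν α
        ≡ sum (map (λ s → schurCoeff (lastOr μ s) α) (filterᵇ (validSeq μ ν) (candidates μ ν))))
    ×
    -- in particular, if s_μ s_ν = Σ_λ c_λ s_λ then c_λ = #{valid sequences with μ^l = λ}
    ((c : List ℕ → ℕ) →
      ((α : List ℕ) →
        schurProdCoeff μ ν α ≡ sum (map (λ la → c la * schurCoeff la α) (partitionsOf (size μ + size ν)))) →
      (la : List ℕ) → T (isPartition la) → size la ≡ size μ + size ν →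
      c la ≡ length (filterᵇ (λ s → validSeq μ ν s ∧ eqList (lastOr μ s) la) (candidates μ ν)))
theorem5p1 μ ν hμ hν = expansion , coefficients
  where
  π = Par⁻ μ hμ
  ρ = Par⁻ ν hν
  n = size μ + size ν
  V = filterᵇ (validSeq μ ν) (candidates μ ν)
  N : List ℕ → ℕ
  N la = length (filterᵇ (λ s → eqList (lastOr μ s) la) V)
  expansion : ∀ α → schurProdCoeff μ ν α ≡ sum (map (λ s → schurCoeff (lastOr μ s) α) V)
  expansion = product-expansion π ρ
  last∈ : ∀ {s} → s ∈ V → lastOr μ s ∈ partitionsOf n
  last∈ s∈ with ps , refl , v ← sound (Enum-valid μ ν π ρ) s∈ = complete (Enum-partitionsOf n) (Valid-last π v)
  coefficients : ∀ c → (∀ α → schurProdCoeff μ ν α ≡ sum (map (λ la → c la * schurCoeff la α) (partitionsOf n))) →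
    ∀ la → T (isPartition la) → size la ≡ n → c la ≡ length (filterᵇ (λ s → validSeq μ ν s ∧ eqList (lastOr μ s) la) (candidates μ ν))
  coefficients c eq la hla e = trans
    (schur-independent n c N (λ α → trans (sym (eq α)) (trans (expansion α)
      (regroup (lastOr μ) (λ p → schurCoeff p α) (unique (Enum-partitionsOf n)) V last∈))) la (Par⁻ la hla) e)
    (cong length (sym (filterᵇ-∧ (validSeq μ ν) (λ s → eqList (lastOr μ s) la) (candidates μ ν))))
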